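{- For every constant $c\ge 1$ there is a constant $C>0$ (depending only on $c$) such that every graph $G=(V,E)$ with $n=|V|\ge 2$ vertices, minimum degree $\delta$ and maximum degree $\Delta\le c\,\delta$ satisfies $$\mathcal{R}(G)\;\ge\; C\cdot\frac{\delta^2}{n}\cdot\frac{1}{\log n}.$$
   Context: Graphs are finite, undirected, simple and connected. A random walk on $G$ moves at each step from its current vertex to a neighbor chosen uniformly at random. The cover time $\mathsf{COV}(s)$ is the expected number of steps for the walk started at $s$ to visit all vertices, and $\mathsf{COV}(G)=\max_{s\in V}\mathsf{COV}(s)$. Randomized broadcast algorithm $\mathsf{RBA}$ (push algorithm): at time $0$ only a vertex $s$ knows a rumor; at each time step $t=1,2,\dots$ every vertex that knows the rumor chooses, independently, a neighbor uniformly at random and informs it. $I_t$ is the set of informed vertices at time $t$ ($I_0=\{s\}$). The expected broadcast time is $\mathbf{E}[\mathsf{RBA}(G)]:=\max_{s\in V}\mathbf{E}[\min\{t: I_t=V\}\text{ with } I_0=\{s\}]$. Finally $\mathcal{R}(G):=\mathsf{COV}(G)/\mathbf{E}[\mathsf{RBA}(G)]$. -}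

module Defs where

open import Data.Bool.Base using (Bool; true; false; if_then_else_; T)
import Data.Bool.Properties as Boolₚ
open import Data.Fin.Base using (Fin; zero; suc)
open import Data.Fin.Properties using (all?; ¬∀⟶∃¬)
open import Data.Fin.Subset as Subset using (Subset; ⊤; ⁅_⁆; _∪_; ⋃; _∈_; _∉_; _⊆_; Nonempty)
open import Data.Fin.Subset.Properties as Subₚ using (_∈?_)
open import Data.Integer.Base as ℤ using (-[1+_])
import Data.Integer.Properties as ℤₚ
open import Data.List.Base using (List; []; _∷_; map; foldr; length; filter; allFin; cartesianProductWith)
open import Data.List.Extrema.Nat using (min; max)
open import Data.List.Membership.Propositional using () renaming (_∈_ to _∈ˡ_)
import Data.List.Membership.Propositional.Properties as ∈ₚ
import Data.List.Properties as Listₚ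
open import Data.List.Relation.Unary.Any using (here; there)
open import Data.Nat.Base as ℕ using (ℕ; zero; suc)
import Data.Nat.Properties as ℕₚ
open import Data.Product.Base using (∃-syntax; _×_; _,_; proj₁; proj₂)
open import Data.Rational.Base using (ℚ; mkℚ; 0ℚ; 1ℚ; ½; _+_; _*_; _-_; -_; _≤_; _<_; _⊔_; ∣_∣; 1/_; ↥_; ↧_; ↧ₙ_; *≤*; *<*; positive; nonNegative; toℚᵘ; ≢-nonZero)
open import Data.Rational.Literals using (fromℤ)
open import Data.Rational.Properties
open import Data.Rational.Solver using (module +-*-Solver)
import Data.Rational.Unnormalised.Base as ℚᵘ
import Data.Rational.Unnormalised.Properties as ℚᵘₚ
open import Data.Sum.Base using (_⊎_; inj₁; inj₂)
import Data.Vec.Properties as Vecₚ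
open import Function.Base using (_∘_; id)
open import Relation.Binary.Construct.Closure.ReflexiveTransitive as Star using (Star)
open import Relation.Binary.PropositionalEquality.Core using (_≡_; _≢_; refl; sym; trans; cong; cong₂; subst; subst₂)
open import Relation.Binary.PropositionalEquality.Properties using (module ≡-Reasoning)
open import Relation.Nullary.Decidable using (Dec; yes; no; does; dec-true; dec-false; T?)
open import Relation.Nullary.Negation.Core using (contradiction; ¬_)

open +-*-Solver using (solve; _:+_; _:*_; _:-_; :-_; _:=_; con)

ι : ℕ → ℚ
ι n = fromℤ (ℤ.+ n)

infixr 8 _^ℚ_
_^ℚ_ : ℚ → ℕ → ℚ
q ^ℚ zero  = 1ℚ
q ^ℚ suc n = q * q ^ℚ n

-- Junk value: inv 0 = 0.
inv : ℚ → ℚ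
inv p with p ≟ 0ℚ
... | yes _   = 0ℚ
... | no p≢0 = (1/ p) {{≢-nonZero p≢0}}

-- Σ< N f = f 0 + ⋯ + f (N - 1)
Σ< : ℕ → (ℕ → ℚ) → ℚ
Σ< zero    f = 0ℚ
Σ< (suc N) f = Σ< N f + f N

≤-by : ∀ {x y} r → y ≡ x + r → 0ℚ ≤ r → x ≤ y
≤-by {x} r refl 0≤r = subst (_≤ x + r) (+-identityʳ x) (+-monoʳ-≤ x 0≤r)

diff≥0 : ∀ {x y} → x ≤ y → 0ℚ ≤ y - x
diff≥0 {x} {y} x≤y = subst (_≤ y - x) (+-inverseʳ x) (+-monoˡ-≤ (- x) x≤y)

diff>0 : ∀ {x y} → x < y → 0ℚ < y - x
diff>0 {x} {y} x<y = subst (_< y - x) (+-inverseʳ x) (+-monoˡ-< (- x) x<y)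

+≥0 : ∀ {x y} → 0ℚ ≤ x → 0ℚ ≤ y → 0ℚ ≤ x + y
+≥0 = +-mono-≤

*≥0 : ∀ {x y} → 0ℚ ≤ x → 0ℚ ≤ y → 0ℚ ≤ x * y
*≥0 {x} {y} 0≤x 0≤y = subst (_≤ x * y) (*-zeroʳ x) (*-monoˡ-≤-nonNeg x {{nonNegative 0≤x}} 0≤y)

*>0 : ∀ {x y} → 0ℚ < x → 0ℚ < y → 0ℚ < x * y
*>0 {x} {y} 0<x 0<y = subst (_< x * y) (*-zeroʳ x) (*-monoʳ-<-pos x {{positive 0<x}} 0<y)

*-monoˡ : ∀ {x y} r → 0ℚ ≤ r → x ≤ y → r * x ≤ r * y
*-monoˡ r 0≤r = *-monoˡ-≤-nonNeg r {{nonNegative 0≤r}}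

*-monoʳ : ∀ {x y} r → 0ℚ ≤ r → x ≤ y → x * r ≤ y * r
*-monoʳ r 0≤r = *-monoʳ-≤-nonNeg r {{nonNegative 0≤r}}

0<1 : 0ℚ < 1ℚ
0<1 = positive⁻¹ 1ℚ

0≤1 : 0ℚ ≤ 1ℚ
0≤1 = <⇒≤ 0<1

0<½ : 0ℚ < ½
0<½ = positive⁻¹ ½

½+½ : ∀ x → ½ * x + ½ * x ≡ x
½+½ = solve 1 (λ x → con ½ :* x :+ con ½ :* x := x) refl

ι≥0 : ∀ n → 0ℚ ≤ ι n
ι≥0 n = nonNegative⁻¹ (ι n)

ι-suc : ∀ n → ι (suc n) ≡ 1ℚ + ι n
ι-suc n = toℚᵘ-injective (ℚᵘₚ.≃-trans lem (ℚᵘₚ.≃-sym (toℚᵘ-homo-+ 1ℚ (ι n))))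
  where
  lem : toℚᵘ (ι (suc n)) ℚᵘ.≃ (toℚᵘ 1ℚ ℚᵘ.+ toℚᵘ (ι n))
  lem = ℚᵘ.*≡* (cong (λ z → (ℤ.1ℤ ℤ.+ z) ℤ.* ℤ.1ℤ) (sym (ℤₚ.*-identityʳ (ℤ.+ n))))

ι-+ : ∀ m n → ι (m ℕ.+ n) ≡ ι m + ι n
ι-+ zero    n = sym (+-identityˡ (ι n))
ι-+ (suc m) n = begin
  ι (suc (m ℕ.+ n))  ≡⟨ ι-suc (m ℕ.+ n) ⟩
  1ℚ + ι (m ℕ.+ n)   ≡⟨ cong (1ℚ +_) (ι-+ m n) ⟩
  1ℚ + (ι m + ι n)   ≡⟨ +-assoc 1ℚ (ι m) (ι n) ⟨
  1ℚ + ι m + ι n     ≡⟨ cong (_+ ι n) (ι-suc m) ⟨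
  ι (suc m) + ι n    ∎
  where open ≡-Reasoning

ι-mono : ∀ {m n} → m ℕ.≤ n → ι m ≤ ι n
ι-mono m≤n = *≤* (ℤₚ.*-monoʳ-≤-nonNeg (ℤ.+ 1) (ℤ.+≤+ m≤n))

ι>0 : ∀ {n} → 0 ℕ.< n → 0ℚ < ι n
ι>0 0<n = <-≤-trans 0<1 (ι-mono 0<n)

archimedean : ∀ x {y} → 0ℚ < y → ∃[ j ] x ≤ ι j * y
archimedean x@record{} {y@(mkℚ (ℤ.+ suc k) d c)} _ = j , toℚᵘ-cancel-≤ (ℚᵘₚ.≤-trans lem (ℚᵘₚ.≤-reflexive (ℚᵘₚ.≃-sym (toℚᵘ-homo-* (ι j) y))))
  where
  j = ℤ.∣ ↥ x ∣ ℕ.* suc d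
  a≤∣a∣ : ∀ a → a ℤ.≤ ℤ.+ ℤ.∣ a ∣
  a≤∣a∣ (ℤ.+ n) = ℤₚ.≤-refl
  a≤∣a∣ -[1+ n ] = ℤ.-≤+
  lem : toℚᵘ x ℚᵘ.≤ (toℚᵘ (ι j) ℚᵘ.* toℚᵘ y)
  lem = ℚᵘ.*≤* (ℤₚ.≤-trans
    (ℤₚ.*-monoʳ-≤-nonNeg (ℤ.+ (1 ℕ.* suc d)) (a≤∣a∣ (↥ x)))
    (subst₂ ℤ._≤_ (ℤₚ.pos-* ℤ.∣ ↥ x ∣ (1 ℕ.* suc d))
      (trans (ℤₚ.pos-* (j ℕ.* suc k) (↧ₙ x)) (cong (ℤ._* ↧ x) (ℤₚ.pos-* j (suc k))))
      (ℤ.+≤+ (ℕₚ.≤-trans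
        (ℕₚ.≤-reflexive (cong (ℤ.∣ ↥ x ∣ ℕ.*_) (ℕₚ.*-identityˡ (suc d))))
        (ℕₚ.≤-trans (ℕₚ.m≤m*n j (suc k)) (ℕₚ.m≤m*n (j ℕ.* suc k) (↧ₙ x)))))))
archimedean x {mkℚ (ℤ.+ zero) d c} (*<* (ℤ.+<+ ()))
archimedean x {mkℚ -[1+ k ] d c} (*<* ())

*-inv : ∀ {p} → 0ℚ < p → p * inv p ≡ 1ℚ
*-inv {p} 0<p with p ≟ 0ℚ
... | yes refl = contradiction 0<p (<-irrefl refl)
... | no p≢0  = *-inverseʳ p {{≢-nonZero p≢0}}

inv>0 : ∀ {p} → 0ℚ < p → 0ℚ < inv p
inv>0 {p} 0<p = *-cancelˡ-<-nonNeg p {{nonNegative (<⇒≤ 0<p)}}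
  (subst₂ _<_ (sym (*-zeroʳ p)) (sym (*-inv 0<p)) 0<1)

inv-anti : ∀ {p q} → 0ℚ < p → p ≤ q → inv q ≤ inv p
inv-anti {p} {q} 0<p p≤q = ≤-by ((q - p) * (inv p * inv q)) eq
    (*≥0 (diff≥0 p≤q) (*≥0 (<⇒≤ (inv>0 0<p)) (<⇒≤ (inv>0 0<q))))
  where
  0<q = <-≤-trans 0<p p≤q
  open ≡-Reasoning
  eq : inv p ≡ inv q + (q - p) * (inv p * inv q)
  eq = begin
    inv p                                           ≡⟨ solve 2 (λ a b → a := b :+ (con 1ℚ :* a :- con 1ℚ :* b)) refl (inv p) (inv q) ⟩
    inv q + (1ℚ * inv p - 1ℚ * inv q)               ≡⟨ cong₂ (λ u v → inv q + (u * inv p - v * inv q)) (*-inv 0<q) (*-inv 0<p) ⟨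
    inv q + (q * inv q * inv p - p * inv p * inv q) ≡⟨ solve 4 (λ p q a b → b :+ (q :* b :* a :- p :* a :* b) := b :+ (q :- p) :* (a :* b)) refl p q (inv p) (inv q) ⟩
    inv q + (q - p) * (inv p * inv q)               ∎

^≥0 : ∀ {q} → 0ℚ ≤ q → ∀ n → 0ℚ ≤ q ^ℚ n
^≥0 0≤q zero    = 0≤1
^≥0 0≤q (suc n) = *≥0 0≤q (^≥0 0≤q n)

^>0 : ∀ {q} → 0ℚ < q → ∀ n → 0ℚ < q ^ℚ n
^>0 0<q zero    = 0<1
^>0 0<q (suc n) = *>0 0<q (^>0 0<q n)

bernoulli : ∀ {q} → 0ℚ ≤ q → q ≤ 1ℚ → ∀ j → q ^ℚ j * (1ℚ + ι j * (1ℚ - q)) ≤ 1ℚ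
bernoulli {q} _ _ zero = ≤-reflexive (solve 1 (λ q → con 1ℚ :* (con 1ℚ :+ con 0ℚ :* (con 1ℚ :- q)) := con 1ℚ) refl q)
bernoulli {q} 0≤q q≤1 (suc j) = ≤-trans
  (≤-by (q ^ℚ j * (1ℚ - q) * (1ℚ - q) * (1ℚ + ι j))
     eq
     (*≥0 (*≥0 (*≥0 (^≥0 0≤q j) (diff≥0 q≤1)) (diff≥0 q≤1)) (+≥0 0≤1 (ι≥0 j))))
  (bernoulli 0≤q q≤1 j)
  where
  eq : q ^ℚ j * (1ℚ + ι j * (1ℚ - q)) ≡ q ^ℚ suc j * (1ℚ + ι (suc j) * (1ℚ - q)) + q ^ℚ j * (1ℚ - q) * (1ℚ - q) * (1ℚ + ι j)
  eq rewrite ι-suc j = solve 3 (λ q a j → a :* (con 1ℚ :+ j :* (con 1ℚ :- q)) := (q :* a) :* (con 1ℚ :+ (con 1ℚ :+ j) :* (con 1ℚ :- q)) :+ a :* (con 1ℚ :- q) :* (con 1ℚ :- q) :* (con 1ℚ :+ j)) refl q (q ^ℚ j) (ι j)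

^→0 : ∀ {q} → 0ℚ ≤ q → q < 1ℚ → ∀ B {ε} → 0ℚ < ε → ∃[ j ] q ^ℚ j * B ≤ ε
^→0 {q} 0≤q q<1 B {ε} 0<ε with archimedean B (*>0 (diff>0 q<1) 0<ε)
... | j , B≤ = j , (begin
  q ^ℚ j * B                               ≤⟨ *-monoˡ (q ^ℚ j) (^≥0 0≤q j) B≤ ⟩
  q ^ℚ j * (ι j * ((1ℚ - q) * ε))          ≤⟨ ≤-by (q ^ℚ j * ε) (solve 4 (λ a j q ε → a :* (con 1ℚ :+ j :* (con 1ℚ :- q)) :* ε := a :* (j :* ((con 1ℚ :- q) :* ε)) :+ a :* ε) refl (q ^ℚ j) (ι j) q ε) (*≥0 (^≥0 0≤q j) (<⇒≤ 0<ε)) ⟩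
  q ^ℚ j * (1ℚ + ι j * (1ℚ - q)) * ε       ≤⟨ *-monoʳ ε (<⇒≤ 0<ε) (bernoulli 0≤q (<⇒≤ q<1) j) ⟩
  1ℚ * ε                                  ≡⟨ *-identityˡ ε ⟩
  ε                                       ∎)
  where open ≤-Reasoning

≤∣∣ : ∀ p → p ≤ ∣ p ∣
≤∣∣ p with ≤-total 0ℚ p
... | inj₁ 0≤p = ≤-reflexive (sym (0≤p⇒∣p∣≡p 0≤p))
... | inj₂ p≤0 = ≤-trans p≤0 (0≤∣p∣ p)

∣∣-intro : ∀ p q {ε} → p ≤ q + ε → q ≤ p + ε → ∣ p - q ∣ ≤ ε
∣∣-intro p q {ε} h k with ∣p∣≡p∨∣p∣≡-p (p - q)
... | inj₁ e rewrite e = ≤-by (q + ε - p) (solve 3 (λ p q ε → ε := p :- q :+ (q :+ ε :- p)) refl p q ε) (diff≥0 h)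
... | inj₂ e rewrite e = ≤-by (p + ε - q) (solve 3 (λ p q ε → ε := :- (p :- q) :+ (p :+ ε :- q)) refl p q ε) (diff≥0 k)

∣∣-elim : ∀ p q {ε} → ∣ p - q ∣ ≤ ε → p ≤ q + ε
∣∣-elim p q {ε} h = ≤-by (ε - (p - q)) (solve 3 (λ p q ε → q :+ ε := p :+ (ε :- (p :- q))) refl p q ε) (diff≥0 (≤-trans (≤∣∣ (p - q)) h))

Cauchy : (ℕ → ℚ) → Set
Cauchy a = ∀ ε → 0ℚ < ε → ∃[ N ] (∀ m n → N ℕ.≤ m → N ℕ.≤ n → ∣ a m - a n ∣ ≤ ε)

-- Equality of reals is not _≡_ but x ≤ℝ y together with y ≤ℝ x.
record ℝ : Set where
  constructor mkℝ
  field
    seq    : ℕ → ℚ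
    cauchy : Cauchy seq
open ℝ public

infix 4 _≤ℝ_ _<ℝ_
_≤ℝ_ : ℝ → ℝ → Set
x ≤ℝ y = ∀ ε → 0ℚ < ε → ∃[ N ] (∀ n → N ℕ.≤ n → seq x n ≤ seq y n + ε)

_<ℝ_ : ℝ → ℝ → Set
x <ℝ y = ∃[ ε ] (0ℚ < ε × ∃[ N ] (∀ n → N ℕ.≤ n → seq x n + ε ≤ seq y n))

fromℚ : ℚ → ℝ
fromℚ q = mkℝ (λ _ → q) λ ε 0<ε → 0 , λ _ _ _ _ → ≤-trans (≤-reflexive (cong ∣_∣ (+-inverseʳ q))) (<⇒≤ 0<ε)

fromℕ : ℕ → ℝ
fromℕ n = fromℚ (ι n)

0ℝ 1ℝ : ℝ
0ℝ = fromℚ 0ℚ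
1ℝ = fromℚ 1ℚ

_⊔ℝ_ : ℝ → ℝ → ℝ
x ⊔ℝ y = mkℝ (λ n → seq x n ⊔ seq y n) λ ε 0<ε →
  let N₁ , h₁ = cauchy x ε 0<ε
      N₂ , h₂ = cauchy y ε 0<ε
      bound : ∀ m n → N₁ ℕ.⊔ N₂ ℕ.≤ m → N₁ ℕ.⊔ N₂ ℕ.≤ n → seq x m ⊔ seq y m ≤ (seq x n ⊔ seq y n) + ε
      bound m n N≤m N≤n = ⊔-lub {_} {seq x m} {seq y m}
        (≤-trans (∣∣-elim (seq x m) (seq x n) (h₁ m n (ℕₚ.m⊔n≤o⇒m≤o N₁ N₂ N≤m) (ℕₚ.m⊔n≤o⇒m≤o N₁ N₂ N≤n))) (+-monoˡ-≤ ε (p≤p⊔q (seq x n) (seq y n))))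
        (≤-trans (∣∣-elim (seq y m) (seq y n) (h₂ m n (ℕₚ.m⊔n≤o⇒n≤o N₁ N₂ N≤m) (ℕₚ.m⊔n≤o⇒n≤o N₁ N₂ N≤n))) (+-monoˡ-≤ ε (p≤q⊔p (seq x n) (seq y n))))
  in N₁ ℕ.⊔ N₂ , λ m n N≤m N≤n → ∣∣-intro (seq x m ⊔ seq y m) (seq x n ⊔ seq y n) (bound m n N≤m N≤n) (bound n m N≤n N≤m)

eventually-bounded : ∀ x → ∃[ B ] ∃[ N ] (0ℚ < B × (∀ n → N ℕ.≤ n → ∣ seq x n ∣ ≤ B))
eventually-bounded x with cauchy x 1ℚ 0<1
... | N , h = B , N , 0<B , bound
  where
  B = 1ℚ + ∣ seq x N ∣
  0<B : 0ℚ < B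
  0<B = <-≤-trans 0<1 (≤-by ∣ seq x N ∣ refl (0≤∣p∣ (seq x N)))
  open ≤-Reasoning
  bound : ∀ n → N ℕ.≤ n → ∣ seq x n ∣ ≤ B
  bound n N≤n = begin
    ∣ seq x n ∣                         ≡⟨ cong ∣_∣ (solve 2 (λ a b → a := (a :- b) :+ b) refl (seq x n) (seq x N)) ⟩
    ∣ (seq x n - seq x N) + seq x N ∣   ≤⟨ ∣p+q∣≤∣p∣+∣q∣ (seq x n - seq x N) (seq x N) ⟩
    ∣ seq x n - seq x N ∣ + ∣ seq x N ∣ ≤⟨ +-monoˡ-≤ ∣ seq x N ∣ (h n N N≤n ℕₚ.≤-refl) ⟩
    B                                   ∎

∣*∣-≤ : ∀ u v {B η} → 0ℚ ≤ B → ∣ u ∣ ≤ B → ∣ v ∣ ≤ η → ∣ u * v ∣ ≤ B * η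
∣*∣-≤ u v {B} {η} 0≤B u≤B v≤η = begin
  ∣ u * v ∣      ≡⟨ ∣p*q∣≡∣p∣*∣q∣ u v ⟩
  ∣ u ∣ * ∣ v ∣  ≤⟨ *-monoʳ ∣ v ∣ (0≤∣p∣ v) u≤B ⟩
  B * ∣ v ∣      ≤⟨ *-monoˡ B 0≤B v≤η ⟩
  B * η          ∎
  where open ≤-Reasoning

*-inv-cancel : ∀ e {b} → 0ℚ < b → b * (e * inv b) ≡ e
*-inv-cancel e {b} 0<b = begin
  b * (e * inv b)  ≡⟨ solve 3 (λ b e i → b :* (e :* i) := e :* (b :* i)) refl b e (inv b) ⟩
  e * (b * inv b)  ≡⟨ cong (e *_) (*-inv 0<b) ⟩
  e * 1ℚ           ≡⟨ *-identityʳ e ⟩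
  e                ∎
  where open ≡-Reasoning

∣*-*∣-≤ : ∀ a b c d {B C η θ} → 0ℚ ≤ B → 0ℚ ≤ C → ∣ a ∣ ≤ B → ∣ d ∣ ≤ C →
          ∣ b - d ∣ ≤ η → ∣ a - c ∣ ≤ θ → ∣ a * b - c * d ∣ ≤ B * η + C * θ
∣*-*∣-≤ a b c d {B} {C} {η} {θ} 0≤B 0≤C a≤B d≤C b-d a-c = begin
  ∣ a * b - c * d ∣                 ≡⟨ cong ∣_∣ (solve 4 (λ a b c d → a :* b :- c :* d := a :* (b :- d) :+ d :* (a :- c)) refl a b c d) ⟩
  ∣ a * (b - d) + d * (a - c) ∣     ≤⟨ ∣p+q∣≤∣p∣+∣q∣ (a * (b - d)) (d * (a - c)) ⟩
  ∣ a * (b - d) ∣ + ∣ d * (a - c) ∣ ≤⟨ +-mono-≤ (∣*∣-≤ a (b - d) 0≤B a≤B b-d) (∣*∣-≤ d (a - c) 0≤C d≤C a-c) ⟩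
  B * η + C * θ                     ∎
  where open ≤-Reasoning

*-cauchy : ∀ x y → Cauchy (λ n → seq x n * seq y n)
*-cauchy x y ε 0<ε = N , λ m n N≤m N≤n → subst (∣ seq x m * seq y m - seq x n * seq y n ∣ ≤_) simp
    (∣*-*∣-≤ (seq x m) (seq y m) (seq x n) (seq y n) (<⇒≤ 0<B) (<⇒≤ 0<C)
      (hB m (ℕₚ.≤-trans N₁≤N N≤m)) (hC n (ℕₚ.≤-trans N₂≤N N≤n))
      (proj₂ cy m n (ℕₚ.≤-trans N₃≤N N≤m) (ℕₚ.≤-trans N₃≤N N≤n))
      (proj₂ cx m n (ℕₚ.≤-trans N₄≤N N≤m) (ℕₚ.≤-trans N₄≤N N≤n)))
  where
  bx = eventually-bounded x
  by = eventually-bounded y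
  B C e : ℚ
  B = proj₁ bx
  C = proj₁ by
  e = ½ * ε
  0<B : 0ℚ < B
  0<B = proj₁ (proj₂ (proj₂ bx))
  0<C : 0ℚ < C
  0<C = proj₁ (proj₂ (proj₂ by))
  hB = proj₂ (proj₂ (proj₂ bx))
  hC = proj₂ (proj₂ (proj₂ by))
  cy = cauchy y (e * inv B) (*>0 (*>0 0<½ 0<ε) (inv>0 0<B))
  cx = cauchy x (e * inv C) (*>0 (*>0 0<½ 0<ε) (inv>0 0<C))
  N₁ N₂ N₃ N₄ N : ℕ
  N₁ = proj₁ (proj₂ bx)
  N₂ = proj₁ (proj₂ by)
  N₃ = proj₁ cy
  N₄ = proj₁ cx
  N  = N₁ ℕ.+ (N₂ ℕ.+ (N₃ ℕ.+ N₄))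
  N₁≤N : N₁ ℕ.≤ N
  N₁≤N = ℕₚ.m≤m+n N₁ _
  N₂≤N : N₂ ℕ.≤ N
  N₂≤N = ℕₚ.≤-trans (ℕₚ.m≤m+n N₂ _) (ℕₚ.m≤n+m _ N₁)
  N₃₄≤N : N₃ ℕ.+ N₄ ℕ.≤ N
  N₃₄≤N = ℕₚ.≤-trans (ℕₚ.m≤n+m _ N₂) (ℕₚ.m≤n+m _ N₁)
  N₃≤N : N₃ ℕ.≤ N
  N₃≤N = ℕₚ.≤-trans (ℕₚ.m≤m+n N₃ _) N₃₄≤N
  N₄≤N : N₄ ℕ.≤ N
  N₄≤N = ℕₚ.≤-trans (ℕₚ.m≤n+m N₄ N₃) N₃₄≤N
  simp : B * (e * inv B) + C * (e * inv C) ≡ ε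
  simp = trans (cong₂ _+_ (*-inv-cancel e 0<B) (*-inv-cancel e 0<C)) (½+½ ε)

infixl 7 _*ℝ_
_*ℝ_ : ℝ → ℝ → ℝ
x *ℝ y = mkℝ (λ n → seq x n * seq y n) (*-cauchy x y)

-- inv is applied to entries that may vanish, but only before the index from
-- which the sequence is bounded away from 0.
recip : (x : ℝ) → 0ℝ <ℝ x → ℝ
recip x (e , 0<e , N₁ , e≤) = mkℝ (λ n → inv (seq x n)) prf
  where
  prf : Cauchy (λ n → inv (seq x n))
  prf ε 0<ε with cauchy x (ε * (e * e)) (*>0 0<ε (*>0 0<e 0<e))
  ... | N₂ , h = N₁ ℕ.⊔ N₂ , λ m n N≤m N≤n → ∣∣-intro (inv (seq x m)) (inv (seq x n)) (bound m n N≤m N≤n) (bound n m N≤n N≤m)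
    where
    bound : ∀ m n → N₁ ℕ.⊔ N₂ ℕ.≤ m → N₁ ℕ.⊔ N₂ ℕ.≤ n → inv (seq x m) ≤ inv (seq x n) + ε
    bound m n N≤m N≤n = begin
        inv a                             ≡⟨ solve 2 (λ a b → a := b :+ (con 1ℚ :* a :- con 1ℚ :* b)) refl (inv a) (inv b) ⟩
        inv b + (1ℚ * inv a - 1ℚ * inv b) ≡⟨ cong₂ (λ u v → inv b + (u * inv a - v * inv b)) (*-inv 0<b) (*-inv 0<a) ⟨
        inv b + (b * inv b * inv a - a * inv a * inv b)
          ≡⟨ solve 4 (λ a b u v → v :+ (b :* v :* u :- a :* u :* v) := v :+ (b :- a) :* (u :* v)) refl a b (inv a) (inv b) ⟩
        inv b + (b - a) * (inv a * inv b) ≤⟨ +-monoʳ-≤ (inv b) (*-monoʳ (inv a * inv b) (*≥0 0≤ia 0≤ib) (≤-trans (≤∣∣ (b - a)) (h n m (le₂ N≤n) (le₂ N≤m)))) ⟩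
        inv b + ε * (e * e) * (inv a * inv b) ≡⟨ cong (λ z → inv b + z) (solve 4 (λ ε e u v → ε :* (e :* e) :* (u :* v) := ε :* ((e :* u) :* (e :* v))) refl ε e (inv a) (inv b)) ⟩
        inv b + ε * ((e * inv a) * (e * inv b)) ≤⟨ +-monoʳ-≤ (inv b) (*-monoˡ ε (<⇒≤ 0<ε) (≤-trans (*-monoʳ (e * inv b) (*≥0 (<⇒≤ 0<e) 0≤ib) (one a 0<a e≤a)) (*-monoˡ 1ℚ 0≤1 (one b 0<b e≤b)))) ⟩
        inv b + ε * (1ℚ * 1ℚ)             ≡⟨ cong (inv b +_) (*-identityʳ ε) ⟩
        inv b + ε                         ∎
      where
      open ≤-Reasoning
      a = seq x m
      b = seq x n
      le₁ : ∀ {k} → N₁ ℕ.⊔ N₂ ℕ.≤ k → N₁ ℕ.≤ k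
      le₁ = ℕₚ.m⊔n≤o⇒m≤o N₁ N₂
      le₂ : ∀ {k} → N₁ ℕ.⊔ N₂ ℕ.≤ k → N₂ ℕ.≤ k
      le₂ = ℕₚ.m⊔n≤o⇒n≤o N₁ N₂
      e≤′ : ∀ k → N₁ ℕ.≤ k → e ≤ seq x k
      e≤′ k N≤k = subst (_≤ seq x k) (+-identityˡ e) (e≤ k N≤k)
      e≤a = e≤′ m (le₁ N≤m)
      e≤b = e≤′ n (le₁ N≤n)
      0<a = <-≤-trans 0<e e≤a
      0<b = <-≤-trans 0<e e≤b
      0≤ia = <⇒≤ (inv>0 0<a)
      0≤ib = <⇒≤ (inv>0 0<b)
      one : ∀ c → 0ℚ < c → e ≤ c → e * inv c ≤ 1ℚ
      one c 0<c e≤c = subst (e * inv c ≤_) (*-inv 0<c) (*-monoʳ (inv c) (<⇒≤ (inv>0 0<c)) e≤c)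

infixl 7 _÷_[_]
_÷_[_] : (x y : ℝ) → 0ℝ <ℝ y → ℝ
x ÷ y [ 0<y ] = x *ℝ recip y 0<y

Σ-mono : ∀ {f g : ℕ → ℚ} N → (∀ i → f i ≤ g i) → Σ< N f ≤ Σ< N g
Σ-mono zero    h = ≤-refl
Σ-mono (suc N) h = +-mono-≤ (Σ-mono N h) (h N)

Σ-cong : ∀ {f g : ℕ → ℚ} N → (∀ i → f i ≡ g i) → Σ< N f ≡ Σ< N g
Σ-cong zero    h = refl
Σ-cong (suc N) h = cong₂ _+_ (Σ-cong N h) (h N)

Σ≥0 : ∀ {f : ℕ → ℚ} N → (∀ i → 0ℚ ≤ f i) → 0ℚ ≤ Σ< N f
Σ≥0 zero    h = ≤-refl
Σ≥0 (suc N) h = +≥0 (Σ≥0 N h) (h N)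

Σ-* : ∀ q (f : ℕ → ℚ) N → Σ< N (λ i → q * f i) ≡ q * Σ< N f
Σ-* q f zero    = sym (*-zeroʳ q)
Σ-* q f (suc N) = trans (cong (_+ q * f N) (Σ-* q f N)) (sym (*-distribˡ-+ q (Σ< N f) (f N)))

Σ-split : ∀ (f : ℕ → ℚ) N M → Σ< (N ℕ.+ M) f ≡ Σ< M f + Σ< N (λ i → f (i ℕ.+ M))
Σ-split f zero    M = sym (+-identityʳ (Σ< M f))
Σ-split f (suc N) M = trans (cong (_+ f (N ℕ.+ M)) (Σ-split f N M)) (+-assoc (Σ< M f) _ _)

Σ-mono-range : ∀ {f : ℕ → ℚ} → (∀ i → 0ℚ ≤ f i) → ∀ {M N} → M ℕ.≤ N → Σ< M f ≤ Σ< N f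
Σ-mono-range {f} h {M} {N} M≤N = subst (λ k → Σ< M f ≤ Σ< k f) (ℕₚ.m∸n+n≡m M≤N)
  (≤-by _ (Σ-split f (N ℕ.∸ M) M) (Σ≥0 (N ℕ.∸ M) (λ i → h (i ℕ.+ M))))

series>0 : ∀ {f : ℕ → ℚ} → (∀ i → 0ℚ ≤ f i) → ∀ i → 0ℚ < f i →
           ∃[ e ] (0ℚ < e × ∃[ N ] (∀ n → N ℕ.≤ n → 0ℚ + e ≤ Σ< n f))
series>0 {f} f≥0 i fi>0 = f i , fi>0 , suc i , λ n i<n →
  ≤-trans (+-monoˡ-≤ (f i) (Σ≥0 i f≥0)) (Σ-mono-range f≥0 i<n)

-- Comparison of Σ b with a series whose terms shrink by a factor q < 1 every K
-- indices.
module _ {b d : ℕ → ℚ} (0≤b : ∀ t → 0ℚ ≤ b t) (b≤d : ∀ t → b t ≤ d t)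
         {q : ℚ} (0≤q : 0ℚ ≤ q) (q<1 : q < 1ℚ)
         (K : ℕ) (decay : ∀ t → d (t ℕ.+ K) ≤ q * d t) where

  private
    0≤d : ∀ t → 0ℚ ≤ d t
    0≤d t = ≤-trans (0≤b t) (b≤d t)

    B : ℚ
    B = Σ< K d * inv (1ℚ - q)

    0<1-q = diff>0 q<1

    open ≤-Reasoning

    bounded : ∀ N → Σ< N d ≤ B
    bounded N = begin
      Σ< N d                             ≡⟨ *-identityˡ _ ⟨
      1ℚ * Σ< N d                        ≡⟨ cong (_* Σ< N d) (*-inv 0<1-q) ⟨
      (1ℚ - q) * inv (1ℚ - q) * Σ< N d   ≡⟨ solve 3 (λ p i s → p :* i :* s := p :* s :* i) refl (1ℚ - q) (inv (1ℚ - q)) (Σ< N d) ⟩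
      (1ℚ - q) * Σ< N d * inv (1ℚ - q)   ≤⟨ *-monoʳ (inv (1ℚ - q)) (<⇒≤ (inv>0 0<1-q)) step ⟩
      B                                  ∎
      where
      total : Σ< N d ≤ Σ< K d + q * Σ< N d
      total = begin
        Σ< N d                                    ≤⟨ Σ-mono-range 0≤d (ℕₚ.m≤m+n N K) ⟩
        Σ< (N ℕ.+ K) d                            ≡⟨ Σ-split d N K ⟩
        Σ< K d + Σ< N (λ i → d (i ℕ.+ K))         ≤⟨ +-monoʳ-≤ (Σ< K d) (Σ-mono N decay) ⟩
        Σ< K d + Σ< N (λ i → q * d i)             ≡⟨ cong (Σ< K d +_) (Σ-* q d N) ⟩
        Σ< K d + q * Σ< N d                       ∎
      step : (1ℚ - q) * Σ< N d ≤ Σ< K d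
      step = ≤-by (Σ< K d + q * Σ< N d - Σ< N d)
        (solve 3 (λ k q s → k := (con 1ℚ :- q) :* s :+ (k :+ q :* s :- s)) refl (Σ< K d) q (Σ< N d))
        (diff≥0 total)

    tail : ∀ j N → Σ< N (λ i → d (i ℕ.+ j ℕ.* K)) ≤ q ^ℚ j * B
    tail zero    N = begin
      Σ< N (λ i → d (i ℕ.+ 0)) ≡⟨ Σ-cong N (λ i → cong d (ℕₚ.+-identityʳ i)) ⟩
      Σ< N d                   ≤⟨ bounded N ⟩
      B                        ≡⟨ *-identityˡ B ⟨
      1ℚ * B                   ∎
    tail (suc j) N = begin
      Σ< N (λ i → d (i ℕ.+ (K ℕ.+ j ℕ.* K)))   ≡⟨ Σ-cong N (λ i → cong d (trans (cong (i ℕ.+_) (ℕₚ.+-comm K (j ℕ.* K))) (sym (ℕₚ.+-assoc i (j ℕ.* K) K)))) ⟩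
      Σ< N (λ i → d ((i ℕ.+ j ℕ.* K) ℕ.+ K))   ≤⟨ Σ-mono N (λ i → decay (i ℕ.+ j ℕ.* K)) ⟩
      Σ< N (λ i → q * d (i ℕ.+ j ℕ.* K))       ≡⟨ Σ-* q (λ i → d (i ℕ.+ j ℕ.* K)) N ⟩
      q * Σ< N (λ i → d (i ℕ.+ j ℕ.* K))       ≤⟨ *-monoˡ q 0≤q (tail j N) ⟩
      q * (q ^ℚ j * B)                          ≡⟨ *-assoc q (q ^ℚ j) B ⟨
      q ^ℚ suc j * B                            ∎

  series-cauchy : Cauchy (λ N → Σ< N b)
  series-cauchy ε 0<ε = M , λ m n N≤m N≤n → ∣∣-intro (Σ< m b) (Σ< n b) (bound m n N≤m N≤n) (bound n m N≤n N≤m)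
    where
    jp = ^→0 0≤q q<1 B 0<ε
    j M : ℕ
    j = proj₁ jp
    M = j ℕ.* K
    small : q ^ℚ j * B ≤ ε
    small = proj₂ jp
    bound : ∀ m n → M ℕ.≤ m → M ℕ.≤ n → Σ< m b ≤ Σ< n b + ε
    bound m n M≤m M≤n = begin
      Σ< m b                                         ≡⟨ cong (λ k → Σ< k b) (ℕₚ.m∸n+n≡m M≤m) ⟨
      Σ< ((m ℕ.∸ M) ℕ.+ M) b                         ≡⟨ Σ-split b (m ℕ.∸ M) M ⟩
      Σ< M b + Σ< (m ℕ.∸ M) (λ i → b (i ℕ.+ M))      ≤⟨ +-mono-≤ (Σ-mono-range 0≤b M≤n) (Σ-mono (m ℕ.∸ M) (λ i → b≤d (i ℕ.+ M))) ⟩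
      Σ< n b + Σ< (m ℕ.∸ M) (λ i → d (i ℕ.+ M))      ≤⟨ +-monoʳ-≤ (Σ< n b) (≤-trans (tail j (m ℕ.∸ M)) small) ⟩
      Σ< n b + ε                                     ∎

-- Natural logarithm of n = m + 1 from the Mercator series
-- -ln (1 - r) = Σ_{j ≥ 1} r ^ j / j at r = 1 - 1 / n = m / (m + 1);
-- log-term m j is the summand of index j + 1.
log-ratio : ℕ → ℚ
log-ratio m = ι m * inv (ι (suc m))

log-term : ℕ → ℕ → ℚ
log-term m j = log-ratio m ^ℚ suc j * inv (ι (suc j))

0<ι-suc : ∀ n → 0ℚ < ι (suc n)
0<ι-suc n = ι>0 {suc n} (ℕ.s≤s ℕ.z≤n)

log-ratio≥0 : ∀ m → 0ℚ ≤ log-ratio m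
log-ratio≥0 m = *≥0 (ι≥0 m) (<⇒≤ (inv>0 (0<ι-suc m)))

log-ratio<1 : ∀ m → log-ratio m < 1ℚ
log-ratio<1 m = subst (log-ratio m <_) (*-inv (0<ι-suc m))
  (*-monoˡ-<-pos (inv (ι (suc m))) {{positive (inv>0 (0<ι-suc m))}}
    (subst₂ _<_ (+-identityˡ (ι m)) (sym (ι-suc m)) (+-monoˡ-< (ι m) 0<1)))

log-term≥0 : ∀ m j → 0ℚ ≤ log-term m j
log-term≥0 m j = *≥0 (^≥0 (log-ratio≥0 m) (suc j)) (<⇒≤ (inv>0 (0<ι-suc j)))

log-cauchy : ∀ m → Cauchy (λ N → Σ< N (log-term m))
log-cauchy m = series-cauchy (log-term≥0 m) (λ _ → ≤-refl) (log-ratio≥0 m) (log-ratio<1 m) 1 decay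
  where
  r = log-ratio m
  open ≤-Reasoning
  decay : ∀ j → log-term m (j ℕ.+ 1) ≤ r * log-term m j
  decay j rewrite ℕₚ.+-comm j 1 = begin
    r * r ^ℚ suc j * inv (ι (suc (suc j))) ≤⟨ *-monoˡ (r * r ^ℚ suc j) (*≥0 (log-ratio≥0 m) (^≥0 (log-ratio≥0 m) (suc j))) (inv-anti (0<ι-suc j) (ι-mono (ℕₚ.n≤1+n (suc j)))) ⟩
    r * r ^ℚ suc j * inv (ι (suc j))       ≡⟨ *-assoc r (r ^ℚ suc j) _ ⟩
    r * (r ^ℚ suc j * inv (ι (suc j)))     ∎

-- Junk value: log 0 = 0.
log : ℕ → ℝ
log zero    = 0ℝ
log (suc m) = mkℝ (λ N → Σ< N (log-term m)) (log-cauchy m)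

log>0 : ∀ {n} → 2 ℕ.≤ n → 0ℝ <ℝ log n
log>0 {suc m} (ℕ.s≤s 1≤m) = series>0 (log-term≥0 m) 0 pos
  where
  pos : 0ℚ < log-term m 0
  pos = *>0 (^>0 (*>0 (ι>0 1≤m) (inv>0 (0<ι-suc m))) 1) (inv>0 (0<ι-suc 0))

fromℕ>0 : ∀ {n} → 1 ℕ.≤ n → 0ℝ <ℝ fromℕ n
fromℕ>0 {n} 1≤n = ι n , ι>0 1≤n , 0 , λ _ _ → ≤-reflexive (+-identityˡ (ι n))

sumOver : {A : Set} → (A → ℚ) → List A → ℚ
sumOver f []       = 0ℚ
sumOver f (x ∷ xs) = f x + sumOver f xs

-- Expectation of f at a uniformly random entry of the list, repeated entries
-- counted with multiplicity.  Junk value: 0 on the empty list.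
average : {A : Set} → (A → ℚ) → List A → ℚ
average f xs = sumOver f xs * inv (ι (length xs))

module _ {A : Set} where

  invlen≥0 : (xs : List A) → 0ℚ ≤ inv (ι (length xs))
  invlen≥0 []       = ≤-refl
  invlen≥0 (x ∷ xs) = <⇒≤ (inv>0 (0<ι-suc (length xs)))

  sumOver-mono : ∀ {f g : A → ℚ} xs → (∀ {x} → x ∈ˡ xs → f x ≤ g x) → sumOver f xs ≤ sumOver g xs
  sumOver-mono []       h = ≤-refl
  sumOver-mono (x ∷ xs) h = +-mono-≤ (h (here refl)) (sumOver-mono xs (h ∘ there))

  sumOver-≥0 : ∀ {f : A → ℚ} xs → (∀ x → 0ℚ ≤ f x) → 0ℚ ≤ sumOver f xs
  sumOver-≥0 []       h = ≤-refl
  sumOver-≥0 (x ∷ xs) h = +≥0 (h x) (sumOver-≥0 xs h)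

  sumOver-* : ∀ q (f : A → ℚ) xs → sumOver (λ x → q * f x) xs ≡ q * sumOver f xs
  sumOver-* q f []       = sym (*-zeroʳ q)
  sumOver-* q f (x ∷ xs) = trans (cong (q * f x +_) (sumOver-* q f xs)) (sym (*-distribˡ-+ q (f x) (sumOver f xs)))

  sumOver-≤-length : ∀ {f : A → ℚ} xs → (∀ x → f x ≤ 1ℚ) → sumOver f xs ≤ ι (length xs)
  sumOver-≤-length []       h = ≤-refl
  sumOver-≤-length (x ∷ xs) h = ≤-trans (+-mono-≤ (h x) (sumOver-≤-length xs h)) (≤-reflexive (sym (ι-suc (length xs))))

  sumOver-deficit : ∀ {f : A → ℚ} {x} δ xs → (∀ x → f x ≤ 1ℚ) → x ∈ˡ xs → f x ≤ 1ℚ - δ →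
                    sumOver f xs ≤ ι (length xs) - δ
  sumOver-deficit {f} {x} δ (_ ∷ xs) h (here refl) fx = ≤-trans (+-mono-≤ fx (sumOver-≤-length xs h))
    (≤-reflexive (trans (solve 2 (λ d l → con 1ℚ :- d :+ l := con 1ℚ :+ l :- d) refl δ (ι (length xs)))
      (cong (_- δ) (sym (ι-suc (length xs))))))
  sumOver-deficit {f} {x} δ (y ∷ xs) h (there x∈) fx = ≤-trans (+-mono-≤ (h y) (sumOver-deficit δ xs h x∈ fx))
    (≤-reflexive (trans (sym (+-assoc 1ℚ (ι (length xs)) (- δ)))
      (cong (_- δ) (sym (ι-suc (length xs))))))

  sumOver->0 : ∀ {f : A → ℚ} {x} xs → (∀ x → 0ℚ ≤ f x) → x ∈ˡ xs → 0ℚ < f x → 0ℚ < sumOver f xs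
  sumOver->0 (_ ∷ xs) h (here refl) fx = +-mono-<-≤ fx (sumOver-≥0 xs h)
  sumOver->0 (y ∷ xs) h (there x∈)  fx = +-mono-≤-< (h y) (sumOver->0 xs h x∈ fx)

  average-mono : ∀ {f g : A → ℚ} xs → (∀ {x} → x ∈ˡ xs → f x ≤ g x) → average f xs ≤ average g xs
  average-mono xs h = *-monoʳ (inv (ι (length xs))) (invlen≥0 xs) (sumOver-mono xs h)

  average-≥0 : ∀ {f : A → ℚ} xs → (∀ x → 0ℚ ≤ f x) → 0ℚ ≤ average f xs
  average-≥0 xs h = *≥0 (sumOver-≥0 xs h) (invlen≥0 xs)

  average-* : ∀ q (f : A → ℚ) xs → average (λ x → q * f x) xs ≡ q * average f xs
  average-* q f xs = trans (cong (_* inv (ι (length xs))) (sumOver-* q f xs)) (*-assoc q (sumOver f xs) _)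

  average-≤1 : ∀ {f : A → ℚ} xs → (∀ x → f x ≤ 1ℚ) → average f xs ≤ 1ℚ
  average-≤1 []       h = 0≤1
  average-≤1 {f} (x ∷ xs) h = subst (average f (x ∷ xs) ≤_) (*-inv (0<ι-suc (length xs)))
    (*-monoʳ (inv (ι (suc (length xs)))) (invlen≥0 (x ∷ xs)) (sumOver-≤-length (x ∷ xs) h))

  average->0 : ∀ {f : A → ℚ} {x} xs → (∀ x → 0ℚ ≤ f x) → x ∈ˡ xs → 0ℚ < f x → 0ℚ < average f xs
  average->0 (y ∷ xs) h x∈ fx = *>0 (sumOver->0 (y ∷ xs) h x∈ fx) (inv>0 (0<ι-suc (length xs)))

  average-deficit : ∀ {f : A → ℚ} {x} δ {D} xs → 0ℚ ≤ δ → (∀ x → f x ≤ 1ℚ) → x ∈ˡ xs → f x ≤ 1ℚ - δ →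
                    length xs ℕ.≤ D → average f xs ≤ 1ℚ - inv (ι D) * δ
  average-deficit {f} {x} δ {D} xs@(_ ∷ ys) 0≤δ h x∈ fx len≤D = begin
    sumOver f xs * i      ≤⟨ *-monoʳ i (invlen≥0 xs) (sumOver-deficit δ xs h x∈ fx) ⟩
    (ι (length xs) - δ) * i ≡⟨ solve 3 (λ l d i → (l :- d) :* i := l :* i :- i :* d) refl (ι (length xs)) δ i ⟩
    ι (length xs) * i - i * δ ≡⟨ cong (_- i * δ) (*-inv (0<ι-suc (length ys))) ⟩
    1ℚ - i * δ            ≤⟨ +-monoʳ-≤ 1ℚ (neg-antimono-≤ (*-monoʳ δ 0≤δ (inv-anti (0<ι-suc (length ys)) (ι-mono len≤D)))) ⟩
    1ℚ - inv (ι D) * δ    ∎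
    where
    open ≤-Reasoning
    i = inv (ι (length xs))

if-elim : ∀ (P : ℚ → Set) b {x y} → P x → P y → P (if b then x else y)
if-elim P true  px py = px
if-elim P false px py = py

if-rel : ∀ (P : ℚ → ℚ → Set) b {x y x′ y′} → P x x′ → P y y′ → P (if b then x else y) (if b then x′ else y′)
if-rel P true  px py = px
if-rel P false px py = py

-- A Markov chain X₀, X₁, … which moves from s to a uniformly random entry of
-- next s, and its hitting time T = min { t : Done X_t }.  ℙ[T≡ t ] s and
-- ℙ[T≥ t ] s are the probabilities given X₀ = s, computed by conditioning on X₁.
module Hitting {S : Set} (next : S → List S) {Done : S → Set} (done? : ∀ s → Dec (Done s)) where

  ℙ[T≡_] : ℕ → S → ℚ
  ℙ[T≡ zero  ] s = if does (done? s) then 1ℚ else 0ℚ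
  ℙ[T≡ suc t ] s = if does (done? s) then 0ℚ else average ℙ[T≡ t ] (next s)

  -- Partial sums of 𝔼[T] = Σ_t t · ℙ[T = t].
  partial-𝔼 : S → ℕ → ℚ
  partial-𝔼 s N = Σ< N (λ t → ι t * ℙ[T≡ t ] s)

  ℙ[T≥_] : ℕ → S → ℚ
  ℙ[T≥ zero  ] s = 1ℚ
  ℙ[T≥ suc t ] s = if does (done? s) then 0ℚ else average ℙ[T≥ t ] (next s)

  -- A done state can be reached from s in at most k moves.
  data Reach : ℕ → S → Set where
    stop : ∀ {k s} → Done s → Reach k s
    step : ∀ {k s s′} → s′ ∈ˡ next s → Reach k s′ → Reach (suc k) s

  Reach-mono : ∀ {k l s} → k ℕ.≤ l → Reach k s → Reach l s
  Reach-mono _           (stop d)    = stop d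
  Reach-mono (ℕ.s≤s k≤l) (step s′ r) = step s′ (Reach-mono k≤l r)

  ℙ≡-≥0 : ∀ t s → 0ℚ ≤ ℙ[T≡ t ] s
  ℙ≡-≥0 zero    s = if-elim (0ℚ ≤_) (does (done? s)) 0≤1 ≤-refl
  ℙ≡-≥0 (suc t) s = if-elim (0ℚ ≤_) (does (done? s)) ≤-refl (average-≥0 (next s) (ℙ≡-≥0 t))

  ℙ≥-≥0 : ∀ t s → 0ℚ ≤ ℙ[T≥ t ] s
  ℙ≥-≥0 zero    s = 0≤1
  ℙ≥-≥0 (suc t) s = if-elim (0ℚ ≤_) (does (done? s)) ≤-refl (average-≥0 (next s) (ℙ≥-≥0 t))

  ℙ≥-≤1 : ∀ t s → ℙ[T≥ t ] s ≤ 1ℚ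
  ℙ≥-≤1 zero    s = ≤-refl
  ℙ≥-≤1 (suc t) s = if-elim (_≤ 1ℚ) (does (done? s)) 0≤1 (average-≤1 (next s) (ℙ≥-≤1 t))

  ℙ≡≤ℙ≥ : ∀ t s → ℙ[T≡ t ] s ≤ ℙ[T≥ t ] s
  ℙ≡≤ℙ≥ zero    s = if-elim (_≤ 1ℚ) (does (done? s)) ≤-refl 0≤1
  ℙ≡≤ℙ≥ (suc t) s = if-rel _≤_ (does (done? s)) ≤-refl (average-mono (next s) (λ {x} _ → ℙ≡≤ℙ≥ t x))

  Reach⇒ℙ>0 : ∀ {k s} → Reach k s → ∃[ t ] 0ℚ < ℙ[T≡ t ] s
  Reach⇒ℙ>0 {s = s} (stop d) = 0 , subst (λ b → 0ℚ < (if b then 1ℚ else 0ℚ)) (sym (dec-true (done? s) d)) 0<1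
  Reach⇒ℙ>0 {s = s} (step s′ r) = by-dec (done? s)
    where
    ih = Reach⇒ℙ>0 r
    t  = proj₁ ih
    by-dec : Dec (Done s) → ∃[ t ] 0ℚ < ℙ[T≡ t ] s
    by-dec (yes d) = 0 , subst (λ b → 0ℚ < (if b then 1ℚ else 0ℚ)) (sym (dec-true (done? s) d)) 0<1
    by-dec (no ¬d) = suc t , subst (λ b → 0ℚ < (if b then 0ℚ else average ℙ[T≡ t ] (next s))) (sym (dec-false (done? s) ¬d))
      (average->0 (next s) (ℙ≡-≥0 t) s′ (proj₂ ih))

  partial-𝔼-eventually>0 : ∀ {k s} → ¬ Done s → Reach k s → ∃[ e ] (0ℚ < e × ∃[ N ] (∀ n → N ℕ.≤ n → 0ℚ + e ≤ partial-𝔼 s n))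
  partial-𝔼-eventually>0 {k} {s} ¬d r = go (proj₁ tp) (proj₂ tp)
    where
    tp = Reach⇒ℙ>0 r
    term : ℕ → ℚ
    term t = ι t * ℙ[T≡ t ] s
    term≥0 : ∀ t → 0ℚ ≤ term t
    term≥0 t = *≥0 (ι≥0 t) (ℙ≡-≥0 t s)
    go : ∀ t → 0ℚ < ℙ[T≡ t ] s → ∃[ e ] (0ℚ < e × ∃[ N ] (∀ n → N ℕ.≤ n → 0ℚ + e ≤ partial-𝔼 s n))
    go zero    p = contradiction (subst (λ b → 0ℚ < (if b then 1ℚ else 0ℚ)) (dec-false (done? s) ¬d) p) (<-irrefl refl)
    go (suc t) p = series>0 term≥0 (suc t) (*>0 (0<ι-suc t) p)

  -- Sufficient for T to be almost surely finite, with a geometric tail, from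
  -- every state satisfying Inv.
  record Absorbing : Set₁ where
    field
      Inv      : S → Set
      Inv-next : ∀ {s s′} → Inv s → s′ ∈ˡ next s → Inv s′
      D        : ℕ
      len≤D    : ∀ s → length (next s) ℕ.≤ suc D
      K        : ℕ
      reach    : ∀ {s} → Inv s → Reach K s

  module _ (A : Absorbing) where
    open Absorbing A
    open ≤-Reasoning

    private
      η δ e : ℚ
      η = inv (ι (suc D))
      δ = η ^ℚ K
      e = ½ * δ

      0<η : 0ℚ < η
      0<η = inv>0 (0<ι-suc D)

      η≤1 : η ≤ 1ℚ
      η≤1 = subst (η ≤_) (*-inv (0<ι-suc D)) (subst (_≤ ι (suc D) * η) (*-identityˡ η) (*-monoʳ η (<⇒≤ 0<η) (ι-mono {1} {suc D} (ℕ.s≤s ℕ.z≤n))))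

      ^≤1 : ∀ k → η ^ℚ k ≤ 1ℚ
      ^≤1 zero    = ≤-refl
      ^≤1 (suc k) = ≤-trans (*-monoʳ (η ^ℚ k) (^≥0 (<⇒≤ 0<η) k) η≤1) (subst (_≤ 1ℚ) (sym (*-identityˡ (η ^ℚ k))) (^≤1 k))

      ℙ≥-deficit : ∀ {k s} → Reach k s → ℙ[T≥ suc k ] s ≤ 1ℚ - η ^ℚ k
      ℙ≥-deficit {k} {s} (stop d) = subst (λ b → (if b then 0ℚ else average ℙ[T≥ k ] (next s)) ≤ 1ℚ - η ^ℚ k) (sym (dec-true (done? s) d)) (diff≥0 (^≤1 k))
      ℙ≥-deficit {suc k} {s} (step s′ r) = if-elim (_≤ 1ℚ - η ^ℚ suc k) (does (done? s)) (diff≥0 (^≤1 (suc k)))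
        (average-deficit (η ^ℚ k) (next s) (^≥0 (<⇒≤ 0<η) k) (ℙ≥-≤1 (suc k)) s′ (ℙ≥-deficit r) (len≤D s))

      K′ : ℕ
      K′ = suc K

      q q′ : ℚ
      q  = 1ℚ - δ
      q′ = 1ℚ - e

      0≤q : 0ℚ ≤ q
      0≤q = diff≥0 (^≤1 K)

      0<δ : 0ℚ < δ
      0<δ = ^>0 0<η K

      0<e : 0ℚ < e
      0<e = *>0 0<½ 0<δ

      e+e : e + e ≡ δ
      e+e = ½+½ δ

      0≤q′ : 0ℚ ≤ q′
      0≤q′ = diff≥0 {e} (≤-trans (≤-by {e} e (sym e+e) (<⇒≤ 0<e)) (^≤1 K))

      q′<1 : q′ < 1ℚ
      q′<1 = subst (q′ <_) (+-identityʳ 1ℚ) (+-monoʳ-< 1ℚ (neg-antimono-< 0<e))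

      ℙ≥-decay : ∀ t s → Inv s → ℙ[T≥ t ℕ.+ K′ ] s ≤ q * ℙ[T≥ t ] s
      ℙ≥-decay zero    s i = subst (ℙ[T≥ K′ ] s ≤_) (sym (*-identityʳ q)) (ℙ≥-deficit (reach i))
      ℙ≥-decay (suc t) s i = if-rel (λ x y → x ≤ q * y) (does (done? s)) (≤-reflexive (sym (*-zeroʳ q)))
        (subst (average ℙ[T≥ t ℕ.+ K′ ] (next s) ≤_) (average-* q ℙ[T≥ t ] (next s))
          (average-mono (next s) (λ {x} x∈ → ℙ≥-decay t x (Inv-next i x∈))))

      lp = archimedean (ι K′) 0<e
      L : ℕ
      L = proj₁ lp
      K′≤Le : ι K′ ≤ ι L * e
      K′≤Le = proj₂ lp

      weight : ∀ t → (ι (t ℕ.+ K′) + ι L) * q ≤ q′ * (ι t + ι L)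
      weight t = ≤-by (e * ι t + (ι L * e - ι K′) + ι K′ * δ) eq
          (+≥0 (+≥0 (*≥0 (<⇒≤ 0<e) (ι≥0 t)) (diff≥0 K′≤Le)) (*≥0 (ι≥0 K′) (<⇒≤ 0<δ)))
        where
        alg : ∀ t k l e → (1ℚ - e) * (t + l) ≡ (t + k + l) * (1ℚ - (e + e)) + (e * t + (l * e - k) + k * (e + e))
        alg = solve 4 (λ t k l e → (con 1ℚ :- e) :* (t :+ l) := (t :+ k :+ l) :* (con 1ℚ :- (e :+ e)) :+ (e :* t :+ (l :* e :- k) :+ k :* (e :+ e))) refl
        eq : q′ * (ι t + ι L) ≡ (ι (t ℕ.+ K′) + ι L) * q + (e * ι t + (ι L * e - ι K′) + ι K′ * δ)
        eq = trans (alg (ι t) (ι K′) (ι L) e)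
          (cong₂ (λ z w → (z + ι L) * (1ℚ - w) + (e * ι t + (ι L * e - ι K′) + ι K′ * w)) (sym (ι-+ t K′)) e+e)

    𝔼-cauchy : ∀ s → Inv s → Cauchy (partial-𝔼 s)
    𝔼-cauchy s i = series-cauchy {d = d} (λ t → *≥0 (ι≥0 t) (ℙ≡-≥0 t s)) b≤d 0≤q′ q′<1 K′ decay
      where
      d : ℕ → ℚ
      d t = (ι t + ι L) * ℙ[T≥ t ] s
      0≤w : ∀ t → 0ℚ ≤ ι t + ι L
      0≤w t = +≥0 (ι≥0 t) (ι≥0 L)
      b≤d : ∀ t → ι t * ℙ[T≡ t ] s ≤ d t
      b≤d t = ≤-trans (*-monoˡ (ι t) (ι≥0 t) (ℙ≡≤ℙ≥ t s)) (*-monoʳ (ℙ[T≥ t ] s) (ℙ≥-≥0 t s) (≤-by {ι t} (ι L) refl (ι≥0 L)))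
      decay : ∀ t → d (t ℕ.+ K′) ≤ q′ * d t
      decay t = begin
        (ι (t ℕ.+ K′) + ι L) * ℙ[T≥ t ℕ.+ K′ ] s  ≤⟨ *-monoˡ (ι (t ℕ.+ K′) + ι L) (0≤w (t ℕ.+ K′)) (ℙ≥-decay t s i) ⟩
        (ι (t ℕ.+ K′) + ι L) * (q * ℙ[T≥ t ] s)   ≡⟨ *-assoc (ι (t ℕ.+ K′) + ι L) q (ℙ[T≥ t ] s) ⟨
        (ι (t ℕ.+ K′) + ι L) * q * ℙ[T≥ t ] s     ≤⟨ *-monoʳ (ℙ[T≥ t ] s) (ℙ≥-≥0 t s) (weight t) ⟩
        q′ * (ι t + ι L) * ℙ[T≥ t ] s             ≡⟨ *-assoc q′ (ι t + ι L) (ℙ[T≥ t ] s) ⟩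
        q′ * d t                                  ∎

    𝔼[T] : ∀ s → Inv s → ℝ
    𝔼[T] s i = mkℝ (partial-𝔼 s) (𝔼-cauchy s i)

record Graph (n : ℕ) : Set where
  field
    adj       : Fin n → Fin n → Bool
    irrefl    : ∀ v → adj v v ≡ false
    symmetric : ∀ u v → adj u v ≡ adj v u
    connected : ∀ u v → Star (λ x y → T (adj x y)) u v

open Graph public

module _ {n : ℕ} (G : Graph n) where

  neighbours : Fin n → List (Fin n)
  neighbours v = filter (λ u → T? (adj G v u)) (allFin n)

  degree : Fin n → ℕ
  degree v = length (neighbours v)

  -- The seeds are irrelevant for n ≥ 1, as 0 ≤ degree v ≤ n.
  δ Δ : ℕ
  δ = min n (map degree (allFin n))
  Δ = max 0 (map degree (allFin n))

  -- A state is the current vertex together with the set of visited vertices.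
  walk-next : Fin n × Subset n → List (Fin n × Subset n)
  walk-next (v , S) = map (λ u → u , S ∪ ⁅ u ⁆) (neighbours v)

  informed : Subset n → List (Fin n)
  informed I = filter (_∈? I) (allFin n)

  -- All ways for the vertices of the list to choose one neighbour each.  A
  -- uniform element of this product amounts to independent uniform choices.
  choices : List (Fin n) → List (List (Fin n))
  choices []       = [] ∷ []
  choices (v ∷ vs) = cartesianProductWith _∷_ (neighbours v) (choices vs)

  push-next : Subset n → List (Subset n)
  push-next I = map (λ us → I ∪ ⋃ (map ⁅_⁆ us)) (choices (informed I))

  full? : (S : Subset n) → Dec (S ≡ ⊤)
  full? S = Vecₚ.≡-dec Boolₚ._≟_ S ⊤

  module Walk = Hitting walk-next {Done = λ s → proj₂ s ≡ ⊤} (λ s → full? (proj₂ s))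
  module Push = Hitting push-next {Done = _≡ ⊤} full?

  full : ∀ {S : Subset n} → (∀ v → v ∈ S) → S ≡ ⊤
  full h = Subₚ.⊆-antisym Subₚ.⊆⊤ (λ {v} _ → h v)

  ∈-neighbours : ∀ {v u} → T (adj G v u) → u ∈ˡ neighbours v
  ∈-neighbours {v} {u} a = ∈ₚ.∈-filter⁺ (λ u → T? (adj G v u)) (∈ₚ.∈-allFin u) a

  degree≤n : ∀ v → degree v ℕ.≤ n
  degree≤n v = ℕₚ.≤-trans (Listₚ.length-filter (λ u → T? (adj G v u)) (allFin n))
    (ℕₚ.≤-reflexive (Listₚ.length-tabulate {n = n} id))

  private
    pathLength : ∀ {u v} → Star (λ x y → T (adj G x y)) u v → ℕ
    pathLength Star.ε       = 0
    pathLength (_ Star.◅ p) = suc (pathLength p)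

    bound : ∀ {m} (f : Fin m → ℕ) → ∃[ L ] (∀ i → f i ℕ.≤ L)
    bound {zero}  f = 0 , λ ()
    bound {suc m} f = f zero ℕ.+ proj₁ ih , λ where
        zero    → ℕₚ.m≤m+n (f zero) _
        (suc i) → ℕₚ.≤-trans (proj₂ ih i) (ℕₚ.m≤n+m _ (f zero))
      where ih = bound (λ i → f (suc i))

    row : ∀ u → ∃[ L ] (∀ v → pathLength (connected G u v) ℕ.≤ L)
    row u = bound (λ v → pathLength (connected G u v))

    L : ℕ
    L = proj₁ (bound (λ u → proj₁ (row u)))

    pathLength≤L : ∀ u v → pathLength (connected G u v) ℕ.≤ L
    pathLength≤L u v = ℕₚ.≤-trans (proj₂ (row u) v) (proj₂ (bound (λ u → proj₁ (row u))) u)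

    visit : ∀ {k v t S} (p : Star (λ x y → T (adj G x y)) v t) → v ∈ S →
            (∀ S′ → S ⊆ S′ → t ∈ S′ → Walk.Reach k (t , S′)) → Walk.Reach (pathLength p ℕ.+ k) (v , S)
    visit {S = S} Star.ε v∈S h = h S id v∈S
    visit {S = S} (Star._◅_ {j = u} a p) v∈S h =
      Walk.step (∈ₚ.∈-map⁺ (λ u → u , S ∪ ⁅ u ⁆) (∈-neighbours a))
        (visit p (Subₚ.q⊆p∪q S ⁅ u ⁆ (Subₚ.x∈⁅x⁆ u))
          (λ S′ S∪u⊆S′ → h S′ (λ x∈S → S∪u⊆S′ (Subₚ.p⊆p∪q ⁅ u ⁆ x∈S))))

    tour : ∀ ts {v S} → v ∈ S → (∀ u → u ∈ S ⊎ u ∈ˡ ts) → Walk.Reach (length ts ℕ.* L) (v , S)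
    tour [] v∈S h = Walk.stop (full (λ u → case-⊎ (h u)))
      where
      case-⊎ : ∀ {u S} → u ∈ S ⊎ u ∈ˡ [] → u ∈ S
      case-⊎ (inj₁ x) = x
      case-⊎ (inj₂ ())
    tour (t ∷ ts) {v} {S} v∈S h = Walk.Reach-mono (ℕₚ.+-monoˡ-≤ (length ts ℕ.* L) (pathLength≤L v t))
      (visit (connected G v t) v∈S (λ S′ S⊆S′ t∈S′ → tour ts t∈S′ (λ u → next-cover S⊆S′ t∈S′ (h u))))
      where
      next-cover : ∀ {u S′} → S ⊆ S′ → t ∈ S′ → u ∈ S ⊎ u ∈ˡ t ∷ ts → u ∈ S′ ⊎ u ∈ˡ ts
      next-cover S⊆S′ t∈S′ (inj₁ u∈S)          = inj₁ (S⊆S′ u∈S)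
      next-cover S⊆S′ t∈S′ (inj₂ (here refl))  = inj₁ t∈S′
      next-cover S⊆S′ t∈S′ (inj₂ (there u∈ts)) = inj₂ u∈ts

    walk-inv : ∀ {s s′} → proj₁ s ∈ proj₂ s → s′ ∈ˡ walk-next s → proj₁ s′ ∈ proj₂ s′
    walk-inv {v , S} _ s′∈ with u , _ , refl ← ∈ₚ.∈-map⁻ (λ u → u , S ∪ ⁅ u ⁆) s′∈ = Subₚ.q⊆p∪q S ⁅ u ⁆ (Subₚ.x∈⁅x⁆ u)

  walk-absorbing : Walk.Absorbing
  walk-absorbing = record
    { Inv      = λ s → proj₁ s ∈ proj₂ s
    ; Inv-next = walk-inv
    ; D        = n
    ; len≤D    = λ (v , S) → ℕₚ.≤-trans (ℕₚ.≤-reflexive (Listₚ.length-map (λ u → u , S ∪ ⁅ u ⁆) (neighbours v))) (ℕₚ.m≤n⇒m≤1+n (degree≤n v))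
    ; K        = length (allFin n) ℕ.* L
    ; reach    = λ v∈S → tour (allFin n) v∈S (λ u → inj₂ (∈ₚ.∈-allFin u))
    }

  private
    length-cartesian : ∀ (us : List (Fin n)) (yss : List (List (Fin n))) →
                       length (cartesianProductWith _∷_ us yss) ≡ length us ℕ.* length yss
    length-cartesian []       yss = refl
    length-cartesian (u ∷ us) yss = trans (Listₚ.length-++ (map (u ∷_) yss))
      (cong₂ ℕ._+_ (Listₚ.length-map (u ∷_) yss) (length-cartesian us yss))

    length-choices : ∀ vs → length (choices vs) ℕ.≤ suc n ℕ.^ length vs
    length-choices []       = ℕₚ.≤-refl
    length-choices (v ∷ vs) = ℕₚ.≤-trans (ℕₚ.≤-reflexive (length-cartesian (neighbours v) (choices vs)))
      (ℕₚ.*-mono-≤ (ℕₚ.m≤n⇒m≤1+n (degree≤n v)) (length-choices vs))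

    length-informed : ∀ I → length (informed I) ℕ.≤ n
    length-informed I = ℕₚ.≤-trans (Listₚ.length-filter (_∈? I) (allFin n))
      (ℕₚ.≤-reflexive (Listₚ.length-tabulate {n = n} id))

    length-push-next : ∀ I → length (push-next I) ℕ.≤ suc n ℕ.^ n
    length-push-next I = ℕₚ.≤-trans (ℕₚ.≤-reflexive (Listₚ.length-map _ (choices (informed I))))
      (ℕₚ.≤-trans (length-choices (informed I)) (ℕₚ.^-monoʳ-≤ (suc n) (length-informed I)))

    crossing : ∀ {I s x} → Star (λ x y → T (adj G x y)) s x → s ∈ I → x ∉ I → ∃[ u ] ∃[ w ] (u ∈ I × w ∉ I × T (adj G u w))
    crossing Star.ε s∈I x∉I = contradiction s∈I x∉I
    crossing {I} (Star._◅_ {i = s} {j = y} a p) s∈I x∉I with y ∈? I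
    ... | yes y∈I = crossing p y∈I x∉I
    ... | no  y∉I = s , y , s∈I , y∉I , a

    first-step : ∀ {v y} → Star (λ x y → T (adj G x y)) v y → v ≢ y → ∃[ z ] z ∈ˡ neighbours v
    first-step Star.ε             v≢v = contradiction refl v≢v
    first-step (Star._◅_ {j = z} a p) _   = z , ∈-neighbours a

    has-neighbour : ∀ {I u w} → u ∈ I → w ∉ I → ∀ v → ∃[ z ] z ∈ˡ neighbours v
    has-neighbour {I} {u} {w} u∈I w∉I v with v ∈? I
    ... | yes v∈I = first-step (connected G v w) (λ { refl → w∉I v∈I })
    ... | no  v∉I = first-step (connected G v u) (λ { refl → v∉I u∈I })

    module _ (nbr : ∀ v → ∃[ z ] z ∈ˡ neighbours v) where
      some-choice : ∀ vs → ∃[ us ] us ∈ˡ choices vs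
      some-choice []       = [] , here refl
      some-choice (v ∷ vs) = _ , ∈ₚ.∈-cartesianProductWith⁺ _∷_ (proj₂ (nbr v)) (proj₂ (some-choice vs))

      choice-of : ∀ {u w} vs → u ∈ˡ vs → w ∈ˡ neighbours u → ∃[ us ] (us ∈ˡ choices vs × w ∈ˡ us)
      choice-of (_ ∷ vs) (here refl) w∈ = _ , ∈ₚ.∈-cartesianProductWith⁺ _∷_ w∈ (proj₂ (some-choice vs)) , here refl
      choice-of (v ∷ vs) (there u∈)  w∈ with us , us∈ , w∈us ← choice-of vs u∈ w∈ =
        _ , ∈ₚ.∈-cartesianProductWith⁺ _∷_ (proj₂ (nbr v)) us∈ , there w∈us

    ∈-⋃ : ∀ {w : Fin n} us → w ∈ˡ us → w ∈ ⋃ (map ⁅_⁆ us)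
    ∈-⋃ {w} (_ ∷ us) (here refl) = Subₚ.p⊆p∪q (⋃ (map ⁅_⁆ us)) (Subₚ.x∈⁅x⁆ w)
    ∈-⋃ {w} (u ∷ us) (there w∈)  = Subₚ.q⊆p∪q ⁅ u ⁆ (⋃ (map ⁅_⁆ us)) (∈-⋃ us w∈)

    push-reach : ∀ k {I} → Nonempty I → n ℕ.≤ k ℕ.+ Subset.∣ I ∣ → Push.Reach k I
    push-reach zero    {I} _ n≤∣I∣ = Push.stop (Subₚ.∣p∣≡n⇒p≡⊤ (ℕₚ.≤-antisym (Subₚ.∣p∣≤n I) n≤∣I∣))
    push-reach (suc k) {I} (s , s∈I) n≤ with all? (_∈? I)
    ... | yes all = Push.stop (full all)
    ... | no ¬all
      with x , x∉I ← ¬∀⟶∃¬ n (_∈ I) (_∈? I) ¬all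
      with u , w , u∈I , w∉I , a ← crossing (connected G s x) s∈I x∉I
      with us , us∈ , w∈us ← choice-of (has-neighbour u∈I w∉I) (informed I)
                               (∈ₚ.∈-filter⁺ (_∈? I) (∈ₚ.∈-allFin u) u∈I) (∈-neighbours a)
      = Push.step (∈ₚ.∈-map⁺ (λ us → I ∪ ⋃ (map ⁅_⁆ us)) us∈)
          (push-reach k (s , Subₚ.p⊆p∪q J s∈I)
            (ℕₚ.≤-trans n≤ (ℕₚ.≤-trans (ℕₚ.≤-reflexive (sym (ℕₚ.+-suc k Subset.∣ I ∣)))
              (ℕₚ.+-monoʳ-≤ k (Subₚ.p⊂q⇒∣p∣<∣q∣ (Subₚ.p⊆p∪q J , w , Subₚ.q⊆p∪q I J (∈-⋃ us w∈us) , w∉I))))))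
      where J = ⋃ (map ⁅_⁆ us)

    push-inv : ∀ {I I′ : Subset n} → Nonempty I → I′ ∈ˡ push-next I → Nonempty I′
    push-inv {I} (s , s∈I) I′∈ with us , _ , refl ← ∈ₚ.∈-map⁻ (λ us → I ∪ ⋃ (map ⁅_⁆ us)) I′∈ =
      s , Subₚ.p⊆p∪q (⋃ (map ⁅_⁆ us)) s∈I

  push-absorbing : Push.Absorbing
  push-absorbing = record
    { Inv      = Nonempty
    ; Inv-next = push-inv
    ; D        = suc n ℕ.^ n
    ; len≤D    = λ I → ℕₚ.m≤n⇒m≤1+n (length-push-next I)
    ; K        = n
    ; reach    = λ {I} ne → push-reach n ne (ℕₚ.m≤m+n n Subset.∣ I ∣)
    }

  cover-time : Fin n → ℝ
  cover-time s = Walk.𝔼[T] walk-absorbing (s , ⁅ s ⁆) (Subₚ.x∈⁅x⁆ s)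

  broadcast-time : Fin n → ℝ
  broadcast-time s = Push.𝔼[T] push-absorbing ⁅ s ⁆ (s , Subₚ.x∈⁅x⁆ s)

  -- The seed 0ℝ is irrelevant for n ≥ 1, as expected times are nonnegative.
  maxᵥ : (Fin n → ℝ) → ℝ
  maxᵥ f = foldr _⊔ℝ_ 0ℝ (map f (allFin n))

  COV 𝔼[RBA] : ℝ
  COV    = maxᵥ cover-time
  𝔼[RBA] = maxᵥ broadcast-time

⊔ℝ>0ˡ : ∀ x y → 0ℝ <ℝ x → 0ℝ <ℝ x ⊔ℝ y
⊔ℝ>0ˡ x y (e , 0<e , N , h) = e , 0<e , N , λ n N≤n → ≤-trans (h n N≤n) (p≤p⊔q (seq x n) (seq y n))

⊔ℝ>0ʳ : ∀ x y → 0ℝ <ℝ y → 0ℝ <ℝ x ⊔ℝ y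
⊔ℝ>0ʳ x y (e , 0<e , N , h) = e , 0<e , N , λ n N≤n → ≤-trans (h n N≤n) (p≤q⊔p (seq x n) (seq y n))

max>0 : ∀ {A : Set} (f : A → ℝ) {a} xs → a ∈ˡ xs → 0ℝ <ℝ f a → 0ℝ <ℝ foldr _⊔ℝ_ 0ℝ (map f xs)
max>0 f (x ∷ xs) (here refl) 0<fa = ⊔ℝ>0ˡ (f x) (foldr _⊔ℝ_ 0ℝ (map f xs)) 0<fa
max>0 f (x ∷ xs) (there a∈)  0<fa = ⊔ℝ>0ʳ (f x) (foldr _⊔ℝ_ 0ℝ (map f xs)) (max>0 f xs a∈ 0<fa)

𝔼[RBA]>0 : ∀ {n} (G : Graph n) → 2 ℕ.≤ n → 0ℝ <ℝ 𝔼[RBA] G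
𝔼[RBA]>0 {suc (suc m)} G _ = max>0 (broadcast-time G) (allFin _) (∈ₚ.∈-allFin zero)
  (Push.partial-𝔼-eventually>0 G (λ ()) (Push.Absorbing.reach (push-absorbing G) (zero , Subₚ.x∈⁅x⁆ zero)))
𝔼[RBA]>0 {suc zero} G (ℕ.s≤s ())

ℛ : ∀ {n} → Graph n → 2 ℕ.≤ n → ℝ
ℛ G 2≤n = COV G ÷ 𝔼[RBA] G [ 𝔼[RBA]>0 G 2≤n ]

{-# OPTIONS --safe #-}
-- Let M bound the cover time.  A walk that starts inside S covers only after
-- leaving S; summing the equations for the expected exit times of S over S,
-- weighted by degree, gives vol S ≤ 2 M e(S, Sᶜ), so every cut of the graph has
-- at least n δ / (4 M) edges.
--
-- With Δ ≤ k δ the push algorithm informs δ/8 new vertices in expected time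
-- O(k log n + k M / n), hence all of V in O(n/δ) such phases.  Starting from I₀,
-- let B be the vertices with at least a quarter of their neighbours in I₀.  B is
-- informed after O(k log n) steps; then some push crosses the boundary after
-- O(Δ / cut) = O(k M / n) steps; and from then on the set of informed vertices
-- outside I₀ ∪ B, most of whose edges lead to uninformed vertices, grows by a
-- constant factor per step until it has size δ/8.  As n ≤ 4 k M, altogether
-- 𝔼[RBA] = O(k² M log n / δ), and 1/δ ≤ n/δ².
module Submission where

open import Defs

-- The expectations are reals given by the partial sums of Σ t · ℙ[T = t], to which drift arguments
-- do not apply directly. The estimates are therefore made over ℚ for 𝔼[min(T, N)], uniformly in N,
-- and compared with the partial sums from above for the broadcast and from below for the cover
-- time. Knowledge of the cover time reaches the push process through cuts alone, and a cut may have
-- only n δ / (4 M) edges. Waiting O(k M / n) steps for a crossing before each of n new vertices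
-- would cost O(k M), without the factor 1/δ; one such wait in each of the O(n/δ) phases is
-- affordable. Hence after a single crossing the growth has to come from degrees: a vertex outside
-- I₀ ∪ B has at most a quarter of its neighbours in I₀ and at most δ/8 among the other informed
-- ones, so at least δ/2 uninformed neighbours. B is absorbed beforehand so that the crossing surely
-- lands on such a vertex. No concentration is used: measured by harmonic numbers, the progress of
-- one step is bounded below by a linear function of the number of newly informed vertices, so
-- expected counts suffice.

module Proof where

  open import Data.Bool.Base using (Bool; true; false; if_then_else_; T; _∧_; _∨_; not)
  open import Data.Bool.Properties using (∧-zeroʳ; not-involutive)
  open import Data.Empty using (⊥-elim)
  open import Data.Fin.Base using (Fin; zero; suc)
  open import Data.Fin.Properties using (_≟_; all?; ¬∀⟶∃¬)
  open import Data.Fin.Subset using (Subset; ⊤; ⁅_⁆; _∪_; ⋃; _∈_; _∉_)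
  open import Data.Fin.Subset.Properties as Subₚ using (_∈?_)
  import Data.Integer.Base as ℤ
  import Data.Integer.Properties as ℤₚ
  open import Data.List.Base using (List; []; _∷_; _++_; map; foldr; length; filter; allFin; cartesianProductWith)
  open import Data.List.Extrema.Nat using (v<min⁺)
  import Data.List.Membership.Propositional.Properties as ∈ₚ
  open import Data.List.Membership.Propositional using () renaming (_∈_ to _∈ˡ_)
  import Data.List.Properties as Listₚ
  import Data.List.Relation.Unary.All as All
  import Data.List.Relation.Unary.All.Properties as Allₚ
  open import Data.List.Relation.Unary.Any using (here; there)
  open import Data.Nat.Base as ℕ using (ℕ; zero; suc)
  open import Data.Nat.DivMod using (_/_; m≡m%n+[m/n]*n; m/n*n≤m; m%n<n)
  import Data.Nat.Properties as ℕₚ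
  open import Data.List.Extrema ℕₚ.≤-totalOrder using (min≤xs; xs≤max)
  open import Data.Product.Base using (∃-syntax; _×_; _,_; proj₁; proj₂)
  open import Data.Rational.Base using (ℚ; 0ℚ; 1ℚ; ½; _+_; _*_; _-_; -_; _≤_; _<_; positive)
  open import Data.Rational.Properties hiding (_≟_)
  open import Data.Rational.Solver using (module +-*-Solver)
  open import Data.Sum.Base using (_⊎_; inj₁; inj₂)
  open import Function.Base using (_∘_; id)
  open import Relation.Binary.Construct.Closure.ReflexiveTransitive as Star using (Star)
  open import Relation.Binary.PropositionalEquality.Core using (_≡_; _≢_; refl; sym; trans; cong; cong₂; subst; subst₂)
  open import Relation.Binary.PropositionalEquality.Properties using (module ≡-Reasoning)
  open import Relation.Nullary.Decidable using (Dec; yes; no; does; dec-true; dec-false; T?)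
  open import Relation.Nullary.Negation.Core using (contradiction; ¬_)
  open import Relation.Unary using (Decidable)

  open +-*-Solver using (solve; _:+_; _:*_; _:-_; _:=_; con)

  -- Sums and averages

  ι-cancel-≤ : ∀ {m n} → ι m ≤ ι n → m ℕ.≤ n
  ι-cancel-≤ {m} {n} m≤n = ℤₚ.drop‿+≤+ (subst₂ ℤ._≤_ (ℤₚ.*-identityʳ (ℤ.+ m)) (ℤₚ.*-identityʳ (ℤ.+ n)) (drop-*≤* m≤n))

  ι-* : ∀ m n → ι (m ℕ.* n) ≡ ι m * ι n
  ι-* zero    n = sym (*-zeroˡ (ι n))
  ι-* (suc m) n = begin
    ι (n ℕ.+ m ℕ.* n)   ≡⟨ ι-+ n (m ℕ.* n) ⟩
    ι n + ι (m ℕ.* n)   ≡⟨ cong (ι n +_) (ι-* m n) ⟩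
    ι n + ι m * ι n     ≡⟨ solve 2 (λ m n → n :+ m :* n := (con 1ℚ :+ m) :* n) refl (ι m) (ι n) ⟩
    (1ℚ + ι m) * ι n    ≡⟨ cong (_* ι n) (ι-suc m) ⟨
    ι (suc m) * ι n     ∎
    where open ≡-Reasoning

  cancelˡ : ∀ {x y} r → 0ℚ < r → r * x ≤ r * y → x ≤ y
  cancelˡ r 0<r = *-cancelˡ-≤-pos r {{positive 0<r}}

  𝟙 : Bool → ℚ
  𝟙 b = if b then 1ℚ else 0ℚ

  𝟙≥0 : ∀ b → 0ℚ ≤ 𝟙 b
  𝟙≥0 b = if-elim (0ℚ ≤_) b 0≤1 ≤-refl

  𝟙≤1 : ∀ b → 𝟙 b ≤ 1ℚ
  𝟙≤1 b = if-elim (_≤ 1ℚ) b ≤-refl 0≤1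

  module _ {A : Set} where

    sumOver-cong : ∀ {f g : A → ℚ} xs → (∀ x → f x ≡ g x) → sumOver f xs ≡ sumOver g xs
    sumOver-cong []       h = refl
    sumOver-cong (x ∷ xs) h = cong₂ _+_ (h x) (sumOver-cong xs h)

    sumOver-0 : ∀ (xs : List A) → sumOver (λ _ → 0ℚ) xs ≡ 0ℚ
    sumOver-0 []       = refl
    sumOver-0 (x ∷ xs) = trans (+-identityˡ _) (sumOver-0 xs)

    sumOver-+ : ∀ (f g : A → ℚ) xs → sumOver (λ x → f x + g x) xs ≡ sumOver f xs + sumOver g xs
    sumOver-+ f g []       = refl
    sumOver-+ f g (x ∷ xs) = trans (cong (f x + g x +_) (sumOver-+ f g xs))
      (solve 4 (λ a b c d → a :+ b :+ (c :+ d) := a :+ c :+ (b :+ d)) refl (f x) (g x) (sumOver f xs) (sumOver g xs))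

    sumOver-1 : ∀ (xs : List A) → sumOver (λ _ → 1ℚ) xs ≡ ι (length xs)
    sumOver-1 []       = refl
    sumOver-1 (x ∷ xs) = trans (cong (1ℚ +_) (sumOver-1 xs)) (sym (ι-suc (length xs)))

    sumOver-++ : ∀ (f : A → ℚ) xs ys → sumOver f (xs ++ ys) ≡ sumOver f xs + sumOver f ys
    sumOver-++ f []       ys = sym (+-identityˡ _)
    sumOver-++ f (x ∷ xs) ys = trans (cong (f x +_) (sumOver-++ f xs ys)) (sym (+-assoc (f x) _ _))

    sumOver-filter : ∀ {P : A → Set} (P? : Decidable P) (f : A → ℚ) xs →
                     sumOver f (filter P? xs) ≡ sumOver (λ x → 𝟙 (does (P? x)) * f x) xs
    sumOver-filter P? f []       = refl
    sumOver-filter P? f (x ∷ xs) with does (P? x)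
    ... | true  = cong₂ _+_ (sym (*-identityˡ (f x))) (sumOver-filter P? f xs)
    ... | false = trans (sumOver-filter P? f xs) (solve 2 (λ a s → s := con 0ℚ :* a :+ s) refl (f x) _)

    sumOver-map : ∀ {B : Set} (f : B → ℚ) (g : A → B) xs → sumOver f (map g xs) ≡ sumOver (f ∘ g) xs
    sumOver-map f g []       = refl
    sumOver-map f g (x ∷ xs) = cong (f (g x) +_) (sumOver-map f g xs)

    average-+ : ∀ (f g : A → ℚ) xs → average (λ x → f x + g x) xs ≡ average f xs + average g xs
    average-+ f g xs = trans (cong (_* inv (ι (length xs))) (sumOver-+ f g xs)) (*-distribʳ-+ _ (sumOver f xs) _)

    average-cong : ∀ {f g : A → ℚ} xs → (∀ x → f x ≡ g x) → average f xs ≡ average g xs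
    average-cong xs h = cong (_* inv (ι (length xs))) (sumOver-cong xs h)

    average-map : ∀ {B : Set} (f : B → ℚ) (g : A → B) xs → average f (map g xs) ≡ average (f ∘ g) xs
    average-map f g xs = cong₂ (λ a l → a * inv (ι l)) (sumOver-map f g xs) (Listₚ.length-map g xs)

    average-1 : ∀ (xs : List A) → 0 ℕ.< length xs → average (λ _ → 1ℚ) xs ≡ 1ℚ
    average-1 xs 0<l = trans (cong (_* inv (ι (length xs))) (sumOver-1 xs)) (*-inv (ι>0 0<l))

    average-const : ∀ c (xs : List A) → 0 ℕ.< length xs → average (λ _ → c) xs ≡ c
    average-const c xs 0<l = begin
      average (λ _ → c) xs        ≡⟨ average-cong xs (λ _ → sym (*-identityʳ c)) ⟩
      average (λ _ → c * 1ℚ) xs   ≡⟨ average-* c (λ _ → 1ℚ) xs ⟩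
      c * average (λ _ → 1ℚ) xs   ≡⟨ cong (c *_) (average-1 xs 0<l) ⟩
      c * 1ℚ                      ≡⟨ *-identityʳ c ⟩
      c                           ∎
      where open ≡-Reasoning

    average-sumOver : ∀ {B : Set} (f : B → A → ℚ) (ys : List B) xs →
                      average (λ x → sumOver (λ y → f y x) ys) xs ≡ sumOver (λ y → average (f y) xs) ys
    average-sumOver f []       xs = trans (cong (_* inv (ι (length xs))) (sumOver-0 xs)) (*-zeroˡ (inv (ι (length xs))))
    average-sumOver f (y ∷ ys) xs = trans (average-+ (f y) _ xs) (cong (average (f y) xs +_) (average-sumOver f ys xs))

    average-Σ< : ∀ (f : ℕ → A → ℚ) N xs → average (λ x → Σ< N (λ t → f t x)) xs ≡ Σ< N (λ t → average (f t) xs)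
    average-Σ< f zero    xs = trans (cong (_* inv (ι (length xs))) (sumOver-0 xs)) (*-zeroˡ (inv (ι (length xs))))
    average-Σ< f (suc N) xs = trans (average-+ _ (f N) xs) (cong (_+ average (f N) xs) (average-Σ< f N xs))

  sumOver-swap : ∀ {A B : Set} (f : A → B → ℚ) xs ys →
                 sumOver (λ x → sumOver (f x) ys) xs ≡ sumOver (λ y → sumOver (λ x → f x y) xs) ys
  sumOver-swap f []       ys = sym (sumOver-0 ys)
  sumOver-swap f (x ∷ xs) ys = trans (cong (sumOver (f x) ys +_) (sumOver-swap f xs ys)) (sym (sumOver-+ (f x) _ ys))

  0<length : ∀ {A : Set} {x : A} {xs} → x ∈ˡ xs → 0 ℕ.< length xs
  0<length (here _)  = ℕ.s≤s ℕ.z≤n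
  0<length (there _) = ℕ.s≤s ℕ.z≤n

  Σ<-suc : ∀ (f : ℕ → ℚ) N → Σ< (suc N) f ≡ f 0 + Σ< N (f ∘ suc)
  Σ<-suc f zero    = +-comm 0ℚ (f 0)
  Σ<-suc f (suc N) = trans (cong (_+ f (suc N)) (Σ<-suc f N)) (+-assoc (f 0) _ _)

  Σ<-+ : ∀ (f g : ℕ → ℚ) N → Σ< N (λ i → f i + g i) ≡ Σ< N f + Σ< N g
  Σ<-+ f g zero    = refl
  Σ<-+ f g (suc N) = trans (cong (_+ (f N + g N)) (Σ<-+ f g N))
    (solve 4 (λ a b c d → a :+ b :+ (c :+ d) := a :+ c :+ (b :+ d)) refl (Σ< N f) (Σ< N g) (f N) (g N))

  Σ<-0 : ∀ {f : ℕ → ℚ} N → (∀ i → f i ≡ 0ℚ) → Σ< N f ≡ 0ℚ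
  Σ<-0 zero    h = refl
  Σ<-0 (suc N) h = trans (cong₂ _+_ (Σ<-0 N h) (h N)) (+-identityʳ 0ℚ)


  -- Truncated hitting times

  module Truncated {S : Set} (next : S → List S) {Done : S → Set} (done? : ∀ s → Dec (Done s)) where

    open Hitting next done?

    -- 𝔼[min(T, N)].
    𝔼[T∧_] : ℕ → S → ℚ
    𝔼[T∧ zero  ] s = 0ℚ
    𝔼[T∧ suc N ] s = if does (done? s) then 0ℚ else 1ℚ + average 𝔼[T∧ N ] (next s)

    𝔼∧≥0 : ∀ N s → 0ℚ ≤ 𝔼[T∧ N ] s
    𝔼∧≥0 zero    s = ≤-refl
    𝔼∧≥0 (suc N) s = if-elim (0ℚ ≤_) (does (done? s)) ≤-refl (+≥0 0≤1 (average-≥0 (next s) (𝔼∧≥0 N)))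

    𝔼∧≤ : ∀ N s → 𝔼[T∧ N ] s ≤ ι N
    𝔼∧≤ zero    s = ≤-refl
    𝔼∧≤ (suc N) s = if-elim (_≤ ι (suc N)) (does (done? s)) (ι≥0 (suc N)) (begin
      1ℚ + average 𝔼[T∧ N ] (next s)          ≤⟨ +-monoʳ-≤ 1ℚ (average-mono (next s) (λ {x} _ → ≤-trans (𝔼∧≤ N x) (≤-reflexive (sym (*-identityʳ (ι N)))))) ⟩
      1ℚ + average (λ _ → ι N * 1ℚ) (next s)  ≡⟨ cong (1ℚ +_) (average-* (ι N) (λ _ → 1ℚ) (next s)) ⟩
      1ℚ + ι N * average (λ _ → 1ℚ) (next s)  ≤⟨ +-monoʳ-≤ 1ℚ (*-monoˡ (ι N) (ι≥0 N) (average-≤1 (next s) (λ _ → ≤-refl))) ⟩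
      1ℚ + ι N * 1ℚ                           ≡⟨ cong (1ℚ +_) (*-identityʳ (ι N)) ⟩
      1ℚ + ι N                                ≡⟨ ι-suc N ⟨
      ι (suc N)                               ∎)
      where open ≤-Reasoning

    done⇒𝔼∧≡0 : ∀ N {s} → Done s → 𝔼[T∧ N ] s ≡ 0ℚ
    done⇒𝔼∧≡0 zero    d = refl
    done⇒𝔼∧≡0 (suc N) {s} d rewrite dec-true (done? s) d = refl

    -- This is ℙ[T < N]. It arises when conditioning on X₁ turns the weight t + 1 of a partial sum
    -- into 1 + t.
    ΣP : ℕ → S → ℚ
    ΣP N s = Σ< N (λ t → ℙ[T≡ t ] s)

    ΣP-suc : ∀ N s → ΣP (suc N) s ≡ (if does (done? s) then 1ℚ else average (ΣP N) (next s))
    ΣP-suc N s = trans (Σ<-suc (λ t → ℙ[T≡ t ] s) N) (lem (does (done? s)))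
      where
      lem : ∀ b → (if b then 1ℚ else 0ℚ) + Σ< N (λ t → if b then 0ℚ else average ℙ[T≡ t ] (next s))
                ≡ (if b then 1ℚ else average (ΣP N) (next s))
      lem true  = trans (cong (1ℚ +_) (Σ<-0 N (λ _ → refl))) (+-identityʳ 1ℚ)
      lem false = trans (+-identityˡ _) (sym (average-Σ< ℙ[T≡_] N (next s)))

    ΣP≤1 : ∀ N s → ΣP N s ≤ 1ℚ
    ΣP≤1 zero    s = 0≤1
    ΣP≤1 (suc N) s = subst (_≤ 1ℚ) (sym (ΣP-suc N s))
      (if-elim (_≤ 1ℚ) (does (done? s)) ≤-refl (average-≤1 (next s) (ΣP≤1 N)))

    partial-𝔼-suc : ∀ N s → partial-𝔼 s (suc N) ≡
                    (if does (done? s) then 0ℚ else average (λ x → ΣP N x + partial-𝔼 x N) (next s))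
    partial-𝔼-suc N s = trans (Σ<-suc (λ t → ι t * ℙ[T≡ t ] s) N) (lem (does (done? s)))
      where
      open ≡-Reasoning
      lem : ∀ b → 0ℚ * (if b then 1ℚ else 0ℚ) + Σ< N (λ t → ι (suc t) * (if b then 0ℚ else average ℙ[T≡ t ] (next s)))
                ≡ (if b then 0ℚ else average (λ x → ΣP N x + partial-𝔼 x N) (next s))
      lem true  = trans (cong (0ℚ +_) (Σ<-0 N (λ t → *-zeroʳ (ι (suc t))))) (+-identityʳ 0ℚ)
      lem false = begin
        0ℚ + Σ< N (λ t → ι (suc t) * average ℙ[T≡ t ] (next s))
          ≡⟨ +-identityˡ _ ⟩
        Σ< N (λ t → ι (suc t) * average ℙ[T≡ t ] (next s))
          ≡⟨ Σ-cong N (λ t → trans (cong (_* average ℙ[T≡ t ] (next s)) (ι-suc t))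
               (solve 2 (λ i a → (con 1ℚ :+ i) :* a := a :+ i :* a) refl (ι t) (average ℙ[T≡ t ] (next s)))) ⟩
        Σ< N (λ t → average ℙ[T≡ t ] (next s) + ι t * average ℙ[T≡ t ] (next s))
          ≡⟨ Σ-cong N (λ t → cong (average ℙ[T≡ t ] (next s) +_) (sym (average-* (ι t) ℙ[T≡ t ] (next s)))) ⟩
        Σ< N (λ t → average ℙ[T≡ t ] (next s) + average (λ x → ι t * ℙ[T≡ t ] x) (next s))
          ≡⟨ Σ<-+ (λ t → average ℙ[T≡ t ] (next s)) _ N ⟩
        Σ< N (λ t → average ℙ[T≡ t ] (next s)) + Σ< N (λ t → average (λ x → ι t * ℙ[T≡ t ] x) (next s))
          ≡⟨ cong₂ _+_ (average-Σ< ℙ[T≡_] N (next s)) (average-Σ< (λ t x → ι t * ℙ[T≡ t ] x) N (next s)) ⟨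
        average (ΣP N) (next s) + average (λ x → partial-𝔼 x N) (next s)
          ≡⟨ average-+ (ΣP N) (λ x → partial-𝔼 x N) (next s) ⟨
        average (λ x → ΣP N x + partial-𝔼 x N) (next s) ∎

    -- The partial sum counts only runs with T < N, where T and min(T, N) agree. In the recursion
    -- the difference is that of ℙ[T < N] and 1.
    partial-𝔼≤𝔼∧ : ∀ N s → partial-𝔼 s N ≤ 𝔼[T∧ N ] s
    partial-𝔼≤𝔼∧ zero    s = ≤-refl
    partial-𝔼≤𝔼∧ (suc N) s = subst (_≤ 𝔼[T∧ suc N ] s) (sym (partial-𝔼-suc N s))
      (if-rel _≤_ (does (done? s)) ≤-refl (begin
        average (λ x → ΣP N x + partial-𝔼 x N) (next s)      ≤⟨ average-mono (next s) (λ {x} _ → +-mono-≤ (ΣP≤1 N x) (partial-𝔼≤𝔼∧ N x)) ⟩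
        average (λ x → 1ℚ + 𝔼[T∧ N ] x) (next s)             ≡⟨ average-+ (λ _ → 1ℚ) 𝔼[T∧ N ] (next s) ⟩
        average (λ _ → 1ℚ) (next s) + average 𝔼[T∧ N ] (next s) ≤⟨ +-monoˡ-≤ _ (average-≤1 (next s) (λ _ → ≤-refl)) ⟩
        1ℚ + average 𝔼[T∧ N ] (next s)                       ∎))
      where open ≤-Reasoning

    -- A potential that drops by at least 1 in expectation at every step bounds
    -- 𝔼[T]; it suffices that this holds until a state is reached from which the
    -- bound is already known.
    drift : (Ψ : S → ℚ) (Dom : S → Set) → (∀ s → 0ℚ ≤ Ψ s) →
            (∀ {s s′} → Dom s → s′ ∈ˡ next s → Dom s′) →
            (∀ s → Dom s → (∀ N → 𝔼[T∧ N ] s ≤ Ψ s) ⊎ 1ℚ + average Ψ (next s) ≤ Ψ s) →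
            ∀ N s → Dom s → 𝔼[T∧ N ] s ≤ Ψ s
    drift Ψ Dom Ψ≥0 closed h zero    s d = Ψ≥0 s
    drift Ψ Dom Ψ≥0 closed h (suc N) s d with h s d
    ... | inj₁ known = known (suc N)
    ... | inj₂ drop  = if-elim (_≤ Ψ s) (does (done? s)) (Ψ≥0 s) (≤-trans
      (+-monoʳ-≤ 1ℚ (average-mono (next s) (λ {x} x∈ → drift Ψ Dom Ψ≥0 closed h N x (closed d x∈)))) drop)

    module _ (A : Absorbing) where
      open Absorbing A

      private
        η : ℚ
        η = inv (ι (suc D))

        0<η : 0ℚ < η
        0<η = inv>0 (0<ι-suc D)

        η≤1 : η ≤ 1ℚ
        η≤1 = inv-anti 0<1 (ι-mono {1} {suc D} (ℕ.s≤s ℕ.z≤n))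

        η^≤1 : ∀ k → η ^ℚ k ≤ 1ℚ
        η^≤1 zero    = ≤-refl
        η^≤1 (suc k) = ≤-trans (*-monoˡ η (<⇒≤ 0<η) (η^≤1 k)) (≤-trans (≤-reflexive (*-identityʳ η)) η≤1)

        q : ℚ
        q = 1ℚ - η ^ℚ K

        -- A fixed route of at most k moves to a done state is followed with probability at least η
        -- ^ k.
        reach⇒ℙ≥ : ∀ {k s} → Reach k s → ℙ[T≥ suc k ] s ≤ 1ℚ - η ^ℚ k
        reach⇒ℙ≥ {k} {s} (stop d) rewrite dec-true (done? s) d = diff≥0 (η^≤1 k)
        reach⇒ℙ≥ {suc k} {s} (step s′∈ r) = if-elim (_≤ 1ℚ - η ^ℚ suc k) (does (done? s)) (diff≥0 (η^≤1 (suc k)))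
          (average-deficit (η ^ℚ k) (next s) (^≥0 (<⇒≤ 0<η) k) (ℙ≥-≤1 (suc k)) s′∈ (reach⇒ℙ≥ r) (len≤D s))

        -- After t moves the state still satisfies `Inv`, so the route of length K is available
        -- again. A block has `suc K` moves because `reach⇒ℙ≥` bounds the event T > K.
        geometric : ∀ t {s} → Inv s → ℙ[T≥ t ℕ.+ suc K ] s ≤ q * ℙ[T≥ t ] s
        geometric zero    i = ≤-trans (reach⇒ℙ≥ (reach i)) (≤-reflexive (sym (*-identityʳ q)))
        geometric (suc t) {s} i = if-rel (λ x y → x ≤ q * y) (does (done? s)) (≤-reflexive (sym (*-zeroʳ q)))
          (≤-trans (average-mono (next s) (λ x∈ → geometric t (Inv-next i x∈))) (≤-reflexive (average-* q ℙ[T≥ t ] (next s))))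

        ℙ≥≤q^ : ∀ j {s} → Inv s → ℙ[T≥ j ℕ.* suc K ] s ≤ q ^ℚ j
        ℙ≥≤q^ zero    i = ≤-refl
        ℙ≥≤q^ (suc j) {s} i = subst (λ k → ℙ[T≥ k ] s ≤ q ^ℚ suc j) (ℕₚ.+-comm (j ℕ.* suc K) (suc K))
          (≤-trans (geometric (j ℕ.* suc K) i) (*-monoˡ q (diff≥0 (η^≤1 K)) (ℙ≥≤q^ j i)))

        next-nonempty : ∀ {s} → Inv s → ¬ Done s → 0 ℕ.< length (next s)
        next-nonempty i ¬d with reach i
        ... | stop d     = contradiction d ¬d
        ... | step s′∈ _ = 0<length s′∈

      -- The events T < m and T ≥ m exhaust everything unless mass is lost, which happens at a state
      -- without successors, where `average` is 0 by default. `Inv` excludes this: from a state that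
      -- is not done a move towards a done one exists.
      total : ∀ m {s} → Inv s → 1ℚ ≤ ΣP m s + ℙ[T≥ m ] s
      total zero    i = ≤-refl
      total (suc m) {s} i rewrite ΣP-suc m s with done? s
      ... | yes _ = ≤-refl
      ... | no ¬d = begin
        1ℚ                                                ≡⟨ average-1 (next s) (next-nonempty i ¬d) ⟨
        average (λ _ → 1ℚ) (next s)                       ≤⟨ average-mono (next s) (λ x∈ → total m (Inv-next i x∈)) ⟩
        average (λ x → ΣP m x + ℙ[T≥ m ] x) (next s)      ≡⟨ average-+ (ΣP m) ℙ[T≥ m ] (next s) ⟩
        average (ΣP m) (next s) + average ℙ[T≥ m ] (next s) ∎
        where open ≤-Reasoning

      -- min(T, N) is at most T on the event T < m and at most N on the event T ≥ m.
      𝔼∧≤partial-𝔼+ : ∀ m N {s} → Inv s → 𝔼[T∧ N ] s ≤ partial-𝔼 s m + ι N * ℙ[T≥ m ] s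
      𝔼∧≤partial-𝔼+ m zero {s} i = +≥0 (Σ≥0 m (λ t → *≥0 (ι≥0 t) (ℙ≡-≥0 t s))) (≤-reflexive (sym (*-zeroˡ (ℙ[T≥ m ] s))))
      𝔼∧≤partial-𝔼+ zero (suc N) {s} i = ≤-trans (𝔼∧≤ (suc N) s) (≤-reflexive (solve 1 (λ a → a := con 0ℚ :+ a :* con 1ℚ) refl (ι (suc N))))
      𝔼∧≤partial-𝔼+ (suc m) (suc N) {s} i rewrite partial-𝔼-suc m s with done? s
      ... | yes _ = ≤-reflexive (trans (sym (*-zeroʳ (ι (suc N)))) (sym (+-identityˡ _)))
      ... | no ¬d = begin
        1ℚ + average 𝔼[T∧ N ] (next s)
          ≡⟨ cong (_+ average 𝔼[T∧ N ] (next s)) (average-1 (next s) (next-nonempty i ¬d)) ⟨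
        average (λ _ → 1ℚ) (next s) + average 𝔼[T∧ N ] (next s)
          ≡⟨ average-+ (λ _ → 1ℚ) 𝔼[T∧ N ] (next s) ⟨
        average (λ x → 1ℚ + 𝔼[T∧ N ] x) (next s)
          ≤⟨ average-mono (next s) (λ {x} x∈ → ≤-trans
               (+-mono-≤ (total m (Inv-next i x∈)) (𝔼∧≤partial-𝔼+ m N (Inv-next i x∈)))
               (≤-reflexive (trans
                 (solve 4 (λ a b c d → a :+ b :+ (c :+ d :* b) := a :+ c :+ (con 1ℚ :+ d) :* b) refl (ΣP m x) (ℙ[T≥ m ] x) (partial-𝔼 x m) (ι N))
                 (cong (λ z → ΣP m x + partial-𝔼 x m + z * ℙ[T≥ m ] x) (sym (ι-suc N)))))) ⟩
        average (λ x → ΣP m x + partial-𝔼 x m + ι (suc N) * ℙ[T≥ m ] x) (next s)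
          ≡⟨ average-+ (λ x → ΣP m x + partial-𝔼 x m) (λ x → ι (suc N) * ℙ[T≥ m ] x) (next s) ⟩
        average (λ x → ΣP m x + partial-𝔼 x m) (next s) + average (λ x → ι (suc N) * ℙ[T≥ m ] x) (next s)
          ≡⟨ cong (average (λ x → ΣP m x + partial-𝔼 x m) (next s) +_) (average-* (ι (suc N)) ℙ[T≥ m ] (next s)) ⟩
        average (λ x → ΣP m x + partial-𝔼 x m) (next s) + ι (suc N) * average ℙ[T≥ m ] (next s) ∎
        where open ≤-Reasoning

      -- For fixed N the error N · ℙ[T ≥ m] decays geometrically in m. The index is pushed beyond m₀
      -- so that a Cauchy modulus can later compare it with any other late index.
      𝔼∧-limit : ∀ {s} → Inv s → ∀ N m₀ {ε} → 0ℚ < ε → ∃[ m ] (m₀ ℕ.≤ m × 𝔼[T∧ N ] s ≤ partial-𝔼 s m + ε)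
      𝔼∧-limit {s} i N m₀ {ε} 0<ε = m₀ ℕ.+ j ℕ.* suc K , ℕₚ.m≤m+n m₀ _ , (begin
          𝔼[T∧ N ] s                                                ≤⟨ 𝔼∧≤partial-𝔼+ (j ℕ.* suc K) N i ⟩
          partial-𝔼 s (j ℕ.* suc K) + ι N * ℙ[T≥ j ℕ.* suc K ] s    ≤⟨ +-mono-≤ (Σ-mono-range (λ t → *≥0 (ι≥0 t) (ℙ≡-≥0 t s)) (ℕₚ.m≤n+m (j ℕ.* suc K) m₀)) (*-monoˡ (ι N) (ι≥0 N) (ℙ≥≤q^ j i)) ⟩
          partial-𝔼 s (m₀ ℕ.+ j ℕ.* suc K) + ι N * q ^ℚ j           ≤⟨ +-monoʳ-≤ (partial-𝔼 s (m₀ ℕ.+ j ℕ.* suc K)) (≤-trans (≤-reflexive (*-comm (ι N) (q ^ℚ j))) (proj₂ jp)) ⟩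
          partial-𝔼 s (m₀ ℕ.+ j ℕ.* suc K) + ε                      ∎)
        where
        open ≤-Reasoning
        q<1 : q < 1ℚ
        q<1 = subst (q <_) (+-identityʳ 1ℚ) (+-monoʳ-< 1ℚ (neg-antimono-< (^>0 0<η K)))
        jp = ^→0 (diff≥0 (η^≤1 K)) q<1 (ι N) 0<ε
        j : ℕ
        j = proj₁ jp

  -- Cuts and the cover time

  module _ {n : ℕ} where

    ∑ : (Fin n → ℚ) → ℚ
    ∑ f = sumOver f (allFin n)

    -- Encoded by `filter` and `T?` in order that `degree G v` is `# (adj G v)` by computation.
    # : (Fin n → Bool) → ℕ
    # p = length (filter (λ u → T? (p u)) (allFin n))

    ∑-cong : ∀ {f g : Fin n → ℚ} → (∀ v → f v ≡ g v) → ∑ f ≡ ∑ g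
    ∑-cong = sumOver-cong (allFin n)

    ∑-mono : ∀ {f g : Fin n → ℚ} → (∀ v → f v ≤ g v) → ∑ f ≤ ∑ g
    ∑-mono h = sumOver-mono (allFin n) (λ {v} _ → h v)

    ∑-+ : ∀ (f g : Fin n → ℚ) → ∑ (λ v → f v + g v) ≡ ∑ f + ∑ g
    ∑-+ f g = sumOver-+ f g (allFin n)

    ∑-* : ∀ q (f : Fin n → ℚ) → ∑ (λ v → q * f v) ≡ q * ∑ f
    ∑-* q f = sumOver-* q f (allFin n)

    ∑≥0 : ∀ {f : Fin n → ℚ} → (∀ v → 0ℚ ≤ f v) → 0ℚ ≤ ∑ f
    ∑≥0 = sumOver-≥0 (allFin n)

    ι# : ∀ p → ι (# p) ≡ ∑ (𝟙 ∘ p)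
    ι# p = begin
      ι (# p)                                                ≡⟨ sumOver-1 (filter (λ u → T? (p u)) (allFin n)) ⟨
      sumOver (λ _ → 1ℚ) (filter (λ u → T? (p u)) (allFin n)) ≡⟨ sumOver-filter (λ u → T? (p u)) (λ _ → 1ℚ) (allFin n) ⟩
      ∑ (λ v → 𝟙 (p v) * 1ℚ)                                 ≡⟨ ∑-cong (λ v → *-identityʳ (𝟙 (p v))) ⟩
      ∑ (𝟙 ∘ p)                                              ∎
      where open ≡-Reasoning

    length-allFin : length (allFin n) ≡ n
    length-allFin = Listₚ.length-tabulate {n = n} id

    ∑-1 : ∑ (λ _ → 1ℚ) ≡ ι n
    ∑-1 = trans (sumOver-1 (allFin n)) (cong ι length-allFin)

    #≤n : ∀ p → # p ℕ.≤ n
    #≤n p = ℕₚ.≤-trans (Listₚ.length-filter (λ u → T? (p u)) (allFin n)) (ℕₚ.≤-reflexive length-allFin)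

    #-mono : ∀ {p q : Fin n → Bool} → (∀ v → 𝟙 (p v) ≤ 𝟙 (q v)) → # p ℕ.≤ # q
    #-mono {p} {q} h = ι-cancel-≤ (subst₂ _≤_ (sym (ι# p)) (sym (ι# q)) (∑-mono h))

    #>0 : ∀ p {v} → T (p v) → 0 ℕ.< # p
    #>0 p {v} pv = 0<length (∈ₚ.∈-filter⁺ (λ u → T? (p u)) (∈ₚ.∈-allFin v) pv)

    #≡0⇒ : ∀ p → # p ≡ 0 → ∀ v → ¬ T (p v)
    #≡0⇒ p e v pv = ℕₚ.<⇒≢ (#>0 p pv) (sym e)

    member : Subset n → Fin n → Bool
    member I v = does (v ∈? I)

    ∈⇒member : ∀ {I v} → v ∈ I → member I v ≡ true
    ∈⇒member {I} {v} = dec-true (v ∈? I)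

    ∉⇒member : ∀ {I v} → v ∉ I → member I v ≡ false
    ∉⇒member {I} {v} = dec-false (v ∈? I)

    member⇒∈ : ∀ {I v} → member I v ≡ true → v ∈ I
    member⇒∈ {I} {v} e with v ∈? I
    ... | yes v∈I = v∈I

  some-vertex : ∀ {n} → 2 ℕ.≤ n → Fin n
  some-vertex (ℕ.s≤s _) = zero

  other-vertex : ∀ {n} → 2 ℕ.≤ n → (v : Fin n) → ∃[ w ] w ≢ v
  other-vertex (ℕ.s≤s (ℕ.s≤s _)) zero    = suc zero , λ ()
  other-vertex (ℕ.s≤s (ℕ.s≤s _)) (suc v) = zero , λ ()

  module _ {n : ℕ} (G : Graph n) where

    deg : Fin n → ℚ
    deg v = ι (degree G v)

    edge : Fin n → Fin n → ℚ
    edge v u = 𝟙 (adj G v u)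

    edge≥0 : ∀ v u → 0ℚ ≤ edge v u
    edge≥0 v u = 𝟙≥0 (adj G v u)

    edge-sym : ∀ v u → edge v u ≡ edge u v
    edge-sym v u = cong 𝟙 (symmetric G v u)

    deg≡∑ : ∀ v → deg v ≡ ∑ (edge v)
    deg≡∑ v = ι# (adj G v)

    into : (Fin n → Bool) → Fin n → ℚ
    into A v = ∑ (λ u → 𝟙 (A u) * edge v u)

    into≥0 : ∀ A v → 0ℚ ≤ into A v
    into≥0 A v = ∑≥0 (λ u → *≥0 (𝟙≥0 (A u)) (edge≥0 v u))

    edges : (Fin n → Bool) → (Fin n → Bool) → ℚ
    edges Q A = ∑ (λ v → 𝟙 (Q v) * into A v)

    edges-sym : ∀ Q A → edges Q A ≡ edges A Q
    edges-sym Q A = begin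
      ∑ (λ v → 𝟙 (Q v) * ∑ (λ u → 𝟙 (A u) * edge v u))    ≡⟨ ∑-cong (λ v → sym (∑-* (𝟙 (Q v)) (λ u → 𝟙 (A u) * edge v u))) ⟩
      ∑ (λ v → ∑ (λ u → 𝟙 (Q v) * (𝟙 (A u) * edge v u)))  ≡⟨ sumOver-swap (λ v u → 𝟙 (Q v) * (𝟙 (A u) * edge v u)) (allFin n) (allFin n) ⟩
      ∑ (λ u → ∑ (λ v → 𝟙 (Q v) * (𝟙 (A u) * edge v u)))  ≡⟨ ∑-cong (λ u → ∑-cong (λ v → trans
            (solve 3 (λ a b c → a :* (b :* c) := b :* (a :* c)) refl (𝟙 (Q v)) (𝟙 (A u)) (edge v u))
            (cong (λ z → 𝟙 (A u) * (𝟙 (Q v) * z)) (edge-sym v u)))) ⟩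
      ∑ (λ u → ∑ (λ v → 𝟙 (A u) * (𝟙 (Q v) * edge u v)))  ≡⟨ ∑-cong (λ u → ∑-* (𝟙 (A u)) (λ v → 𝟙 (Q v) * edge u v)) ⟩
      ∑ (λ u → 𝟙 (A u) * ∑ (λ v → 𝟙 (Q v) * edge u v))    ∎
      where open ≡-Reasoning

    into-split : ∀ A v → into A v + into (not ∘ A) v ≡ deg v
    into-split A v = begin
      into A v + into (not ∘ A) v                              ≡⟨ ∑-+ (λ u → 𝟙 (A u) * edge v u) (λ u → 𝟙 (not (A u)) * edge v u) ⟨
      ∑ (λ u → 𝟙 (A u) * edge v u + 𝟙 (not (A u)) * edge v u)  ≡⟨ ∑-cong (λ u → lem (A u) (edge v u)) ⟩
      ∑ (edge v)                                               ≡⟨ deg≡∑ v ⟨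
      deg v                                                    ∎
      where
      open ≡-Reasoning
      lem : ∀ b e → 𝟙 b * e + 𝟙 (not b) * e ≡ e
      lem true  = solve 1 (λ e → con 1ℚ :* e :+ con 0ℚ :* e := e) refl
      lem false = solve 1 (λ e → con 0ℚ :* e :+ con 1ℚ :* e := e) refl

    into≤deg : ∀ A v → into A v ≤ deg v
    into≤deg A v = ≤-by (into (not ∘ A) v) (sym (into-split A v)) (into≥0 (not ∘ A) v)

    δ≤degree : ∀ v → δ G ℕ.≤ degree G v
    δ≤degree v = All.lookup (min≤xs n (map (degree G) (allFin n))) (∈ₚ.∈-map⁺ (degree G) (∈ₚ.∈-allFin v))

    degree≤Δ : ∀ v → degree G v ℕ.≤ Δ G
    degree≤Δ v = All.lookup (xs≤max 0 (map (degree G) (allFin n))) (∈ₚ.∈-map⁺ (degree G) (∈ₚ.∈-allFin v))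

    average-neighbours : ∀ {v} → 0 ℕ.< degree G v → ∀ f → deg v * average f (neighbours G v) ≡ ∑ (λ u → edge v u * f u)
    average-neighbours {v} 0<d f = begin
      deg v * (sumOver f (neighbours G v) * inv (deg v)) ≡⟨ *-inv-cancel (sumOver f (neighbours G v)) (ι>0 0<d) ⟩
      sumOver f (neighbours G v)                         ≡⟨ sumOver-filter (λ u → T? (adj G v u)) f (allFin n) ⟩
      ∑ (λ u → edge v u * f u)                           ∎
      where open ≡-Reasoning

    degree>0 : 2 ℕ.≤ n → ∀ v → 0 ℕ.< degree G v
    degree>0 2≤n v = first-step (connected G v (proj₁ (other-vertex 2≤n v))) (proj₂ (other-vertex 2≤n v))
      where
      first-step : ∀ {w} → Star (λ x y → T (adj G x y)) v w → w ≢ v → 0 ℕ.< degree G v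
      first-step Star.ε       w≢v = contradiction refl w≢v
      first-step (a Star.◅ _) _   = 0<length (∈-neighbours G a)

    δ>0 : 2 ℕ.≤ n → 0 ℕ.< δ G
    δ>0 2≤n = v<min⁺ {xs = map (degree G) (allFin n)} (ℕₚ.<-≤-trans (ℕ.s≤s ℕ.z≤n) 2≤n) (Allₚ.map⁺ (All.tabulate (λ {v} _ → degree>0 2≤n v)))

    δ≤n : 2 ℕ.≤ n → δ G ℕ.≤ n
    δ≤n (ℕ.s≤s _) = ℕₚ.≤-trans (δ≤degree zero) (degree≤n G zero)

  module _ {n : ℕ} (G : Graph n) (2≤n : 2 ℕ.≤ n) where

    open Truncated (walk-next G) (λ s → full? G (proj₂ s)) using () renaming (𝔼[T∧_] to 𝔼[cover∧_]; 𝔼∧≥0 to 𝔼cover≥0)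

    module _ {M : ℚ} (cover≤M : ∀ N v → 𝔼[cover∧ N ] (v , ⁅ v ⁆) ≤ M) where

      private
        0≤M : 0ℚ ≤ M
        0≤M = cover≤M 0 (some-vertex 2≤n)

      module _ (S : Fin n → Bool) where

        vol cut : ℚ
        vol = ∑ (λ v → 𝟙 (S v) * deg G v)
        cut = edges G S (not ∘ S)

        -- Expected time, truncated at N, for the walk to leave S.
        exit : ℕ → Fin n → ℚ
        exit zero    v = 0ℚ
        exit (suc N) v = if S v then 1ℚ + average (exit N) (neighbours G v) else 0ℚ

        exit≥0 : ∀ N v → 0ℚ ≤ exit N v
        exit≥0 zero    v = ≤-refl
        exit≥0 (suc N) v = if-elim (0ℚ ≤_) (S v) (+≥0 0≤1 (average-≥0 (neighbours G v) (exit≥0 N))) ≤-refl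

        exit-outside : ∀ N {v} → S v ≡ false → exit N v ≡ 0ℚ
        exit-outside zero    e = refl
        exit-outside (suc N) e rewrite e = refl

        module _ {w : Fin n} (w∉S : S w ≡ false) where

          -- While the visited set U stays inside S, the vertex w is unvisited and the covering walk
          -- is not done, so both recursions make the same step. At the first vertex outside S the
          -- left side becomes 0.
          exit≤cover : ∀ N v U → (∀ u → u ∈ U → S u ≡ true) → exit N v ≤ 𝔼[cover∧ N ] (v , U)
          exit≤cover zero    v U U⊆S = ≤-refl
          exit≤cover (suc N) v U U⊆S = ≤-trans (lem (S v)) (≤-reflexive (sym eq))
            where
            ¬done : ¬ (U ≡ ⊤)
            ¬done refl = contradiction (trans (sym (U⊆S w Subₚ.∈⊤)) w∉S) (λ ())
            eq : 𝔼[cover∧ suc N ] (v , U) ≡ 1ℚ + average (λ u → 𝔼[cover∧ N ] (u , U ∪ ⁅ u ⁆)) (neighbours G v)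
            eq = trans (cong (λ b → if b then 0ℚ else 1ℚ + average 𝔼[cover∧ N ] (walk-next G (v , U))) (dec-false (full? G U) ¬done))
              (cong (1ℚ +_) (average-map 𝔼[cover∧ N ] (λ u → u , U ∪ ⁅ u ⁆) (neighbours G v)))
            step : ∀ u → exit N u ≤ 𝔼[cover∧ N ] (u , U ∪ ⁅ u ⁆)
            step u with S u in e
            ... | false = ≤-trans (≤-reflexive (exit-outside N e)) (𝔼cover≥0 N (u , U ∪ ⁅ u ⁆))
            ... | true  = exit≤cover N u (U ∪ ⁅ u ⁆) λ x x∈ → case x (Subₚ.x∈p∪q⁻ U ⁅ u ⁆ x∈)
              where
              case : ∀ x → x ∈ U ⊎ x ∈ ⁅ u ⁆ → S x ≡ true
              case x (inj₁ x∈U) = U⊆S x x∈U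
              case x (inj₂ x∈u) = subst (λ z → S z ≡ true) (sym (Subₚ.x∈⁅y⁆⇒x≡y u x∈u)) e
            lem : ∀ b → (if b then 1ℚ + average (exit N) (neighbours G v) else 0ℚ)
                        ≤ 1ℚ + average (λ u → 𝔼[cover∧ N ] (u , U ∪ ⁅ u ⁆)) (neighbours G v)
            lem true  = +-monoʳ-≤ 1ℚ (average-mono (neighbours G v) (λ {u} _ → step u))
            lem false = +≥0 0≤1 (average-≥0 (neighbours G v) (λ u → 𝔼cover≥0 N (u , U ∪ ⁅ u ⁆)))

          exit≤M : ∀ N v → exit N v ≤ M
          exit≤M N v with S v in e
          ... | false = ≤-trans (≤-reflexive (exit-outside N e)) 0≤M
          ... | true  = ≤-trans (exit≤cover N v ⁅ v ⁆ (λ u u∈ → subst (λ z → S z ≡ true) (sym (Subₚ.x∈⁅y⁆⇒x≡y v u∈)) e)) (cover≤M N v)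

          weighted : ℕ → ℚ
          weighted N = ∑ (λ v → 𝟙 (S v) * (deg G v * exit N v))

          -- Reversibility of the walk: the weight `deg G v` cancels the averaging over neighbours,
          -- and by symmetry of the edges the value at a target u is then collected once for each
          -- neighbour of u in S.
          weighted-suc : ∀ N → weighted (suc N) ≡ vol + ∑ (λ u → exit N u * into G S u)
          weighted-suc N = begin
            ∑ (λ v → 𝟙 (S v) * (deg G v * exit (suc N) v))
              ≡⟨ ∑-cong pointwise ⟩
            ∑ (λ v → 𝟙 (S v) * deg G v + 𝟙 (S v) * ∑ (λ u → edge G v u * exit N u))
              ≡⟨ ∑-+ (λ v → 𝟙 (S v) * deg G v) (λ v → 𝟙 (S v) * ∑ (λ u → edge G v u * exit N u)) ⟩
            vol + ∑ (λ v → 𝟙 (S v) * ∑ (λ u → edge G v u * exit N u))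
              ≡⟨ cong (vol +_) (∑-cong (λ v → sym (∑-* (𝟙 (S v)) (λ u → edge G v u * exit N u)))) ⟩
            vol + ∑ (λ v → ∑ (λ u → 𝟙 (S v) * (edge G v u * exit N u)))
              ≡⟨ cong (vol +_) (sumOver-swap (λ v u → 𝟙 (S v) * (edge G v u * exit N u)) (allFin n) (allFin n)) ⟩
            vol + ∑ (λ u → ∑ (λ v → 𝟙 (S v) * (edge G v u * exit N u)))
              ≡⟨ cong (vol +_) (∑-cong (λ u → trans (∑-cong (λ v → trans
                   (cong (λ z → 𝟙 (S v) * (z * exit N u)) (edge-sym G v u))
                   (solve 3 (λ a b c → a :* (b :* c) := c :* (a :* b)) refl (𝟙 (S v)) (edge G u v) (exit N u))))
                 (∑-* (exit N u) (λ v → 𝟙 (S v) * edge G u v)))) ⟩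
            vol + ∑ (λ u → exit N u * into G S u) ∎
            where
            open ≡-Reasoning
            pointwise : ∀ v → 𝟙 (S v) * (deg G v * exit (suc N) v) ≡ 𝟙 (S v) * deg G v + 𝟙 (S v) * ∑ (λ u → edge G v u * exit N u)
            pointwise v with S v
            ... | false = solve 2 (λ d s → con 0ℚ :* (d :* con 0ℚ) := con 0ℚ :* d :+ con 0ℚ :* s) refl (deg G v) (∑ (λ u → edge G v u * exit N u))
            ... | true  = trans (solve 2 (λ d a → con 1ℚ :* (d :* (con 1ℚ :+ a)) := con 1ℚ :* d :+ con 1ℚ :* (d :* a)) refl (deg G v) (average (exit N) (neighbours G v)))
              (cong (λ z → 1ℚ * deg G v + 1ℚ * z) (average-neighbours G {v} (degree>0 G 2≤n v) (exit N)))

          -- For u in S the degree splits into edges to S, which reappear in `weighted-suc`, and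
          -- edges of the cut, each of which carries an exit time of at most M.
          weighted-step : ∀ N → vol + weighted N ≤ weighted (suc N) + M * cut
          weighted-step N = begin
            vol + weighted N                                                          ≤⟨ +-monoʳ-≤ vol (∑-mono pointwise) ⟩
            vol + ∑ (λ u → exit N u * into G S u + M * (𝟙 (S u) * into G (not ∘ S) u)) ≡⟨ cong (vol +_) (∑-+ (λ u → exit N u * into G S u) (λ u → M * (𝟙 (S u) * into G (not ∘ S) u))) ⟩
            vol + (a + ∑ (λ u → M * (𝟙 (S u) * into G (not ∘ S) u)))                  ≡⟨ +-assoc vol a (∑ (λ u → M * (𝟙 (S u) * into G (not ∘ S) u))) ⟨
            vol + a + ∑ (λ u → M * (𝟙 (S u) * into G (not ∘ S) u))                    ≡⟨ cong₂ _+_ (sym (weighted-suc N)) (∑-* M (λ u → 𝟙 (S u) * into G (not ∘ S) u)) ⟩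
            weighted (suc N) + M * cut                                                ∎
            where
            open ≤-Reasoning
            a : ℚ
            a = ∑ (λ u → exit N u * into G S u)
            pointwise : ∀ u → 𝟙 (S u) * (deg G u * exit N u) ≤ exit N u * into G S u + M * (𝟙 (S u) * into G (not ∘ S) u)
            pointwise u = subst (λ d → 𝟙 (S u) * (d * x) ≤ x * i + M * (𝟙 (S u) * o)) (into-split G S u) (lem (S u))
              where
              x i o : ℚ
              x = exit N u
              i = into G S u
              o = into G (not ∘ S) u
              lem : ∀ b → 𝟙 b * ((i + o) * x) ≤ x * i + M * (𝟙 b * o)
              lem true  = ≤-by ((M - x) * o) (solve 4 (λ i o x m → x :* i :+ m :* (con 1ℚ :* o) := con 1ℚ :* ((i :+ o) :* x) :+ (m :- x) :* o) refl i o x M)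
                (*≥0 (diff≥0 (exit≤M N u)) (into≥0 G (not ∘ S) u))
              lem false = ≤-by (x * i) (solve 4 (λ i o x m → x :* i :+ m :* (con 0ℚ :* o) := con 0ℚ :* ((i :+ o) :* x) :+ x :* i) refl i o x M)
                (*≥0 (exit≥0 N u) (into≥0 G S u))

          weighted-sum : ∀ N → ι N * vol ≤ weighted N + ι N * (M * cut)
          weighted-sum zero    = ≤-trans (≤-reflexive (*-zeroˡ vol)) (+≥0 (∑≥0 (λ v → *≥0 (𝟙≥0 (S v)) (*≥0 (ι≥0 (degree G v)) ≤-refl))) (≤-reflexive (sym (*-zeroˡ (M * cut)))))
          weighted-sum (suc N) = begin
            ι (suc N) * vol                                  ≡⟨ cong (_* vol) (ι-suc N) ⟩
            (1ℚ + ι N) * vol                                 ≡⟨ solve 2 (λ a v → (con 1ℚ :+ a) :* v := v :+ a :* v) refl (ι N) vol ⟩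
            vol + ι N * vol                                  ≤⟨ +-monoʳ-≤ vol (weighted-sum N) ⟩
            vol + (weighted N + ι N * (M * cut))             ≡⟨ +-assoc vol (weighted N) (ι N * (M * cut)) ⟨
            vol + weighted N + ι N * (M * cut)               ≤⟨ +-monoˡ-≤ (ι N * (M * cut)) (weighted-step N) ⟩
            weighted (suc N) + M * cut + ι N * (M * cut)     ≡⟨ solve 3 (λ w c a → w :+ c :+ a :* c := w :+ (con 1ℚ :+ a) :* c) refl (weighted (suc N)) (M * cut) (ι N) ⟩
            weighted (suc N) + (1ℚ + ι N) * (M * cut)        ≡⟨ cong (λ z → weighted (suc N) + z * (M * cut)) (ι-suc N) ⟨
            weighted (suc N) + ι (suc N) * (M * cut)         ∎
            where open ≤-Reasoning

          weighted≤ : ∀ N → weighted N ≤ M * vol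
          weighted≤ N = begin
            weighted N                            ≤⟨ ∑-mono (λ v → *-monoˡ (𝟙 (S v)) (𝟙≥0 (S v)) (*-monoˡ (deg G v) (ι≥0 (degree G v)) (exit≤M N v))) ⟩
            ∑ (λ v → 𝟙 (S v) * (deg G v * M))     ≡⟨ ∑-cong (λ v → solve 3 (λ a b c → a :* (b :* c) := c :* (a :* b)) refl (𝟙 (S v)) (deg G v) M) ⟩
            ∑ (λ v → M * (𝟙 (S v) * deg G v))     ≡⟨ ∑-* M (λ v → 𝟙 (S v) * deg G v) ⟩
            M * vol                               ∎
            where open ≤-Reasoning

          vol≥0 : 0ℚ ≤ vol
          vol≥0 = ∑≥0 (λ v → *≥0 (𝟙≥0 (S v)) (ι≥0 (degree G v)))

          -- N · vol ≤ M · vol + N · M · cut for every N; take N ≥ 2 M.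
          vol≤2M-cut : vol ≤ (1ℚ + 1ℚ) * (M * cut)
          vol≤2M-cut with archimedean (1ℚ + (M + M)) 0<1
          ... | N , 2M<N = cancelˡ (ι N) 0<N (begin
              ι N * vol
                ≤⟨ ≤-by ((ι N - (M + M)) * vol) (solve 3 (λ a m v → (con 1ℚ :+ con 1ℚ) :* (a :* v :- m :* v) := a :* v :+ (a :- (m :+ m)) :* v) refl (ι N) M vol)
                   (*≥0 (diff≥0 2M≤N) vol≥0) ⟩
              (1ℚ + 1ℚ) * (ι N * vol - M * vol)
                ≤⟨ *-monoˡ (1ℚ + 1ℚ) (+≥0 0≤1 0≤1) (≤-by {ι N * vol - M * vol} (M * vol + ι N * (M * cut) - ι N * vol)
                     (solve 3 (λ a b c → c := a :- b :+ (b :+ c :- a)) refl (ι N * vol) (M * vol) (ι N * (M * cut)))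
                     (diff≥0 (≤-trans (weighted-sum N) (+-monoˡ-≤ (ι N * (M * cut)) (weighted≤ N))))) ⟩
              (1ℚ + 1ℚ) * (ι N * (M * cut))
                ≡⟨ solve 2 (λ a c → (con 1ℚ :+ con 1ℚ) :* (a :* c) := a :* ((con 1ℚ :+ con 1ℚ) :* c)) refl (ι N) (M * cut) ⟩
              ι N * ((1ℚ + 1ℚ) * (M * cut)) ∎)
            where
            open ≤-Reasoning
            1+2M≤N : 1ℚ + (M + M) ≤ ι N
            1+2M≤N = ≤-trans 2M<N (≤-reflexive (*-identityʳ (ι N)))
            2M≤N : M + M ≤ ι N
            2M≤N = ≤-trans (≤-by 1ℚ (+-comm 1ℚ (M + M)) 0≤1) 1+2M≤N
            0<N : 0ℚ < ι N
            0<N = <-≤-trans 0<1 (≤-trans (≤-by (M + M) refl (+≥0 0≤M 0≤M)) 1+2M≤N)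

      -- `vol≤2M-cut` is used for S and for its complement: they have the same cut, and their
      -- volumes add up to at least n δ. Of the two witnesses, w lies outside S and v outside the
      -- complement.
      cut-bound : ∀ S {v w} → S v ≡ true → S w ≡ false → ι n * ι (δ G) ≤ ι 4 * (M * edges G S (not ∘ S))
      cut-bound S {v} {w} v∈S w∉S = begin
        ι n * ι (δ G)                               ≡⟨ *-comm (ι n) (ι (δ G)) ⟩
        ι (δ G) * ι n                               ≡⟨ cong (ι (δ G) *_) (∑-1 {n}) ⟨
        ι (δ G) * ∑ {n} (λ _ → 1ℚ)                      ≡⟨ ∑-* {n} (ι (δ G)) (λ _ → 1ℚ) ⟨
        ∑ {n} (λ _ → ι (δ G) * 1ℚ)                      ≤⟨ ∑-mono (λ u → ≤-trans (≤-reflexive (*-identityʳ (ι (δ G)))) (ι-mono (δ≤degree G u))) ⟩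
        ∑ (deg G)                                   ≡⟨ ∑-cong (λ u → lem (S u) (deg G u)) ⟩
        ∑ (λ u → 𝟙 (S u) * deg G u + 𝟙 (not (S u)) * deg G u) ≡⟨ ∑-+ (λ u → 𝟙 (S u) * deg G u) (λ u → 𝟙 (not (S u)) * deg G u) ⟩
        vol S + vol (not ∘ S)                       ≤⟨ +-mono-≤ (vol≤2M-cut S w∉S) (vol≤2M-cut (not ∘ S) {v} (cong not v∈S)) ⟩
        (1ℚ + 1ℚ) * (M * c) + (1ℚ + 1ℚ) * (M * edges G (not ∘ S) (not ∘ not ∘ S))
          ≡⟨ cong (λ z → (1ℚ + 1ℚ) * (M * c) + (1ℚ + 1ℚ) * (M * z)) (trans (edges-sym G (not ∘ S) (not ∘ not ∘ S)) (∑-cong (λ u → cong (λ b → 𝟙 b * into G (not ∘ S) u) (not-involutive (S u))))) ⟩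
        (1ℚ + 1ℚ) * (M * c) + (1ℚ + 1ℚ) * (M * c)   ≡⟨ solve 1 (λ c → (con 1ℚ :+ con 1ℚ) :* c :+ (con 1ℚ :+ con 1ℚ) :* c := con (ι 4) :* c) refl (M * c) ⟩
        ι 4 * (M * c)                               ∎
        where
        open ≤-Reasoning
        c : ℚ
        c = edges G S (not ∘ S)
        lem : ∀ b d → d ≡ 𝟙 b * d + 𝟙 (not b) * d
        lem true  = solve 1 (λ d → d := con 1ℚ :* d :+ con 0ℚ :* d) refl
        lem false = solve 1 (λ d → d := con 0ℚ :* d :+ con 1ℚ :* d) refl

  -- One round of pushes

  inv-* : ∀ {a b} → 0ℚ < a → 0ℚ < b → inv (a * b) ≡ inv a * inv b
  inv-* {a} {b} 0<a 0<b = begin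
    inv (a * b)                                     ≡⟨ solve 1 (λ x → x := x :* (con 1ℚ :* con 1ℚ)) refl (inv (a * b)) ⟩
    inv (a * b) * (1ℚ * 1ℚ)                         ≡⟨ cong₂ (λ y z → inv (a * b) * (y * z)) (*-inv 0<a) (*-inv 0<b) ⟨
    inv (a * b) * (a * inv a * (b * inv b))         ≡⟨ solve 5 (λ x a b i j → x :* (a :* i :* (b :* j)) := a :* b :* x :* (i :* j)) refl (inv (a * b)) a b (inv a) (inv b) ⟩
    a * b * inv (a * b) * (inv a * inv b)           ≡⟨ cong (_* (inv a * inv b)) (*-inv (*>0 0<a 0<b)) ⟩
    1ℚ * (inv a * inv b)                            ≡⟨ *-identityˡ (inv a * inv b) ⟩
    inv a * inv b                                   ∎
    where open ≡-Reasoning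

  length-cartesian : ∀ {A : Set} (us : List A) yss → length (cartesianProductWith _∷_ us yss) ≡ length us ℕ.* length yss
  length-cartesian []       yss = refl
  length-cartesian (u ∷ us) yss = trans (Listₚ.length-++ (map (u ∷_) yss))
    (cong₂ ℕ._+_ (Listₚ.length-map (u ∷_) yss) (length-cartesian us yss))

  sumOver-cartesian : ∀ {A : Set} (F : List A → ℚ) us yss →
                      sumOver F (cartesianProductWith _∷_ us yss) ≡ sumOver (λ u → sumOver (λ ys → F (u ∷ ys)) yss) us
  sumOver-cartesian F []       yss = refl
  sumOver-cartesian F (u ∷ us) yss = trans (sumOver-++ F (map (u ∷_) yss) (cartesianProductWith _∷_ us yss))
    (cong₂ _+_ (sumOver-map F (u ∷_) yss) (sumOver-cartesian F us yss))

  -- The singleton of w as a Boolean set, so that pushing to one given vertex is a special case of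
  -- pushing into a set.
  is : ∀ {n} → Fin n → Fin n → Bool
  is w u = does (w ≟ u)

  ∑-suc : ∀ {n} (f : Fin (suc n) → ℚ) → ∑ f ≡ f zero + ∑ (f ∘ suc)
  ∑-suc {n} f = cong (f zero +_) (trans (cong (sumOver f) (sym (Listₚ.map-tabulate id suc))) (sumOver-map f suc (allFin n)))

  ∑-is : ∀ {n} (w : Fin n) (f : Fin n → ℚ) → ∑ (λ u → 𝟙 (is w u) * f u) ≡ f w
  ∑-is {suc n} zero f = trans (∑-suc (λ u → 𝟙 (is zero u) * f u)) (begin
    1ℚ * f zero + ∑ (λ u → 0ℚ * f (suc u))  ≡⟨ cong (1ℚ * f zero +_) (∑-* 0ℚ (f ∘ suc)) ⟩
    1ℚ * f zero + 0ℚ * ∑ (f ∘ suc)          ≡⟨ solve 2 (λ a b → con 1ℚ :* a :+ con 0ℚ :* b := a) refl (f zero) (∑ (f ∘ suc)) ⟩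
    f zero                                  ∎)
    where open ≡-Reasoning
  ∑-is {suc n} (suc w) f = trans (∑-suc (λ u → 𝟙 (is (suc w) u) * f u)) (begin
    0ℚ * f zero + ∑ (λ u → 𝟙 (is w u) * f (suc u))  ≡⟨ cong (0ℚ * f zero +_) (∑-is w (f ∘ suc)) ⟩
    0ℚ * f zero + f (suc w)                         ≡⟨ solve 2 (λ a b → con 0ℚ :* a :+ b := b) refl (f zero) (f (suc w)) ⟩
    f (suc w)                                       ∎)
    where open ≡-Reasoning

  ∑-𝟙is : ∀ {n} (u : Fin n) → ∑ (λ w → 𝟙 (is w u)) ≡ 1ℚ
  ∑-𝟙is u = trans (∑-cong (λ w → trans (cong 𝟙 (is-sym w u)) (sym (*-identityʳ (𝟙 (is u w)))))) (∑-is u (λ _ → 1ℚ))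
    where
    is-sym : ∀ {n} (w u : Fin n) → is w u ≡ is u w
    is-sym w u with w ≟ u | u ≟ w
    ... | yes _ | yes _ = refl
    ... | no _  | no _  = refl
    ... | yes e | no ¬e = contradiction (sym e) ¬e
    ... | no ¬e | yes e = contradiction (sym e) ¬e

  module _ {n : ℕ} where

    -- Whether a vertex of Q pushes into A when the vertices vs choose us.
    hits : (Q A : Fin n → Bool) → List (Fin n) → List (Fin n) → Bool
    hits Q A (v ∷ vs) (u ∷ us) = (Q v ∧ A u) ∨ hits Q A vs us
    hits Q A _        _        = false

    hits⇒∈ : ∀ Q A vs us → hits Q A vs us ≡ true → ∃[ w ] (A w ≡ true × w ∈ˡ us)
    hits⇒∈ Q A (v ∷ vs) (u ∷ us) e with Q v | A u in Au
    ... | true  | true  = u , Au , here refl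
    ... | true  | false = let w , Aw , w∈ = hits⇒∈ Q A vs us e in w , Aw , there w∈
    ... | false | _     = let w , Aw , w∈ = hits⇒∈ Q A vs us e in w , Aw , there w∈

    hits-is⇒∈ : ∀ Q w vs us → hits Q (is w) vs us ≡ true → w ∈ˡ us
    hits-is⇒∈ Q w vs us e with hits⇒∈ Q (is w) vs us e
    ... | u , e′ , u∈ with w ≟ u
    ...   | yes refl = u∈

    -- Each vertex of Q in the list names one target and so accounts for at most one w.
    ∑-hits≤ : ∀ Q vs us → ∑ (λ w → 𝟙 (hits Q (is w) vs us)) ≤ sumOver (𝟙 ∘ Q) vs
    ∑-hits≤ Q []       us = ≤-reflexive (sumOver-0 (allFin n))
    ∑-hits≤ Q (v ∷ vs) [] = ≤-trans (≤-reflexive (sumOver-0 (allFin n))) (+≥0 (𝟙≥0 (Q v)) (sumOver-≥0 vs (λ x → 𝟙≥0 (Q x))))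
    ∑-hits≤ Q (v ∷ vs) (u ∷ us) = begin
      ∑ (λ w → 𝟙 ((Q v ∧ is w u) ∨ hits Q (is w) vs us))                ≤⟨ ∑-mono (λ w → lem (Q v) (is w u) (hits Q (is w) vs us)) ⟩
      ∑ (λ w → 𝟙 (Q v) * 𝟙 (is w u) + 𝟙 (hits Q (is w) vs us))          ≡⟨ ∑-+ (λ w → 𝟙 (Q v) * 𝟙 (is w u)) (λ w → 𝟙 (hits Q (is w) vs us)) ⟩
      ∑ (λ w → 𝟙 (Q v) * 𝟙 (is w u)) + ∑ (λ w → 𝟙 (hits Q (is w) vs us)) ≡⟨ cong (_+ ∑ (λ w → 𝟙 (hits Q (is w) vs us))) (trans (∑-* (𝟙 (Q v)) (λ w → 𝟙 (is w u))) (trans (cong (𝟙 (Q v) *_) (∑-𝟙is u)) (*-identityʳ (𝟙 (Q v))))) ⟩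
      𝟙 (Q v) + ∑ (λ w → 𝟙 (hits Q (is w) vs us))                       ≤⟨ +-monoʳ-≤ (𝟙 (Q v)) (∑-hits≤ Q vs us) ⟩
      𝟙 (Q v) + sumOver (𝟙 ∘ Q) vs                                      ∎
      where
      open ≤-Reasoning
      lem : ∀ a b c → 𝟙 ((a ∧ b) ∨ c) ≤ 𝟙 a * 𝟙 b + 𝟙 c
      lem true  true  c = ≤-by (𝟙 c) refl (𝟙≥0 c)
      lem true  false c = ≤-reflexive (sym (+-identityˡ (𝟙 c)))
      lem false true  c = ≤-reflexive (sym (+-identityˡ (𝟙 c)))
      lem false false c = ≤-reflexive (sym (+-identityˡ (𝟙 c)))

    ∈-⋃⁺ : ∀ {w : Fin n} us → w ∈ˡ us → w ∈ ⋃ (map ⁅_⁆ us)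
    ∈-⋃⁺ {w} (_ ∷ us) (here refl) = Subₚ.p⊆p∪q (⋃ (map ⁅_⁆ us)) (Subₚ.x∈⁅x⁆ w)
    ∈-⋃⁺ {w} (u ∷ us) (there w∈)  = Subₚ.q⊆p∪q ⁅ u ⁆ (⋃ (map ⁅_⁆ us)) (∈-⋃⁺ us w∈)

  module _ {n : ℕ} (G : Graph n) (2≤n : 2 ℕ.≤ n) where

    0<length-choices : ∀ vs → 0 ℕ.< length (choices G vs)
    0<length-choices []       = ℕ.s≤s ℕ.z≤n
    0<length-choices (v ∷ vs) = subst (0 ℕ.<_) (sym (length-cartesian (neighbours G v) (choices G vs)))
      (ℕₚ.*-mono-< (degree>0 G 2≤n v) (0<length-choices vs))

    -- Independence: the uniform distribution on a product list is a product measure, so the mean of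
    -- a product of functions of the factors is the product of the means.
    average-choices : ∀ (f : Fin n → ℚ) (g : List (Fin n) → ℚ) (F : List (Fin n) → ℚ) v vs → (∀ u us → F (u ∷ us) ≡ f u * g us) →
                      average F (choices G (v ∷ vs)) ≡ average f (neighbours G v) * average g (choices G vs)
    average-choices f g F v vs h = begin
      sumOver F (cartesianProductWith _∷_ N C) * inv (ι (length (cartesianProductWith _∷_ N C)))
        ≡⟨ cong₂ (λ x y → x * inv y) numerator (trans (cong ι (length-cartesian N C)) (ι-* (length N) (length C))) ⟩
      sumOver f N * sumOver g C * inv (ι (length N) * ι (length C))
        ≡⟨ cong (sumOver f N * sumOver g C *_) (inv-* (ι>0 (degree>0 G 2≤n v)) (ι>0 (0<length-choices vs))) ⟩
      sumOver f N * sumOver g C * (inv (ι (length N)) * inv (ι (length C)))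
        ≡⟨ solve 4 (λ a b c d → a :* b :* (c :* d) := a :* c :* (b :* d)) refl (sumOver f N) (sumOver g C) (inv (ι (length N))) (inv (ι (length C))) ⟩
      average f N * average g C ∎
      where
      open ≡-Reasoning
      N = neighbours G v
      C = choices G vs
      numerator : sumOver F (cartesianProductWith _∷_ N C) ≡ sumOver f N * sumOver g C
      numerator = begin
        sumOver F (cartesianProductWith _∷_ N C)          ≡⟨ sumOver-cartesian F N C ⟩
        sumOver (λ u → sumOver (λ us → F (u ∷ us)) C) N   ≡⟨ sumOver-cong N (λ u → trans (sumOver-cong C (h u)) (trans (sumOver-* (f u) g C) (*-comm (f u) (sumOver g C)))) ⟩
        sumOver (λ u → sumOver g C * f u) N               ≡⟨ sumOver-* (sumOver g C) f N ⟩
        sumOver g C * sumOver f N                         ≡⟨ *-comm (sumOver g C) (sumOver f N) ⟩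
        sumOver f N * sumOver g C                         ∎

    Δ⁻¹ : ℚ
    Δ⁻¹ = inv (ι (Δ G))

    0<Δ : 0ℚ < ι (Δ G)
    0<Δ = ι>0 (lem 2≤n)
      where
      lem : 2 ℕ.≤ n → 0 ℕ.< Δ G
      lem 2≤n@(ℕ.s≤s _) = ℕₚ.<-≤-trans (degree>0 G 2≤n zero) (degree≤Δ G zero)

    0≤Δ⁻¹ : 0ℚ ≤ Δ⁻¹
    0≤Δ⁻¹ = <⇒≤ (inv>0 0<Δ)

    module _ (Q A : Fin n → Bool) where

      -- A lower bound for the probability that v belongs to Q and pushes into A. Dividing by Δ
      -- instead of by the degree of v makes the loads add up to `edges G Q A * Δ⁻¹`.
      load : Fin n → ℚ
      load v = 𝟙 (Q v) * into G A v * Δ⁻¹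

      load≥0 : ∀ v → 0ℚ ≤ load v
      load≥0 v = *≥0 (*≥0 (𝟙≥0 (Q v)) (into≥0 G A v)) 0≤Δ⁻¹

      miss≤ : ∀ v → average (λ u → 𝟙 (not (Q v ∧ A u))) (neighbours G v) ≤ 1ℚ - load v
      miss≤ v = lem (Q v)
        where
        open ≤-Reasoning
        N = neighbours G v
        lem : ∀ b → average (λ u → 𝟙 (not (b ∧ A u))) N ≤ 1ℚ - 𝟙 b * into G A v * Δ⁻¹
        lem false = ≤-trans (≤-reflexive (average-1 N (degree>0 G 2≤n v)))
          (≤-reflexive (solve 2 (λ a b → con 1ℚ := con 1ℚ :- con 0ℚ :* a :* b) refl (into G A v) Δ⁻¹))
        lem true  = begin
          average (λ u → 𝟙 (not (A u))) N
            ≡⟨ average-cong N (λ u → 𝟙not (A u)) ⟩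
          average (λ u → 1ℚ + (- 1ℚ) * 𝟙 (A u)) N
            ≡⟨ trans (average-+ (λ _ → 1ℚ) (λ u → (- 1ℚ) * 𝟙 (A u)) N) (cong₂ _+_ (average-1 N (degree>0 G 2≤n v)) (average-* (- 1ℚ) (𝟙 ∘ A) N)) ⟩
          1ℚ + (- 1ℚ) * (sumOver (𝟙 ∘ A) N * inv (deg G v))
            ≡⟨ cong (λ z → 1ℚ + (- 1ℚ) * (z * inv (deg G v))) (trans (sumOver-filter (λ u → T? (adj G v u)) (𝟙 ∘ A) (allFin n)) (∑-cong (λ u → *-comm (edge G v u) (𝟙 (A u))))) ⟩
          1ℚ + (- 1ℚ) * (into G A v * inv (deg G v))
            ≡⟨ solve 1 (λ a → con 1ℚ :+ con (- 1ℚ) :* a := con 1ℚ :- a) refl (into G A v * inv (deg G v)) ⟩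
          1ℚ - into G A v * inv (deg G v)
            ≤⟨ +-monoʳ-≤ 1ℚ (neg-antimono-≤ (*-monoˡ (into G A v) (into≥0 G A v) (inv-anti (ι>0 (degree>0 G 2≤n v)) (ι-mono (degree≤Δ G v))))) ⟩
          1ℚ - into G A v * Δ⁻¹
            ≡⟨ cong (λ z → 1ℚ - z * Δ⁻¹) (sym (*-identityˡ (into G A v))) ⟩
          1ℚ - 1ℚ * into G A v * Δ⁻¹ ∎
          where
          𝟙not : ∀ b → 𝟙 (not b) ≡ 1ℚ + (- 1ℚ) * 𝟙 b
          𝟙not true  = refl
          𝟙not false = refl

      ℙ[miss] : List (Fin n) → ℚ
      ℙ[miss] vs = average (λ us → 𝟙 (not (hits Q A vs us))) (choices G vs)

      ℙmiss≥0 : ∀ vs → 0ℚ ≤ ℙ[miss] vs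
      ℙmiss≥0 vs = average-≥0 (choices G vs) (λ us → 𝟙≥0 (not (hits Q A vs us)))

      -- The choices are independent, so ℙ[miss] is a product of factors
      -- ≤ 1 - load v, and (1 - a) (1 + a + s) ≤ 1 + s.
      ℙmiss-bound : ∀ vs → ℙ[miss] vs * (1ℚ + sumOver load vs) ≤ 1ℚ
      ℙmiss-bound []       = ≤-refl
      ℙmiss-bound (v ∷ vs) = begin
        ℙ[miss] (v ∷ vs) * (1ℚ + (l + s))
          ≡⟨ cong (_* (1ℚ + (l + s))) (average-choices (λ u → 𝟙 (not (Q v ∧ A u))) (λ us → 𝟙 (not (hits Q A vs us))) (λ us → 𝟙 (not (hits Q A (v ∷ vs) us))) v vs (λ u us → 𝟙not∨ (Q v ∧ A u) (hits Q A vs us))) ⟩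
        p * x * (1ℚ + (l + s))
          ≤⟨ *-monoʳ (1ℚ + (l + s)) (+≥0 0≤1 (+≥0 (load≥0 v) s≥0)) (*-monoʳ x (ℙmiss≥0 vs) (miss≤ v)) ⟩
        (1ℚ - l) * x * (1ℚ + (l + s))
          ≤⟨ ≤-by (x * (l * l + l * s)) (solve 3 (λ x l s → x :* (con 1ℚ :+ s) := (con 1ℚ :- l) :* x :* (con 1ℚ :+ (l :+ s)) :+ x :* (l :* l :+ l :* s)) refl x l s)
               (*≥0 (ℙmiss≥0 vs) (+≥0 (*≥0 (load≥0 v) (load≥0 v)) (*≥0 (load≥0 v) s≥0))) ⟩
        x * (1ℚ + s)
          ≤⟨ ℙmiss-bound vs ⟩
        1ℚ ∎
        where
        open ≤-Reasoning
        l s p x : ℚ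
        l = load v
        s = sumOver load vs
        p = average (λ u → 𝟙 (not (Q v ∧ A u))) (neighbours G v)
        x = ℙ[miss] vs
        s≥0 : 0ℚ ≤ s
        s≥0 = sumOver-≥0 vs load≥0
        𝟙not∨ : ∀ a b → 𝟙 (not (a ∨ b)) ≡ 𝟙 (not a) * 𝟙 (not b)
        𝟙not∨ true  b = sym (*-zeroˡ (𝟙 (not b)))
        𝟙not∨ false b = sym (*-identityˡ (𝟙 (not b)))

      ℙ[hit] : List (Fin n) → ℚ
      ℙ[hit] vs = average (λ us → 𝟙 (hits Q A vs us)) (choices G vs)

      ℙhit+ℙmiss : ∀ vs → ℙ[hit] vs + ℙ[miss] vs ≡ 1ℚ
      ℙhit+ℙmiss vs = begin
        ℙ[hit] vs + ℙ[miss] vs                                                      ≡⟨ average-+ (λ us → 𝟙 (hits Q A vs us)) (λ us → 𝟙 (not (hits Q A vs us))) (choices G vs) ⟨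
        average (λ us → 𝟙 (hits Q A vs us) + 𝟙 (not (hits Q A vs us))) (choices G vs) ≡⟨ average-cong (choices G vs) (λ us → lem (hits Q A vs us)) ⟩
        average (λ _ → 1ℚ) (choices G vs)                                           ≡⟨ average-1 (choices G vs) (0<length-choices vs) ⟩
        1ℚ                                                                          ∎
        where
        open ≡-Reasoning
        lem : ∀ b → 𝟙 b + 𝟙 (not b) ≡ 1ℚ
        lem true  = refl
        lem false = refl

    sumOver-informed : ∀ {Q : Fin n → Bool} {I} (f : Fin n → ℚ) → (∀ v → Q v ≡ true → member I v ≡ true) →
                       sumOver (λ v → 𝟙 (Q v) * f v) (informed G I) ≡ ∑ (λ v → 𝟙 (Q v) * f v)
    sumOver-informed {Q} {I} f Q⊆I = trans (sumOver-filter (_∈? I) (λ v → 𝟙 (Q v) * f v) (allFin n)) (∑-cong pointwise)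
      where
      pointwise : ∀ v → 𝟙 (member I v) * (𝟙 (Q v) * f v) ≡ 𝟙 (Q v) * f v
      pointwise v with Q v in e
      ... | false = solve 2 (λ a b → a :* (con 0ℚ :* b) := con 0ℚ :* b) refl (𝟙 (member I v)) (f v)
      ... | true  = trans (cong (λ b → 𝟙 b * (1ℚ * f v)) (Q⊆I v e)) (*-identityˡ (1ℚ * f v))

    module _ {Q : Fin n → Bool} {I : Subset n} (Q⊆I : ∀ v → Q v ≡ true → member I v ≡ true) where

      miss-bound : ∀ A → ℙ[miss] Q A (informed G I) * (1ℚ + edges G Q A * Δ⁻¹) ≤ 1ℚ
      miss-bound A = subst (λ z → ℙ[miss] Q A (informed G I) * (1ℚ + z) ≤ 1ℚ) eq (ℙmiss-bound Q A (informed G I))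
        where
        open ≡-Reasoning
        eq : sumOver (load Q A) (informed G I) ≡ edges G Q A * Δ⁻¹
        eq = begin
          sumOver (λ v → 𝟙 (Q v) * into G A v * Δ⁻¹) (informed G I)    ≡⟨ sumOver-cong (informed G I) (λ v → *-comm (𝟙 (Q v) * into G A v) Δ⁻¹) ⟩
          sumOver (λ v → Δ⁻¹ * (𝟙 (Q v) * into G A v)) (informed G I)  ≡⟨ sumOver-* Δ⁻¹ (λ v → 𝟙 (Q v) * into G A v) (informed G I) ⟩
          Δ⁻¹ * sumOver (λ v → 𝟙 (Q v) * into G A v) (informed G I)    ≡⟨ cong (Δ⁻¹ *_) (sumOver-informed {Q} {I} (into G A) Q⊆I) ⟩
          Δ⁻¹ * edges G Q A                                            ≡⟨ *-comm Δ⁻¹ (edges G Q A) ⟩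
          edges G Q A * Δ⁻¹                                            ∎

      -- With s the total load towards w, the probability of a miss is at most 1 / (1 + s). A single
      -- target has s ≤ 1, as at most Δ edges end in w, and then 1 / (1 + s) ≤ 1 - s / 2 because (1
      -- + s) (1 - s / 2) = 1 + s (1 - s) / 2.
      hit-vertex : ∀ w → ½ * (into G Q w * Δ⁻¹) ≤ ℙ[hit] Q (is w) (informed G I)
      hit-vertex w = ≤-by (1ℚ - ½ * s - x) eq (diff≥0 x≤)
        where
        s x : ℚ
        s = into G Q w * Δ⁻¹
        x = ℙ[miss] Q (is w) (informed G I)
        s≥0 : 0ℚ ≤ s
        s≥0 = *≥0 (into≥0 G Q w) 0≤Δ⁻¹
        s≤1 : s ≤ 1ℚ
        s≤1 = ≤-trans (*-monoʳ Δ⁻¹ 0≤Δ⁻¹ (≤-trans (into≤deg G Q w) (ι-mono (degree≤Δ G w)))) (≤-reflexive (*-inv 0<Δ))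
        eq : ℙ[hit] Q (is w) (informed G I) ≡ ½ * s + (1ℚ - ½ * s - x)
        eq = trans (solve 3 (λ h x s → h := con ½ :* s :+ (h :+ x :- con ½ :* s :- x)) refl (ℙ[hit] Q (is w) (informed G I)) x s)
          (cong (λ z → ½ * s + (z - ½ * s - x)) (ℙhit+ℙmiss Q (is w) (informed G I)))
        edges-is : edges G Q (is w) ≡ into G Q w
        edges-is = trans (edges-sym G Q (is w)) (∑-is w (into G Q))
        x≤ : x ≤ 1ℚ - ½ * s
        x≤ = cancelˡ (1ℚ + s) (<-≤-trans 0<1 (≤-by s refl s≥0)) (≤-trans
          (≤-trans (≤-reflexive (trans (*-comm (1ℚ + s) x) (cong (λ z → x * (1ℚ + z * Δ⁻¹)) (sym edges-is)))) (miss-bound (is w)))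
          (≤-by (½ * (s * (1ℚ - s))) (solve 1 (λ s → (con 1ℚ :+ s) :* (con 1ℚ :- con ½ :* s) := con 1ℚ :+ con ½ :* (s :* (con 1ℚ :- s))) refl s)
            (*≥0 (<⇒≤ 0<½) (*≥0 s≥0 (diff≥0 s≤1)))))

  -- The push process

  -- Harmonic numbers, the rational substitute for the logarithm inside the potential. The
  -- comparison with `log` comes only at the end.
  H : ℕ → ℚ
  H k = Σ< k (λ i → inv (ι (suc i)))

  H-mono : ∀ {a b} → a ℕ.≤ b → H a ≤ H b
  H-mono = Σ-mono-range (λ i → <⇒≤ (inv>0 (0<ι-suc i)))

  H≥0 : ∀ k → 0ℚ ≤ H k
  H≥0 k = H-mono {0} {k} ℕ.z≤n

  -- Each of the d added terms is at least 1 / c. The bound is linear in d, so the expected gain of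
  -- a potential built from H follows from an expected count.
  H-+ : ∀ d {a c} → d ℕ.+ a ℕ.≤ c → H a + ι d * inv (ι c) ≤ H (d ℕ.+ a)
  H-+ zero    {a} {c} _    = ≤-reflexive (trans (cong (H a +_) (*-zeroˡ (inv (ι c)))) (+-identityʳ (H a)))
  H-+ (suc d) {a} {c} d+a<c = begin
    H a + ι (suc d) * inv (ι c)             ≡⟨ cong (λ z → H a + z * inv (ι c)) (ι-suc d) ⟩
    H a + (1ℚ + ι d) * inv (ι c)            ≡⟨ solve 3 (λ h d i → h :+ (con 1ℚ :+ d) :* i := h :+ d :* i :+ i) refl (H a) (ι d) (inv (ι c)) ⟩
    H a + ι d * inv (ι c) + inv (ι c)       ≤⟨ +-mono-≤ (H-+ d (ℕₚ.<⇒≤ d+a<c)) (inv-anti (0<ι-suc (d ℕ.+ a)) (ι-mono d+a<c)) ⟩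
    H (d ℕ.+ a) + inv (ι (suc (d ℕ.+ a)))   ∎
    where open ≤-Reasoning

  does≡true : ∀ {P : Set} (P? : Dec P) → does P? ≡ true → P
  does≡true (yes p) _ = p

  does≡false : ∀ {P : Set} (P? : Dec P) → does P? ≡ false → ¬ P
  does≡false (no ¬p) _ = ¬p

  𝟙-∧ : ∀ a b → 𝟙 (a ∧ b) ≡ 𝟙 a * 𝟙 b
  𝟙-∧ true  b = sym (*-identityˡ (𝟙 b))
  𝟙-∧ false b = sym (*-zeroˡ (𝟙 b))

  ¬T∧not : ∀ {a b} → ¬ T (a ∧ not b) → b ≡ false → a ≡ false
  ¬T∧not {true}  {false} h _ = ⊥-elim (h _)
  ¬T∧not {false} {false} h _ = refl

  #-split : ∀ {n} (p : Fin n → Bool) → # p ℕ.+ # (not ∘ p) ≡ n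
  #-split {n} p = ℕₚ.≤-antisym (ι-cancel-≤ (≤-reflexive eq)) (ι-cancel-≤ (≤-reflexive (sym eq)))
    where
    open ≡-Reasoning
    lem : ∀ b → 𝟙 b + 𝟙 (not b) ≡ 1ℚ
    lem true  = refl
    lem false = refl
    eq : ι (# p ℕ.+ # (not ∘ p)) ≡ ι n
    eq = begin
      ι (# p ℕ.+ # (not ∘ p))             ≡⟨ ι-+ (# p) (# (not ∘ p)) ⟩
      ι (# p) + ι (# (not ∘ p))           ≡⟨ cong₂ _+_ (ι# p) (ι# (not ∘ p)) ⟩
      ∑ (𝟙 ∘ p) + ∑ (𝟙 ∘ not ∘ p)         ≡⟨ ∑-+ (𝟙 ∘ p) (𝟙 ∘ not ∘ p) ⟨
      ∑ (λ v → 𝟙 (p v) + 𝟙 (not (p v)))   ≡⟨ ∑-cong (λ v → lem (p v)) ⟩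
      ∑ {n} (λ _ → 1ℚ)                    ≡⟨ ∑-1 {n} ⟩
      ι n                                 ∎

  module _ {n : ℕ} (G : Graph n) (2≤n : 2 ℕ.≤ n) (k : ℕ) (Δ≤kδ : Δ G ℕ.≤ k ℕ.* δ G)
           {M : ℚ} (0≤M : 0ℚ ≤ M)
           (cut≥ : ∀ S {v w} → S v ≡ true → S w ≡ false → ι n * ι (δ G) ≤ ι 4 * (M * edges G S (not ∘ S))) where

    open Truncated (push-next G) (full? G) using (drift) renaming (𝔼[T∧_] to 𝔼[push∧_]; done⇒𝔼∧≡0 to full⇒𝔼push≡0)

    Δ⁻ : ℚ
    Δ⁻ = Δ⁻¹ G 2≤n

    0≤Δ⁻ : 0ℚ ≤ Δ⁻
    0≤Δ⁻ = 0≤Δ⁻¹ G 2≤n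

    1≤kδ/Δ : 1ℚ ≤ ι k * (ι (δ G) * Δ⁻)
    1≤kδ/Δ = begin
      1ℚ                    ≡⟨ *-inv (0<Δ G 2≤n) ⟨
      ι (Δ G) * Δ⁻          ≤⟨ *-monoʳ Δ⁻ 0≤Δ⁻ (≤-trans (ι-mono Δ≤kδ) (≤-reflexive (ι-* k (δ G)))) ⟩
      ι k * ι (δ G) * Δ⁻    ≡⟨ *-assoc (ι k) (ι (δ G)) Δ⁻ ⟩
      ι k * (ι (δ G) * Δ⁻)  ∎
      where open ≤-Reasoning

    0<n : 0ℚ < ι n
    0<n = ι>0 (ℕₚ.<-≤-trans (ℕ.s≤s ℕ.z≤n) 2≤n)

    -- 1/κ is a lower bound for the chance that a given vertex of B is hit in one step: half of its
    -- load, which is at least a quarter of δ/Δ ≥ 1/k. 1/γ is one for the chance of a push across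
    -- the boundary, by the cut bound. P is the largest value that the potential of a phase can
    -- take.
    κ γ P : ℚ
    κ = ι 8 * ι k
    γ = 1ℚ + ι 4 * ι k * M * inv (ι n)
    P = κ * H n + (κ * H n + γ)

    0≤κ : 0ℚ ≤ κ
    0≤κ = *≥0 (ι≥0 8) (ι≥0 k)

    0≤γ : 0ℚ ≤ γ
    0≤γ = +≥0 0≤1 (*≥0 (*≥0 (*≥0 (ι≥0 4) (ι≥0 k)) 0≤M) (<⇒≤ (inv>0 0<n)))

    0≤P : 0ℚ ≤ P
    0≤P = +≥0 (*≥0 0≤κ (H≥0 n)) (+≥0 (*≥0 0≤κ (H≥0 n)) 0≤γ)

    pushed : Subset n → List (Fin n) → Subset n
    pushed I us = I ∪ ⋃ (map ⁅_⁆ us)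

    pushed-⊇ : ∀ I us v → member I v ≡ true → member (pushed I us) v ≡ true
    pushed-⊇ I us v e = ∈⇒member {I = pushed I us} {v} (Subₚ.p⊆p∪q (⋃ (map ⁅_⁆ us)) (member⇒∈ {I = I} {v} e))

    pushed-∋ : ∀ I us {v} → v ∈ˡ us → member (pushed I us) v ≡ true
    pushed-∋ I us {v} v∈ = ∈⇒member {I = pushed I us} {v} (Subₚ.q⊆p∪q I (⋃ (map ⁅_⁆ us)) (∈-⋃⁺ us v∈))

    count-hits : ∀ Q (p : Fin n → Bool) vs →
                 average (λ us → ∑ (λ w → 𝟙 (p w) * 𝟙 (hits Q (is w) vs us))) (choices G vs) ≡ ∑ (λ w → 𝟙 (p w) * ℙ[hit] G 2≤n Q (is w) vs)
    count-hits Q p vs = trans (average-sumOver (λ w us → 𝟙 (p w) * 𝟙 (hits Q (is w) vs us)) (allFin n) (choices G vs))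
      (∑-cong (λ w → average-* (𝟙 (p w)) (λ us → 𝟙 (hits Q (is w) vs us)) (choices G vs)))

    -- Separates the two halves of a drift estimate: an inequality for every single outcome `us`,
    -- and a lower bound for the mean of the guaranteed drop R.
    drop⇒drift : ∀ (Ψ : Subset n → ℚ) I (R : List (Fin n) → ℚ) → (∀ us → Ψ (pushed I us) + R us ≤ Ψ I) →
                 1ℚ ≤ average R (choices G (informed G I)) → 1ℚ + average Ψ (push-next G I) ≤ Ψ I
    drop⇒drift Ψ I R h 1≤R = begin
      1ℚ + average Ψ (push-next G I)                      ≤⟨ +-monoˡ-≤ (average Ψ (push-next G I)) 1≤R ⟩
      average R C + average Ψ (push-next G I)             ≡⟨ cong (average R C +_) (average-map Ψ (pushed I) C) ⟩
      average R C + average (λ us → Ψ (pushed I us)) C    ≡⟨ +-comm (average R C) (average (λ us → Ψ (pushed I us)) C) ⟩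
      average (λ us → Ψ (pushed I us)) C + average R C    ≡⟨ average-+ (λ us → Ψ (pushed I us)) R C ⟨
      average (λ us → Ψ (pushed I us) + R us) C           ≤⟨ average-mono C (λ {us} _ → h us) ⟩
      average (λ _ → Ψ I) C                               ≡⟨ average-const (Ψ I) C (0<length-choices G 2≤n (informed G I)) ⟩
      Ψ I                                                 ∎
      where
      open ≤-Reasoning
      C = choices G (informed G I)

    -- One phase, which starts from I₀ and ends once δ/8 further vertices know the
    -- rumor.  B holds the vertices outside I₀ with at least a quarter of their
    -- neighbours in I₀; x counts the informed vertices outside I₀ ∪ B.  Ψ charges
    -- κ log for absorbing B, κ log for letting x double up to δ/8, and γ for the
    -- first push that leaves I₀ ∪ B.
    module Phase (I₀ : Subset n) where

      old B fresh : Fin n → Bool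
      old     = member I₀
      B w     = not (old w) ∧ does (deg G w ≤? ι 4 * into G old w)
      fresh w = not (old w) ∧ not (B w)

      -- J decides when the phase ends and therefore includes the informed vertices of B. They are
      -- left out of x, since their edges may all lead back into I₀.
      b x J : Subset n → ℕ
      b I = # (λ w → B w ∧ not (member I w))
      x I = # (λ w → fresh w ∧ member I w)
      J I = # (λ w → not (old w) ∧ member I w)

      Ψ : Subset n → ℚ
      Ψ I = κ * H (b I) + (κ * (H n - H (x I)) + γ * 𝟙 (x I ℕ.≡ᵇ 0))

      Ψ≥0 : ∀ I → 0ℚ ≤ Ψ I
      Ψ≥0 I = +≥0 (*≥0 0≤κ (H≥0 (b I))) (+≥0 (*≥0 0≤κ (diff≥0 (H-mono (#≤n (λ w → fresh w ∧ member I w))))) (*≥0 0≤γ (𝟙≥0 (x I ℕ.≡ᵇ 0))))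

      Ψ≤P : ∀ I → Ψ I ≤ P
      Ψ≤P I = +-mono-≤ (*-monoˡ κ 0≤κ (H-mono (#≤n (λ w → B w ∧ not (member I w)))))
        (+-mono-≤ (*-monoˡ κ 0≤κ (≤-by (H (x I)) (solve 2 (λ a b → a := a :- b :+ b) refl (H n) (H (x I))) (H≥0 (x I))))
          (≤-trans (*-monoˡ γ 0≤γ (𝟙≤1 (x I ℕ.≡ᵇ 0))) (≤-reflexive (*-identityʳ γ))))

      0<x⇒𝟙≡0 : ∀ {m} → 0 ℕ.< m → 𝟙 (m ℕ.≡ᵇ 0) ≡ 0ℚ
      0<x⇒𝟙≡0 {suc m} _ = refl

      module _ (I : Subset n) (old⊆I : ∀ v → old v ≡ true → member I v ≡ true) where

        vs : List (Fin n)
        vs = informed G I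

        I∌⇒old∌ : ∀ w → member I w ≡ false → old w ≡ false
        I∌⇒old∌ w e with old w in o
        ... | false = refl
        ... | true  = trans (sym (old⊆I w o)) e

        x≤x′ : ∀ us → x I ℕ.≤ x (pushed I us)
        x≤x′ us = #-mono {p = λ w → fresh w ∧ member I w} {q = λ w → fresh w ∧ member (pushed I us) w} pointwise
          where
          pointwise : ∀ w → 𝟙 (fresh w ∧ member I w) ≤ 𝟙 (fresh w ∧ member (pushed I us) w)
          pointwise w with fresh w | member I w in e
          ... | false | _     = ≤-refl
          ... | true  | false = 𝟙≥0 (member (pushed I us) w)
          ... | true  | true  = ≤-reflexive (cong 𝟙 (sym (pushed-⊇ I us w e)))

        -- The target of every push gets informed, so a hit on an uninformed vertex of B removes it
        -- from the count.
        b-drop : ∀ us Q → ι (b (pushed I us)) + ∑ (λ w → 𝟙 (B w ∧ not (member I w)) * 𝟙 (hits Q (is w) vs us)) ≤ ι (b I)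
        b-drop us Q = begin
          ι (b I′) + ∑ (λ w → 𝟙 (B w ∧ not (member I w)) * 𝟙 (h w))
            ≡⟨ cong (_+ ∑ (λ w → 𝟙 (B w ∧ not (member I w)) * 𝟙 (h w))) (ι# (λ w → B w ∧ not (member I′ w))) ⟩
          ∑ (λ w → 𝟙 (B w ∧ not (member I′ w))) + ∑ (λ w → 𝟙 (B w ∧ not (member I w)) * 𝟙 (h w))
            ≡⟨ ∑-+ (λ w → 𝟙 (B w ∧ not (member I′ w))) (λ w → 𝟙 (B w ∧ not (member I w)) * 𝟙 (h w)) ⟨
          ∑ (λ w → 𝟙 (B w ∧ not (member I′ w)) + 𝟙 (B w ∧ not (member I w)) * 𝟙 (h w))
            ≤⟨ ∑-mono pointwise ⟩
          ∑ (λ w → 𝟙 (B w ∧ not (member I w)))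
            ≡⟨ ι# (λ w → B w ∧ not (member I w)) ⟨
          ι (b I) ∎
          where
          open ≤-Reasoning
          I′ = pushed I us
          h : Fin n → Bool
          h w = hits Q (is w) vs us
          pointwise : ∀ w → 𝟙 (B w ∧ not (member I′ w)) + 𝟙 (B w ∧ not (member I w)) * 𝟙 (h w) ≤ 𝟙 (B w ∧ not (member I w))
          pointwise w with B w
          ... | false = ≤-reflexive (trans (+-identityˡ (0ℚ * 𝟙 (h w))) (*-zeroˡ (𝟙 (h w))))
          ... | true with member I w in e
          ...   | true  = ≤-reflexive (trans (cong (λ z → 𝟙 (not z) + 0ℚ * 𝟙 (h w)) (pushed-⊇ I us w e)) (trans (+-identityˡ (0ℚ * 𝟙 (h w))) (*-zeroˡ (𝟙 (h w)))))
          ...   | false with h w in hw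
          ...     | false = ≤-trans (≤-reflexive (+-identityʳ (𝟙 (not (member I′ w))))) (𝟙≤1 (not (member I′ w)))
          ...     | true  = ≤-reflexive (cong (λ z → 𝟙 (not z) + 1ℚ * 1ℚ) (pushed-∋ I us (hits-is⇒∈ Q w vs us hw)))

        b′≤b : ∀ us → b (pushed I us) ℕ.≤ b I
        b′≤b us = ι-cancel-≤ (≤-trans (≤-by s refl (∑≥0 (λ w → *≥0 (𝟙≥0 (B w ∧ not (member I w))) (𝟙≥0 (hits old (is w) vs us))))) (b-drop us old))
          where
          s : ℚ
          s = ∑ (λ w → 𝟙 (B w ∧ not (member I w)) * 𝟙 (hits old (is w) vs us))

        Ψ₁-mono : ∀ us → κ * H (b (pushed I us)) ≤ κ * H (b I)
        Ψ₁-mono us = *-monoˡ κ 0≤κ (H-mono (b′≤b us))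

        Ψ₂-mono : ∀ us → κ * (H n - H (x (pushed I us))) ≤ κ * (H n - H (x I))
        Ψ₂-mono us = *-monoˡ κ 0≤κ (+-monoʳ-≤ (H n) (neg-antimono-≤ (H-mono (x≤x′ us))))

        Ψ₃-mono : ∀ us → γ * 𝟙 (x (pushed I us) ℕ.≡ᵇ 0) ≤ γ * 𝟙 (x I ℕ.≡ᵇ 0)
        Ψ₃-mono us = *-monoˡ γ 0≤γ (lem (x≤x′ us))
          where
          lem : ∀ {a b} → a ℕ.≤ b → 𝟙 (b ℕ.≡ᵇ 0) ≤ 𝟙 (a ℕ.≡ᵇ 0)
          lem {zero}  {b}     _ = 𝟙≤1 (b ℕ.≡ᵇ 0)
          lem {suc a} {suc b} _ = ≤-refl

        module Absorb (0<b : 0 ℕ.< b I) where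

          -- Each uninformed vertex of B reached from I₀ lowers `H (b I)` by at least 1 / b. The
          -- mean of R is at least 1 because each of the b vertices is reached with probability at
          -- least 1/κ.
          R : List (Fin n) → ℚ
          R us = inv (ι (b I)) * (κ * ∑ (λ w → 𝟙 (B w ∧ not (member I w)) * 𝟙 (hits old (is w) vs us)))

          b-part : ∀ us → κ * H (b (pushed I us)) + R us ≤ κ * H (b I)
          b-part us = begin
            κ * H b′ + inv (ι (b I)) * (κ * s)             ≡⟨ solve 4 (λ k h i s → k :* h :+ i :* (k :* s) := k :* (h :+ s :* i)) refl κ (H b′) (inv (ι (b I))) s ⟩
            κ * (H b′ + s * inv (ι (b I)))                 ≤⟨ *-monoˡ κ 0≤κ (+-monoʳ-≤ (H b′) (*-monoʳ (inv (ι (b I))) (<⇒≤ (inv>0 (ι>0 0<b))) s≤)) ⟩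
            κ * (H b′ + ι (b I ℕ.∸ b′) * inv (ι (b I)))    ≤⟨ *-monoˡ κ 0≤κ (H-+ (b I ℕ.∸ b′) (ℕₚ.≤-reflexive b∸b′+b′)) ⟩
            κ * H (b I ℕ.∸ b′ ℕ.+ b′)                      ≡⟨ cong (λ z → κ * H z) b∸b′+b′ ⟩
            κ * H (b I)                                    ∎
            where
            open ≤-Reasoning
            b′ : ℕ
            b′ = b (pushed I us)
            s : ℚ
            s = ∑ (λ w → 𝟙 (B w ∧ not (member I w)) * 𝟙 (hits old (is w) vs us))
            b∸b′+b′ : b I ℕ.∸ b′ ℕ.+ b′ ≡ b I
            b∸b′+b′ = ℕₚ.m∸n+n≡m (b′≤b us)
            s≤ : s ≤ ι (b I ℕ.∸ b′)
            s≤ = ≤-by (ι (b I) - (ι b′ + s)) (begin-equality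
                ι (b I ℕ.∸ b′)                        ≡⟨ solve 2 (λ a c → a := a :+ c :- c) refl (ι (b I ℕ.∸ b′)) (ι b′) ⟩
                ι (b I ℕ.∸ b′) + ι b′ - ι b′          ≡⟨ cong (_- ι b′) (trans (sym (ι-+ (b I ℕ.∸ b′) b′)) (cong ι b∸b′+b′)) ⟩
                ι (b I) - ι b′                        ≡⟨ solve 3 (λ a c s → a :- c := s :+ (a :- (c :+ s))) refl (ι (b I)) (ι b′) s ⟩
                s + (ι (b I) - (ι b′ + s))            ∎)
              (diff≥0 (b-drop us old))

          drop : ∀ us → Ψ (pushed I us) + R us ≤ Ψ I
          drop us = ≤-trans (≤-reflexive (solve 3 (λ a c r → a :+ c :+ r := a :+ r :+ c) refl (κ * H (b (pushed I us))) rest (R us)))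
              (+-mono-≤ (b-part us) (+-mono-≤ (Ψ₂-mono us) (Ψ₃-mono us)))
            where
            rest : ℚ
            rest = κ * (H n - H (x (pushed I us))) + γ * 𝟙 (x (pushed I us) ℕ.≡ᵇ 0)

          1≤κℙ : ∀ w → B w ≡ true → 1ℚ ≤ κ * ℙ[hit] G 2≤n old (is w) vs
          1≤κℙ w Bw = begin
            1ℚ                                       ≤⟨ 1≤kδ/Δ ⟩
            ι k * (ι (δ G) * Δ⁻)                     ≤⟨ *-monoˡ (ι k) (ι≥0 k) (*-monoʳ Δ⁻ 0≤Δ⁻ (≤-trans (ι-mono (δ≤degree G w)) (d≤4a w Bw))) ⟩
            ι k * (ι 4 * into G old w * Δ⁻)          ≡⟨ solve 3 (λ k a d → k :* (con (ι 4) :* a :* d) := con (ι 8) :* k :* (con ½ :* (a :* d))) refl (ι k) (into G old w) Δ⁻ ⟩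
            κ * (½ * (into G old w * Δ⁻))            ≤⟨ *-monoˡ κ 0≤κ (hit-vertex G 2≤n {old} {I} old⊆I w) ⟩
            κ * ℙ[hit] G 2≤n old (is w) vs           ∎
            where
            open ≤-Reasoning
            d≤4a : ∀ w → B w ≡ true → deg G w ≤ ι 4 * into G old w
            d≤4a w e = does≡true (deg G w ≤? ι 4 * into G old w) (lem (not (old w)) e)
              where
              lem : ∀ c {d} → c ∧ d ≡ true → d ≡ true
              lem true e = e

          1≤R : 1ℚ ≤ average R (choices G vs)
          1≤R = begin
            1ℚ                                                   ≡⟨ *-inv (ι>0 0<b) ⟨
            ι (b I) * inv (ι (b I))                              ≡⟨ *-comm (ι (b I)) (inv (ι (b I))) ⟩
            inv (ι (b I)) * ι (b I)                              ≡⟨ cong (inv (ι (b I)) *_) (ι# (λ w → B w ∧ not (member I w))) ⟩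
            inv (ι (b I)) * ∑ (λ w → 𝟙 (p w))                    ≤⟨ *-monoˡ (inv (ι (b I))) (<⇒≤ (inv>0 (ι>0 0<b))) (∑-mono pointwise) ⟩
            inv (ι (b I)) * ∑ (λ w → κ * (𝟙 (p w) * ℙh w))       ≡⟨ cong (inv (ι (b I)) *_) (∑-* κ (λ w → 𝟙 (p w) * ℙh w)) ⟩
            inv (ι (b I)) * (κ * ∑ (λ w → 𝟙 (p w) * ℙh w))       ≡⟨ cong (λ z → inv (ι (b I)) * (κ * z)) (count-hits old p vs) ⟨
            inv (ι (b I)) * (κ * average r C)                    ≡⟨ cong (inv (ι (b I)) *_) (average-* κ r C) ⟨
            inv (ι (b I)) * average (λ us → κ * r us) C          ≡⟨ average-* (inv (ι (b I))) (λ us → κ * r us) C ⟨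
            average R C                                          ∎
            where
            open ≤-Reasoning
            C = choices G vs
            p : Fin n → Bool
            p w = B w ∧ not (member I w)
            ℙh : Fin n → ℚ
            ℙh w = ℙ[hit] G 2≤n old (is w) vs
            r : List (Fin n) → ℚ
            r us = ∑ (λ w → 𝟙 (p w) * 𝟙 (hits old (is w) vs us))
            pointwise : ∀ w → 𝟙 (p w) ≤ κ * (𝟙 (p w) * ℙh w)
            pointwise w = lem (B w) refl (not (member I w))
              where
              lem : ∀ c → B w ≡ c → ∀ d → 𝟙 (c ∧ d) ≤ κ * (𝟙 (c ∧ d) * ℙh w)
              lem true  e true  = ≤-trans (1≤κℙ w e) (≤-reflexive (cong (κ *_) (sym (*-identityˡ (ℙh w)))))
              lem true  e false = ≤-reflexive (solve 2 (λ k h → con 0ℚ := k :* (con 0ℚ :* h)) refl κ (ℙh w))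
              lem false e d     = ≤-reflexive (solve 2 (λ k h → con 0ℚ := k :* (con 0ℚ :* h)) refl κ (ℙh w))

        module B-informed (b≡0 : b I ≡ 0) where

          -- With B informed, uninformed vertices are outside both I₀ and B, so from now on every
          -- newly informed vertex raises x.
          I∌⇒fresh : ∀ w → member I w ≡ false → fresh w ≡ true
          I∌⇒fresh w e = cong₂ (λ o c → not o ∧ not c) (I∌⇒old∌ w e)
            (¬T∧not (#≡0⇒ (λ w → B w ∧ not (member I w)) b≡0 w) e)

        module Grow (b≡0 : b I ≡ 0) (0<x : 0 ℕ.< x I) (8J≤δ : 8 ℕ.* J I ℕ.≤ δ G) where

          open B-informed b≡0

          Q out : Fin n → Bool
          Q w   = fresh w ∧ member I w
          out w = not (member I w)

          Q⊆I : ∀ v → Q v ≡ true → member I v ≡ true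
          Q⊆I v e with fresh v
          ... | true = e

          -- A lower bound for each term gained when H passes from x to x + Y, as x + Y ≤ 2 x.
          i : ℚ
          i = inv (ι (x I ℕ.+ x I))

          0<i : 0ℚ < i
          0<i = inv>0 (ι>0 (ℕₚ.<-≤-trans 0<x (ℕₚ.m≤m+n (x I) (x I))))

          i*x : i * ι (x I) ≡ ½
          i*x = begin
            i * ι (x I)                          ≡⟨ solve 2 (λ i x → i :* x := con ½ :* ((x :+ x) :* i)) refl i (ι (x I)) ⟩
            ½ * ((ι (x I) + ι (x I)) * i)        ≡⟨ cong (λ z → ½ * (z * i)) (ι-+ (x I) (x I)) ⟨
            ½ * (ι (x I ℕ.+ x I) * i)            ≡⟨ cong (½ *_) (*-inv (ι>0 (ℕₚ.<-≤-trans 0<x (ℕₚ.m≤m+n (x I) (x I))))) ⟩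
            ½ * 1ℚ                               ≡⟨ *-identityʳ ½ ⟩
            ½                                    ∎
            where open ≡-Reasoning

          r R : List (Fin n) → ℚ
          r us = ∑ (λ w → 𝟙 (out w) * 𝟙 (hits Q (is w) vs us))
          R us = κ * (i * r us)

          -- Only vertices reached from the x vertices of Q are counted. Other informed vertices may
          -- raise x beyond 2 x, which lowers the potential even further.
          Y : List (Fin n) → ℕ
          Y us = # (λ w → out w ∧ hits Q (is w) vs us)

          ιY≡r : ∀ us → ι (Y us) ≡ r us
          ιY≡r us = trans (ι# (λ w → out w ∧ hits Q (is w) vs us)) (∑-cong (λ w → 𝟙-∧ (out w) (hits Q (is w) vs us)))

          -- Every vertex informs at most one other, so x at most doubles.
          Y≤x : ∀ us → Y us ℕ.≤ x I
          Y≤x us = ι-cancel-≤ (begin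
            ι (Y us)                                ≡⟨ ι# (λ w → out w ∧ hits Q (is w) vs us) ⟩
            ∑ (λ w → 𝟙 (out w ∧ hits Q (is w) vs us)) ≤⟨ ∑-mono (λ w → lem (out w) (hits Q (is w) vs us)) ⟩
            ∑ (λ w → 𝟙 (hits Q (is w) vs us))       ≤⟨ ∑-hits≤ Q vs us ⟩
            sumOver (𝟙 ∘ Q) vs                      ≡⟨ sumOver-cong vs (λ v → sym (*-identityʳ (𝟙 (Q v)))) ⟩
            sumOver (λ v → 𝟙 (Q v) * 1ℚ) vs         ≡⟨ sumOver-informed G 2≤n {Q} {I} (λ _ → 1ℚ) Q⊆I ⟩
            ∑ (λ v → 𝟙 (Q v) * 1ℚ)                  ≡⟨ ∑-cong (λ v → *-identityʳ (𝟙 (Q v))) ⟩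
            ∑ (𝟙 ∘ Q)                               ≡⟨ ι# Q ⟨
            ι (x I)                                 ∎)
            where
            open ≤-Reasoning
            lem : ∀ a c → 𝟙 (a ∧ c) ≤ 𝟙 c
            lem true  c = ≤-refl
            lem false c = 𝟙≥0 c

          Y+x≤x′ : ∀ us → Y us ℕ.+ x I ℕ.≤ x (pushed I us)
          Y+x≤x′ us = ι-cancel-≤ (begin
            ι (Y us ℕ.+ x I)                           ≡⟨ ι-+ (Y us) (x I) ⟩
            ι (Y us) + ι (x I)                         ≡⟨ cong₂ _+_ (ι# (λ w → out w ∧ h w)) (ι# Q) ⟩
            ∑ (λ w → 𝟙 (out w ∧ h w)) + ∑ (𝟙 ∘ Q)      ≡⟨ ∑-+ (λ w → 𝟙 (out w ∧ h w)) (𝟙 ∘ Q) ⟨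
            ∑ (λ w → 𝟙 (out w ∧ h w) + 𝟙 (Q w))        ≤⟨ ∑-mono pointwise ⟩
            ∑ (λ w → 𝟙 (fresh w ∧ member I′ w))        ≡⟨ ι# (λ w → fresh w ∧ member I′ w) ⟨
            ι (x I′)                                   ∎)
            where
            open ≤-Reasoning
            I′ = pushed I us
            h : Fin n → Bool
            h w = hits Q (is w) vs us
            pointwise : ∀ w → 𝟙 (out w ∧ h w) + 𝟙 (Q w) ≤ 𝟙 (fresh w ∧ member I′ w)
            pointwise w = lem (member I w) refl (h w) refl
              where
              lem : ∀ m → member I w ≡ m → ∀ c → h w ≡ c → 𝟙 (not m ∧ c) + 𝟙 (fresh w ∧ m) ≤ 𝟙 (fresh w ∧ member I′ w)
              lem true  e c     _  = ≤-reflexive (trans (+-identityˡ (𝟙 (fresh w ∧ true))) (cong (λ z → 𝟙 (fresh w ∧ z)) (sym (pushed-⊇ I us w e))))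
              lem false e false _  = ≤-trans (≤-reflexive (trans (+-identityˡ (𝟙 (fresh w ∧ false))) (cong 𝟙 (∧-zeroʳ (fresh w))))) (𝟙≥0 (fresh w ∧ member I′ w))
              lem false e true  hw = ≤-reflexive (trans (cong (λ z → 1ℚ + 𝟙 z) (∧-zeroʳ (fresh w)))
                (sym (cong₂ (λ f m → 𝟙 (f ∧ m)) (I∌⇒fresh w e) (pushed-∋ I us (hits-is⇒∈ Q w vs us hw)))))

          x-part : ∀ us → κ * (H n - H (x (pushed I us))) + R us ≤ κ * (H n - H (x I))
          x-part us = begin
            κ * (H n - H x′) + κ * (i * r us)     ≡⟨ solve 5 (λ k h g i r → k :* (h :- g) :+ k :* (i :* r) := k :* (h :- (g :- r :* i))) refl κ (H n) (H x′) i (r us) ⟩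
            κ * (H n - (H x′ - r us * i))         ≤⟨ *-monoˡ κ 0≤κ (+-monoʳ-≤ (H n) (neg-antimono-≤ grow)) ⟩
            κ * (H n - H (x I))                   ∎
            where
            open ≤-Reasoning
            x′ : ℕ
            x′ = x (pushed I us)
            grow : H (x I) ≤ H x′ - r us * i
            grow = begin
              H (x I)                                 ≡⟨ solve 2 (λ h a → h := h :+ a :- a) refl (H (x I)) (r us * i) ⟩
              H (x I) + r us * i - r us * i           ≡⟨ cong (λ z → H (x I) + z * i - r us * i) (ιY≡r us) ⟨
              H (x I) + ι (Y us) * i - r us * i       ≤⟨ +-monoˡ-≤ (- (r us * i)) (H-+ (Y us) (ℕₚ.+-monoˡ-≤ (x I) (Y≤x us))) ⟩
              H (Y us ℕ.+ x I) - r us * i             ≤⟨ +-monoˡ-≤ (- (r us * i)) (H-mono (Y+x≤x′ us)) ⟩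
              H x′ - r us * i                         ∎

          drop : ∀ us → Ψ (pushed I us) + R us ≤ Ψ I
          drop us = ≤-trans (≤-reflexive (solve 4 (λ a c d r → a :+ (c :+ d) :+ r := a :+ (c :+ r :+ d)) refl
                (κ * H (b (pushed I us))) (κ * (H n - H (x (pushed I us)))) (γ * 𝟙 (x (pushed I us) ℕ.≡ᵇ 0)) (R us)))
              (+-mono-≤ (Ψ₁-mono us) (+-mono-≤ (x-part us) (Ψ₃-mono us)))

          -- Fewer than a quarter of the edges of a fresh vertex lead to I₀ and at
          -- most an eighth to other new vertices.
          half-out : ∀ v → Q v ≡ true → ½ * ι (δ G) ≤ into G out v
          -- The weights 1, 1/4, 1/8, 3/4, 1/8 combine m ≤ a + j, 4 a ≤ m + o, 8 j ≤ d, d ≤ m + o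
          -- and 0 ≤ d so that a, j and m cancel and o - d / 2 remains.
          half-out v Qv = ≤-by ((a + j - m) + ½ * ½ * (m + o - ι 4 * a) + ½ * ½ * ½ * (d - ι 8 * j) + ½ * (1ℚ + ½) * (m + o - d) + ½ * ½ * ½ * d)
              (solve 5 (λ o d a j m → o := con ½ :* d :+ ((a :+ j :- m) :+ con (½ * ½) :* (m :+ o :- con (ι 4) :* a) :+ con (½ * ½ * ½) :* (d :- con (ι 8) :* j) :+ con (½ * (1ℚ + ½)) :* (m :+ o :- d) :+ con (½ * ½ * ½) :* d)) refl o d a j m)
              (+≥0 (+≥0 (+≥0 (+≥0 (diff≥0 m≤a+j) (*≥0 (nonNegative⁻¹ (½ * ½)) (diff≥0 4a≤))) (*≥0 (nonNegative⁻¹ (½ * ½ * ½)) (diff≥0 8j≤)))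
                (*≥0 (nonNegative⁻¹ (½ * (1ℚ + ½))) (diff≥0 δ≤))) (*≥0 (nonNegative⁻¹ (½ * ½ * ½)) (ι≥0 (δ G))))
            where
            open ≤-Reasoning
            o d a j m : ℚ
            o = into G out v
            d = ι (δ G)
            a = into G old v
            j = ι (J I)
            m = into G (member I) v
            δ≤ : d ≤ m + o
            δ≤ = ≤-trans (ι-mono (δ≤degree G v)) (≤-reflexive (sym (into-split G (member I) v)))
            8j≤ : ι 8 * j ≤ d
            8j≤ = ≤-trans (≤-reflexive (sym (ι-* 8 (J I)))) (ι-mono 8J≤δ)
            4a<d : ∀ v → Q v ≡ true → ι 4 * into G old v ≤ deg G v
            4a<d v e = <⇒≤ (≰⇒> (does≡false (deg G v ≤? ι 4 * into G old v) (lem (not (old v)) e)))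
              where
              lem : ∀ c {d m} → (c ∧ not (c ∧ d)) ∧ m ≡ true → d ≡ false
              lem true {false} _ = refl
            4a≤ : ι 4 * a ≤ m + o
            4a≤ = ≤-trans (4a<d v Qv) (≤-reflexive (sym (into-split G (member I) v)))
            m≤a+j : m ≤ a + j
            m≤a+j = begin
              ∑ (λ u → 𝟙 (member I u) * edge G v u)                               ≤⟨ ∑-mono pointwise ⟩
              ∑ (λ u → 𝟙 (old u) * edge G v u + 𝟙 (not (old u) ∧ member I u))    ≡⟨ ∑-+ (λ u → 𝟙 (old u) * edge G v u) (λ u → 𝟙 (not (old u) ∧ member I u)) ⟩
              a + ∑ (λ u → 𝟙 (not (old u) ∧ member I u))                          ≡⟨ cong (a +_) (ι# (λ u → not (old u) ∧ member I u)) ⟨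
              a + j                                                               ∎
              where
              pointwise : ∀ u → 𝟙 (member I u) * edge G v u ≤ 𝟙 (old u) * edge G v u + 𝟙 (not (old u) ∧ member I u)
              pointwise u with old u in e
              ... | true  = ≤-trans (*-monoʳ (edge G v u) (edge≥0 G v u) (𝟙≤1 (member I u))) (≤-reflexive (sym (+-identityʳ (1ℚ * edge G v u))))
              ... | false = ≤-trans (*-monoˡ (𝟙 (member I u)) (𝟙≥0 (member I u)) (𝟙≤1 (adj G v u)))
                (≤-reflexive (solve 2 (λ m e → m :* con 1ℚ := con 0ℚ :* e :+ m) refl (𝟙 (member I u)) (edge G v u)))

          ½δx≤edges : ½ * ι (δ G) * ι (x I) ≤ edges G Q out
          ½δx≤edges = begin
            ½ * ι (δ G) * ι (x I)                  ≡⟨ cong (½ * ι (δ G) *_) (ι# Q) ⟩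
            ½ * ι (δ G) * ∑ (𝟙 ∘ Q)                ≡⟨ ∑-* (½ * ι (δ G)) (𝟙 ∘ Q) ⟨
            ∑ (λ v → ½ * ι (δ G) * 𝟙 (Q v))        ≤⟨ ∑-mono (λ v → lem v (Q v) refl) ⟩
            ∑ (λ v → 𝟙 (Q v) * into G out v)       ∎
            where
            open ≤-Reasoning
            lem : ∀ v c → Q v ≡ c → ½ * ι (δ G) * 𝟙 c ≤ 𝟙 c * into G out v
            lem v true  e = ≤-trans (≤-reflexive (*-identityʳ (½ * ι (δ G)))) (≤-trans (half-out v e) (≤-reflexive (sym (*-identityˡ (into G out v)))))
            lem v false e = ≤-reflexive (trans (*-zeroʳ (½ * ι (δ G))) (sym (*-zeroˡ (into G out v))))

          1≤R : 1ℚ ≤ average R (choices G vs)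
          1≤R = begin
            1ℚ                                                     ≤⟨ 1≤kδ/Δ ⟩
            -- The 8 in κ pays for three halves: the one in `hit-vertex`, the one in `half-out`, and
            -- `i*x`, which is ½ because x may double.
            ι k * (ι (δ G) * Δ⁻)                                   ≡⟨ solve 3 (λ k d e → k :* (d :* e) := con (ι 8) :* k :* (con ½ :* (con ½ :* e :* (con ½ :* d)))) refl (ι k) (ι (δ G)) Δ⁻ ⟩
            κ * (½ * (½ * Δ⁻ * (½ * ι (δ G))))                     ≡⟨ cong (λ z → κ * (z * (½ * Δ⁻ * (½ * ι (δ G))))) i*x ⟨
            κ * (i * ι (x I) * (½ * Δ⁻ * (½ * ι (δ G))))           ≡⟨ cong (κ *_) (solve 4 (λ i x e d → i :* x :* (e :* d) := i :* (e :* (d :* x))) refl i (ι (x I)) (½ * Δ⁻) (½ * ι (δ G))) ⟩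
            κ * (i * (½ * Δ⁻ * (½ * ι (δ G) * ι (x I))))           ≤⟨ up (*-monoˡ (½ * Δ⁻) (*≥0 (<⇒≤ 0<½) 0≤Δ⁻) ½δx≤edges) ⟩
            κ * (i * (½ * Δ⁻ * edges G Q out))                     ≡⟨ cong (λ z → κ * (i * (½ * Δ⁻ * z))) (edges-sym G Q out) ⟩
            κ * (i * (½ * Δ⁻ * edges G out Q))                     ≡⟨ cong (λ z → κ * (i * z)) (∑-* (½ * Δ⁻) (λ w → 𝟙 (out w) * into G Q w)) ⟨
            κ * (i * ∑ (λ w → ½ * Δ⁻ * (𝟙 (out w) * into G Q w)))  ≤⟨ up (∑-mono pointwise) ⟩
            κ * (i * ∑ (λ w → 𝟙 (out w) * ℙ[hit] G 2≤n Q (is w) vs)) ≡⟨ cong (λ z → κ * (i * z)) (count-hits Q out vs) ⟨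
            κ * (i * average r C)                                  ≡⟨ cong (κ *_) (average-* i r C) ⟨
            κ * average (λ us → i * r us) C                        ≡⟨ average-* κ (λ us → i * r us) C ⟨
            average R C                                            ∎
            where
            open ≤-Reasoning
            C = choices G vs
            up : ∀ {y z} → y ≤ z → κ * (i * y) ≤ κ * (i * z)
            up y≤z = *-monoˡ κ 0≤κ (*-monoˡ i (<⇒≤ 0<i) y≤z)
            pointwise : ∀ w → ½ * Δ⁻ * (𝟙 (out w) * into G Q w) ≤ 𝟙 (out w) * ℙ[hit] G 2≤n Q (is w) vs
            pointwise w = ≤-trans (≤-reflexive (solve 3 (λ e o q → con ½ :* e :* (o :* q) := o :* (con ½ :* (q :* e))) refl Δ⁻ (𝟙 (out w)) (into G Q w)))
              (*-monoˡ (𝟙 (out w)) (𝟙≥0 (out w)) (hit-vertex G 2≤n {Q} {I} Q⊆I w))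

        module Cross (b≡0 : b I ≡ 0) (x≡0 : x I ≡ 0) {s w : Fin n} (s∈I : member I s ≡ true) (w∉I : member I w ≡ false) where

          open B-informed b≡0

          Q A : Fin n → Bool
          Q = member I
          A = not ∘ member I

          R : List (Fin n) → ℚ
          R us = γ * 𝟙 (hits Q A vs us)

          -- Every uninformed vertex is fresh at this point, so a push out of I makes x positive and
          -- the charge γ disappears. Since x never decreases, it is paid once per phase.
          γ-part : ∀ us → γ * 𝟙 (x (pushed I us) ℕ.≡ᵇ 0) + R us ≤ γ * 𝟙 (x I ℕ.≡ᵇ 0)
          γ-part us = begin
            γ * 𝟙 (x′ ℕ.≡ᵇ 0) + γ * 𝟙 (hits Q A vs us)  ≡⟨ *-distribˡ-+ γ (𝟙 (x′ ℕ.≡ᵇ 0)) (𝟙 (hits Q A vs us)) ⟨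
            γ * (𝟙 (x′ ℕ.≡ᵇ 0) + 𝟙 (hits Q A vs us))    ≤⟨ *-monoˡ γ 0≤γ (lem (hits Q A vs us) refl) ⟩
            γ * 1ℚ                                      ≡⟨ cong (λ z → γ * 𝟙 (z ℕ.≡ᵇ 0)) x≡0 ⟨
            γ * 𝟙 (x I ℕ.≡ᵇ 0)                          ∎
            where
            open ≤-Reasoning
            x′ : ℕ
            x′ = x (pushed I us)
            lem : ∀ c → hits Q A vs us ≡ c → 𝟙 (x′ ℕ.≡ᵇ 0) + 𝟙 c ≤ 1ℚ
            lem false _ = ≤-trans (≤-reflexive (+-identityʳ (𝟙 (x′ ℕ.≡ᵇ 0)))) (𝟙≤1 (x′ ℕ.≡ᵇ 0))
            lem true  e with hits⇒∈ Q A vs us e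
            ... | u , Au , u∈ = ≤-reflexive (cong (_+ 1ℚ) (0<x⇒𝟙≡0 (#>0 (λ w → fresh w ∧ member (pushed I us) w) {u}
                   (subst T (sym (cong₂ _∧_ (I∌⇒fresh u (not-true (member I u) Au)) (pushed-∋ I us u∈))) _))))
              where
              not-true : ∀ c → not c ≡ true → c ≡ false
              not-true false _ = refl

          drop : ∀ us → Ψ (pushed I us) + R us ≤ Ψ I
          drop us = ≤-trans (≤-reflexive (solve 4 (λ a c d r → a :+ (c :+ d) :+ r := a :+ (c :+ (d :+ r))) refl
                (κ * H (b (pushed I us))) (κ * (H n - H (x (pushed I us)))) (γ * 𝟙 (x (pushed I us) ℕ.≡ᵇ 0)) (R us)))
              (+-mono-≤ (Ψ₁-mono us) (+-mono-≤ (Ψ₂-mono us) (γ-part us)))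

          1≤R : 1ℚ ≤ average R (choices G vs)
          1≤R = begin
            -- In effect ℙ[hit] ≥ σ / (1 + σ) ≥ 1 / (1 + g), where σ = cut / Δ. The first inequality
            -- is X (1 + σ) ≤ 1, the second g σ ≥ 1, which is the cut bound divided by Δ ≤ k δ.
            1ℚ                             ≤⟨ ≤-by (g - g * (X * (1ℚ + σ)) + X * (g * σ - 1ℚ)) (solve 3 (λ g X s → (con 1ℚ :+ g) :* (con 1ℚ :- X) := con 1ℚ :+ (g :- g :* (X :* (con 1ℚ :+ s)) :+ X :* (g :* s :- con 1ℚ))) refl g X σ)
                                                (+≥0 (diff≥0 gX≤g) (*≥0 (ℙmiss≥0 G 2≤n Q A vs) (diff≥0 1≤gs))) ⟩
            (1ℚ + g) * (1ℚ - X)            ≡⟨ cong (λ z → (1ℚ + g) * (z - X)) (ℙhit+ℙmiss G 2≤n Q A vs) ⟨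
            γ * (Y + X - X)                ≡⟨ cong (γ *_) (solve 2 (λ y x → y :+ x :- x := y) refl Y X) ⟩
            γ * Y                          ≡⟨ average-* γ (λ us → 𝟙 (hits Q A vs us)) (choices G vs) ⟨
            average R (choices G vs)       ∎
            where
            open ≤-Reasoning
            g X Y σ e : ℚ
            g = ι 4 * ι k * M * inv (ι n)
            X = ℙ[miss] G 2≤n Q A vs
            Y = ℙ[hit] G 2≤n Q A vs
            e = edges G Q A
            σ = e * Δ⁻
            0≤g : 0ℚ ≤ g
            0≤g = *≥0 (*≥0 (*≥0 (ι≥0 4) (ι≥0 k)) 0≤M) (<⇒≤ (inv>0 0<n))
            gX≤g : g * (X * (1ℚ + σ)) ≤ g
            gX≤g = ≤-trans (*-monoˡ g 0≤g (miss-bound G 2≤n {Q} {I} (λ _ q → q) A)) (≤-reflexive (*-identityʳ g))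
            1≤gs : 1ℚ ≤ g * σ
            1≤gs = begin
              1ℚ                                                  ≤⟨ 1≤kδ/Δ ⟩
              ι k * (ι (δ G) * Δ⁻)                                ≡⟨ *-identityˡ (ι k * (ι (δ G) * Δ⁻)) ⟨
              1ℚ * (ι k * (ι (δ G) * Δ⁻))                         ≡⟨ cong (_* (ι k * (ι (δ G) * Δ⁻))) (*-inv 0<n) ⟨
              ι n * inv (ι n) * (ι k * (ι (δ G) * Δ⁻))            ≡⟨ solve 5 (λ n i k d e → n :* i :* (k :* (d :* e)) := i :* k :* e :* (n :* d)) refl (ι n) (inv (ι n)) (ι k) (ι (δ G)) Δ⁻ ⟩
              inv (ι n) * ι k * Δ⁻ * (ι n * ι (δ G))              ≤⟨ *-monoˡ (inv (ι n) * ι k * Δ⁻) (*≥0 (*≥0 (<⇒≤ (inv>0 0<n)) (ι≥0 k)) 0≤Δ⁻) (cut≥ Q {s} {w} s∈I w∉I) ⟩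
              inv (ι n) * ι k * Δ⁻ * (ι 4 * (M * e))              ≡⟨ solve 5 (λ i k d m e → i :* k :* d :* (con (ι 4) :* (m :* e)) := con (ι 4) :* k :* m :* i :* (e :* d)) refl (inv (ι n)) (ι k) Δ⁻ M e ⟩
              g * σ                                              ∎

      module _ {s : Fin n} (s∈I₀ : old s ≡ true) {A : ℚ} (0≤A : 0ℚ ≤ A)
               (later : ∀ I → (∀ v → old v ≡ true → member I v ≡ true) → δ G ℕ.≤ 8 ℕ.* J I → ∀ N → 𝔼[push∧ N ] I ≤ A) where

        private
          -- None of the three terms of Ψ can increase under any outcome, so each case has to make
          -- only one of them drop: the first harmonic term, the second one, or the charge γ.
          drift-Ψ : ∀ I (old⊆I : ∀ v → old v ≡ true → member I v ≡ true) → 8 ℕ.* J I ℕ.≤ δ G → ∀ {w} → member I w ≡ false →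
                    ∃[ R ] ((∀ us → Ψ (pushed I us) + R us ≤ Ψ I) × 1ℚ ≤ average R (choices G (informed G I)))
          drift-Ψ I old⊆I 8J≤δ {w} w∉I = by-cases (b I) refl (x I) refl
            where
            by-cases : ∀ β → b I ≡ β → ∀ ξ → x I ≡ ξ → ∃[ R ] ((∀ us → Ψ (pushed I us) + R us ≤ Ψ I) × 1ℚ ≤ average R (choices G (informed G I)))
            by-cases (suc β) e ξ f = R , drop , 1≤R
              where open Absorb I old⊆I (subst (0 ℕ.<_) (sym e) (ℕ.s≤s ℕ.z≤n))
            by-cases zero e (suc ξ) f = R , drop , 1≤R
              where open Grow I old⊆I e (subst (0 ℕ.<_) (sym f) (ℕ.s≤s ℕ.z≤n)) 8J≤δ
            by-cases zero e zero f = R , drop , 1≤R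
              where open Cross I old⊆I e f {s} {w} (old⊆I s s∈I₀) w∉I

        -- `drift` is applied to `A + Ψ` on the states that contain I₀. Where the phase has ended, A
        -- alone bounds the remaining time and what is left of Ψ is given away.
        phase : ∀ N → 𝔼[push∧ N ] I₀ ≤ A + P
        phase N = ≤-trans (drift (λ I → A + Ψ I) (λ I → ∀ v → old v ≡ true → member I v ≡ true)
            (λ I → +≥0 0≤A (Ψ≥0 I)) closed step N I₀ (λ _ e → e)) (+-monoʳ-≤ A (Ψ≤P I₀))
          where
          closed : ∀ {I I′} → (∀ v → old v ≡ true → member I v ≡ true) → I′ ∈ˡ push-next G I → ∀ v → old v ≡ true → member I′ v ≡ true
          closed {I} h I′∈ v e with us , _ , refl ← ∈ₚ.∈-map⁻ (pushed I) I′∈ = pushed-⊇ I us v (h v e)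
          A≤ : ∀ I → A ≤ A + Ψ I
          A≤ I = ≤-by (Ψ I) refl (Ψ≥0 I)
          step : ∀ I → (∀ v → old v ≡ true → member I v ≡ true) →
                 (∀ N → 𝔼[push∧ N ] I ≤ A + Ψ I) ⊎ 1ℚ + average (λ I → A + Ψ I) (push-next G I) ≤ A + Ψ I
          step I old⊆I with all? (_∈? I)
          ... | yes all = inj₁ (λ N → ≤-trans (≤-reflexive (full⇒𝔼push≡0 N (full G all))) (+≥0 0≤A (Ψ≥0 I)))
          ... | no ¬all with δ G ℕₚ.≤? 8 ℕ.* J I
          ...   | yes δ≤8J = inj₁ (λ N → ≤-trans (later I old⊆I δ≤8J N) (A≤ I))
          ...   | no δ≰8J with w , w∉I ← ¬∀⟶∃¬ n (_∈ I) (_∈? I) ¬all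
                      with R , drop , 1≤R ← drift-Ψ I old⊆I (ℕₚ.<⇒≤ (ℕₚ.≰⇒> δ≰8J)) {w} (∉⇒member {I = I} {w} w∉I)
                      = inj₂ (drop⇒drift (λ I → A + Ψ I) I R
                          (λ us → ≤-trans (≤-reflexive (+-assoc A (Ψ (pushed I us)) (R us))) (+-monoʳ-≤ A (drop us))) 1≤R)

    -- Induction on the number of phases that suffice: the hypothesis says that 8 times the number
    -- of uninformed vertices is at most m δ. The factor 8 is kept on the left because δ/8 need not
    -- be an integer.
    push-bound : ∀ m I {s} → member I s ≡ true → 8 ℕ.* n ℕ.≤ m ℕ.* δ G ℕ.+ 8 ℕ.* # (member I) → ∀ N → 𝔼[push∧ N ] I ≤ ι m * P
    push-bound zero    I {s} s∈I 8n≤ N with all? (_∈? I)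
    ... | yes all = ≤-trans (≤-reflexive (full⇒𝔼push≡0 N (full G all))) (≤-reflexive (sym (*-zeroˡ P)))
    ... | no ¬all with w , w∉I ← ¬∀⟶∃¬ n (_∈ I) (_∈? I) ¬all = contradiction (ℕₚ.*-cancelˡ-≤ 8 8n≤) (ℕₚ.<⇒≱ #I<n)
      where
      #I<n : # (member I) ℕ.< n
      #I<n = subst (# (member I) ℕ.<_) (#-split (member I)) (ℕₚ.m<m+n (# (member I))
        (#>0 (not ∘ member I) {w} (subst T (sym (cong not (∉⇒member {I = I} {w} w∉I))) _)))
    push-bound (suc m) I {s} s∈I 8n≤ N = ≤-trans (phase {s} s∈I (*≥0 (ι≥0 m) 0≤P) later N)
        (≤-reflexive (trans (solve 2 (λ m p → m :* p :+ p := (con 1ℚ :+ m) :* p) refl (ι m) P) (cong (_* P) (sym (ι-suc m)))))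
      where
      open Phase I
      later : ∀ I′ → (∀ v → member I v ≡ true → member I′ v ≡ true) → δ G ℕ.≤ 8 ℕ.* J I′ → ∀ N → 𝔼[push∧ N ] I′ ≤ ι m * P
      later I′ I⊆I′ δ≤8J = push-bound m I′ {s} (I⊆I′ s s∈I) (begin
          8 ℕ.* n                                                 ≤⟨ 8n≤ ⟩
          δ G ℕ.+ m ℕ.* δ G ℕ.+ 8 ℕ.* # (member I)                ≤⟨ ℕₚ.+-monoˡ-≤ (8 ℕ.* # (member I)) (ℕₚ.+-monoˡ-≤ (m ℕ.* δ G) δ≤8J) ⟩
          8 ℕ.* J I′ ℕ.+ m ℕ.* δ G ℕ.+ 8 ℕ.* # (member I)         ≡⟨ cong (ℕ._+ 8 ℕ.* # (member I)) (ℕₚ.+-comm (8 ℕ.* J I′) (m ℕ.* δ G)) ⟩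
          m ℕ.* δ G ℕ.+ 8 ℕ.* J I′ ℕ.+ 8 ℕ.* # (member I)         ≡⟨ ℕₚ.+-assoc (m ℕ.* δ G) (8 ℕ.* J I′) (8 ℕ.* # (member I)) ⟩
          m ℕ.* δ G ℕ.+ (8 ℕ.* J I′ ℕ.+ 8 ℕ.* # (member I))       ≡⟨ cong (m ℕ.* δ G ℕ.+_) (ℕₚ.*-distribˡ-+ 8 (J I′) (# (member I))) ⟨
          m ℕ.* δ G ℕ.+ 8 ℕ.* (J I′ ℕ.+ # (member I))             ≤⟨ ℕₚ.+-monoʳ-≤ (m ℕ.* δ G) (ℕₚ.*-monoʳ-≤ 8 J+#≤) ⟩
          m ℕ.* δ G ℕ.+ 8 ℕ.* # (member I′)                       ∎)
        where
        open ℕₚ.≤-Reasoning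
        J+#≤ : J I′ ℕ.+ # (member I) ℕ.≤ # (member I′)
        J+#≤ = ι-cancel-≤ (subst₂ _≤_
            (sym (trans (ι-+ (J I′) (# (member I))) (trans (cong₂ _+_ (ι# (λ w → not (member I w) ∧ member I′ w)) (ι# (member I)))
              (sym (∑-+ (λ w → 𝟙 (not (member I w) ∧ member I′ w)) (𝟙 ∘ member I))))))
            (sym (ι# (member I′))) (∑-mono pointwise))
          where
          pointwise : ∀ w → 𝟙 (not (member I w) ∧ member I′ w) + 𝟙 (member I w) ≤ 𝟙 (member I′ w)
          pointwise w with member I w in e
          ... | false = ≤-reflexive (+-identityʳ (𝟙 (member I′ w)))
          ... | true  = ≤-reflexive (trans (+-identityˡ 1ℚ) (cong 𝟙 (sym (I⊆I′ w e))))

  -- Comparison with the cover time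

  -- Bernoulli's inequality r ^ j ≥ 1 - j (1 - r), stated without the subtraction.
  ^-lower : ∀ {r} → 0ℚ ≤ r → r ≤ 1ℚ → ∀ j → 1ℚ ≤ r ^ℚ j + ι j * (1ℚ - r)
  ^-lower {r} 0≤r r≤1 zero    = ≤-reflexive (solve 1 (λ r → con 1ℚ := con 1ℚ :+ con 0ℚ :* (con 1ℚ :- r)) refl r)
  ^-lower {r} 0≤r r≤1 (suc j) = begin
    1ℚ                                            ≡⟨ solve 1 (λ r → con 1ℚ := r :* con 1ℚ :+ (con 1ℚ :- r)) refl r ⟩
    r * 1ℚ + (1ℚ - r)                             ≤⟨ +-monoˡ-≤ (1ℚ - r) (*-monoˡ r 0≤r (^-lower 0≤r r≤1 j)) ⟩
    r * (r ^ℚ j + ι j * (1ℚ - r)) + (1ℚ - r)      ≤⟨ ≤-by ((1ℚ - r) * (ι j * (1ℚ - r))) (solve 3 (λ r p j → r :* p :+ (con 1ℚ :+ j) :* (con 1ℚ :- r) := r :* (p :+ j :* (con 1ℚ :- r)) :+ (con 1ℚ :- r) :+ (con 1ℚ :- r) :* (j :* (con 1ℚ :- r))) refl r (r ^ℚ j) (ι j))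
                                                       (*≥0 (diff≥0 r≤1) (*≥0 (ι≥0 j) (diff≥0 r≤1))) ⟩
    r * r ^ℚ j + (1ℚ + ι j) * (1ℚ - r)            ≡⟨ cong (λ z → r * r ^ℚ j + z * (1ℚ - r)) (ι-suc j) ⟨
    r * r ^ℚ j + ι (suc j) * (1ℚ - r)             ∎
    where open ≤-Reasoning

  1-log-ratio : ∀ m → 1ℚ - log-ratio m ≡ inv (ι (suc m))
  1-log-ratio m = begin
    1ℚ - ι m * u                    ≡⟨ cong (_- ι m * u) (*-inv (0<ι-suc m)) ⟨
    ι (suc m) * u - ι m * u         ≡⟨ cong (λ z → z * u - ι m * u) (ι-suc m) ⟩
    (1ℚ + ι m) * u - ι m * u        ≡⟨ solve 2 (λ m u → (con 1ℚ :+ m) :* u :- m :* u := u) refl (ι m) u ⟩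
    u                               ∎
    where
    open ≡-Reasoning
    u : ℚ
    u = inv (ι (suc m))

  -- Termwise with r = 1 - 1/n: by `^-lower`, 1/j exceeds the term r ^ j / j of the logarithm by at
  -- most 1 - r = 1/n, so the n terms of H n lose at most 1 altogether. The remaining terms of the
  -- partial sum are nonnegative.
  H≤log+1 : ∀ {n} → 1 ℕ.≤ n → ∀ {N} → n ℕ.≤ N → H n ≤ seq (log n) N + 1ℚ
  H≤log+1 {suc m} _ {N} n≤N = ≤-trans (partial (suc m)) (+-mono-≤ (Σ-mono-range (log-term≥0 m) n≤N) (≤-reflexive (*-inv (0<ι-suc m))))
    where
    open ≤-Reasoning
    r u : ℚ
    r = log-ratio m
    u = inv (ι (suc m))
    term : ∀ j → inv (ι (suc j)) ≤ log-term m j + u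
    term j = begin
      i                                            ≡⟨ *-identityˡ i ⟨
      1ℚ * i                                       ≤⟨ *-monoʳ i (<⇒≤ (inv>0 (0<ι-suc j))) (^-lower (log-ratio≥0 m) (<⇒≤ (log-ratio<1 m)) (suc j)) ⟩
      (r ^ℚ suc j + ι (suc j) * (1ℚ - r)) * i      ≡⟨ solve 4 (λ p j v i → (p :+ j :* v) :* i := p :* i :+ j :* i :* v) refl (r ^ℚ suc j) (ι (suc j)) (1ℚ - r) i ⟩
      r ^ℚ suc j * i + ι (suc j) * i * (1ℚ - r)    ≡⟨ cong₂ (λ a b → r ^ℚ suc j * i + a * b) (*-inv (0<ι-suc j)) (1-log-ratio m) ⟩
      r ^ℚ suc j * i + 1ℚ * u                      ≡⟨ cong (r ^ℚ suc j * i +_) (*-identityˡ u) ⟩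
      log-term m j + u                             ∎
      where
      i : ℚ
      i = inv (ι (suc j))
    partial : ∀ K → H K ≤ Σ< K (log-term m) + ι K * u
    partial zero    = ≤-reflexive (solve 1 (λ u → con 0ℚ := con 0ℚ :+ con 0ℚ :* u) refl u)
    partial (suc K) = begin
      H K + inv (ι (suc K))                                        ≤⟨ +-mono-≤ (partial K) (term K) ⟩
      Σ< K (log-term m) + ι K * u + (log-term m K + u)             ≡⟨ solve 4 (λ s k u t → s :+ k :* u :+ (t :+ u) := s :+ t :+ (con 1ℚ :+ k) :* u) refl (Σ< K (log-term m)) (ι K) u (log-term m K) ⟩
      Σ< K (log-term m) + log-term m K + (1ℚ + ι K) * u            ≡⟨ cong (λ z → Σ< K (log-term m) + log-term m K + z * u) (ι-suc K) ⟨
      Σ< K (log-term m) + log-term m K + ι (suc K) * u             ∎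

  -- Already the first term of the series is 1 - 1/n. The bound serves to absorb additive constants
  -- into multiples of log n.
  ½≤log : ∀ {n} → 2 ℕ.≤ n → ∀ {N} → 1 ℕ.≤ N → ½ ≤ seq (log n) N
  ½≤log {suc m} 2≤n {N} 1≤N = begin
    ½                            ≤⟨ ≤-by (½ - u) (solve 1 (λ u → con 1ℚ :- u := con ½ :+ (con ½ :- u)) refl u) (diff≥0 (inv-anti {ι 2} (0<ι-suc 1) (ι-mono 2≤n))) ⟩
    1ℚ - u                       ≡⟨ cong (λ z → 1ℚ - z) (1-log-ratio m) ⟨
    1ℚ - (1ℚ - r)                ≡⟨ solve 1 (λ r → con 1ℚ :- (con 1ℚ :- r) := con 0ℚ :+ r :* con 1ℚ :* con 1ℚ) refl r ⟩
    Σ< 1 (log-term m)            ≤⟨ Σ-mono-range (log-term≥0 m) 1≤N ⟩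
    Σ< N (log-term m)            ∎
    where
    open ≤-Reasoning
    r u : ℚ
    r = log-ratio m
    u = inv (ι (suc m))

  ≤-maxᵥ : ∀ {A : Set} (f : A → ℝ) m {a} xs → a ∈ˡ xs → seq (f a) m ≤ seq (foldr _⊔ℝ_ 0ℝ (map f xs)) m
  ≤-maxᵥ f m (x ∷ xs) (here refl) = p≤p⊔q (seq (f x) m) (seq (foldr _⊔ℝ_ 0ℝ (map f xs)) m)
  ≤-maxᵥ f m (x ∷ xs) (there a∈)  = ≤-trans (≤-maxᵥ f m xs a∈) (p≤q⊔p (seq (f x) m) (seq (foldr _⊔ℝ_ 0ℝ (map f xs)) m))

  maxᵥ-≤ : ∀ {A : Set} (f : A → ℝ) m {B} xs → 0ℚ ≤ B → (∀ a → seq (f a) m ≤ B) → seq (foldr _⊔ℝ_ 0ℝ (map f xs)) m ≤ B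
  maxᵥ-≤ f m []       0≤B h = 0≤B
  maxᵥ-≤ f m (x ∷ xs) 0≤B h = ⊔-lub {_} {seq (f x) m} (h x) (maxᵥ-≤ f m xs 0≤B h)

  module _ {n : ℕ} (G : Graph n) (2≤n : 2 ℕ.≤ n) where

    private
      d : ℕ
      d = δ G

      0<d : 0ℚ < ι d
      0<d = ι>0 (δ>0 G 2≤n)

      v₀ : Fin n
      v₀ = some-vertex 2≤n

    open Truncated (walk-next G) (λ s → full? G (proj₂ s)) using () renaming (𝔼[T∧_] to 𝔼[cover∧_]; 𝔼∧-limit to cover-limit)
    open Truncated (push-next G) (full? G) using () renaming (partial-𝔼≤𝔼∧ to partial-push≤)

    -- One more than the integer part of 8 n / δ. The extra phase costs δ ≤ n in the product, whence
    -- 9 n.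
    phases : ∃[ q ] (8 ℕ.* n ℕ.≤ q ℕ.* d × q ℕ.* d ℕ.≤ 9 ℕ.* n)
    phases = suc (8 ℕ.* n / d) , lower , upper
      where
      instance
        d≢0 : ℕ.NonZero d
        d≢0 = ℕ.>-nonZero (δ>0 G 2≤n)
      lower : 8 ℕ.* n ℕ.≤ d ℕ.+ 8 ℕ.* n / d ℕ.* d
      lower = ℕₚ.≤-trans (ℕₚ.≤-reflexive (m≡m%n+[m/n]*n (8 ℕ.* n) d)) (ℕₚ.+-monoˡ-≤ (8 ℕ.* n / d ℕ.* d) (ℕₚ.<⇒≤ (m%n<n (8 ℕ.* n) d)))
      upper : d ℕ.+ 8 ℕ.* n / d ℕ.* d ℕ.≤ 9 ℕ.* n
      upper = ℕₚ.+-mono-≤ (δ≤n G 2≤n) (m/n*n≤m (8 ℕ.* n) d)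

    module _ {k : ℕ} (0<k : 0 ℕ.< k) (Δ≤kδ : Δ G ℕ.≤ k ℕ.* d) {M : ℚ} (cover≤M : ∀ N v → 𝔼[cover∧ N ] (v , ⁅ v ⁆) ≤ M) where

      0≤M : 0ℚ ≤ M
      0≤M = cover≤M 0 v₀

      -- The cut around a single vertex has at most Δ ≤ k δ edges, while the cut bound requires n δ
      -- ≤ 4 M · cut.
      n≤4kM : ι n ≤ ι 4 * ι k * M
      n≤4kM = cancelˡ (ι d) 0<d (begin
        ι d * ι n                                       ≡⟨ *-comm (ι d) (ι n) ⟩
        ι n * ι d                                       ≤⟨ cut-bound G 2≤n cover≤M (is v₀) {v₀} {proj₁ w} (dec-true (v₀ ≟ v₀) refl) (dec-false (v₀ ≟ proj₁ w) (proj₂ w ∘ sym)) ⟩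
        ι 4 * (M * edges G (is v₀) (not ∘ is v₀))       ≡⟨ cong (λ z → ι 4 * (M * z)) (∑-is v₀ (into G (not ∘ is v₀))) ⟩
        ι 4 * (M * into G (not ∘ is v₀) v₀)             ≤⟨ *-monoˡ (ι 4) (ι≥0 4) (*-monoˡ M 0≤M into≤) ⟩
        ι 4 * (M * (ι k * ι d))                         ≡⟨ solve 3 (λ m k d → con (ι 4) :* (m :* (k :* d)) := d :* (con (ι 4) :* k :* m)) refl M (ι k) (ι d) ⟩
        ι d * (ι 4 * ι k * M)                           ∎)
        where
        open ≤-Reasoning
        w = other-vertex 2≤n v₀
        into≤ : into G (not ∘ is v₀) v₀ ≤ ι k * ι d
        into≤ = ≤-trans (into≤deg G (not ∘ is v₀) v₀) (≤-trans (ι-mono (ℕₚ.≤-trans (degree≤Δ G v₀) Δ≤kδ)) (≤-reflexive (ι-* k d)))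

      module _ {L : ℚ} (H≤L+1 : H n ≤ L + 1ℚ) (½≤L : ½ ≤ L) where

        private
          p q X : ℚ
          p = P G 2≤n k Δ≤kδ 0≤M (cut-bound G 2≤n cover≤M)
          q = ι (proj₁ phases)
          X = ι k * ι k * (M * L)

          0≤L : 0ℚ ≤ L
          0≤L = ≤-trans (<⇒≤ 0<½) ½≤L

          1≤2L : 1ℚ ≤ ι 2 * L
          1≤2L = *-monoˡ (ι 2) (ι≥0 2) ½≤L

          1≤k : 1ℚ ≤ ι k
          1≤k = ι-mono 0<k

          H≤3L : H n ≤ ι 3 * L
          H≤3L = ≤-trans H≤L+1 (≤-trans (+-monoʳ-≤ L 1≤2L) (≤-reflexive (solve 1 (λ l → l :+ con (ι 2) :* l := con (ι 3) :* l) refl L)))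

          4kM≤8X : ι 4 * ι k * M ≤ ι 8 * X
          4kM≤8X = begin
            ι 4 * ι k * M                      ≡⟨ *-identityʳ (ι 4 * ι k * M) ⟨
            ι 4 * ι k * M * 1ℚ                 ≤⟨ *-monoˡ (ι 4 * ι k * M) 0≤4kM 1≤2L ⟩
            ι 4 * ι k * M * (ι 2 * L)          ≡⟨ solve 3 (λ k m l → con (ι 4) :* k :* m :* (con (ι 2) :* l) := con (ι 8) :* (con 1ℚ :* k :* (m :* l))) refl (ι k) M L ⟩
            ι 8 * (1ℚ * ι k * (M * L))         ≤⟨ *-monoˡ (ι 8) (ι≥0 8) (*-monoʳ (M * L) (*≥0 0≤M 0≤L) (*-monoʳ (ι k) (ι≥0 k) 1≤k)) ⟩
            ι 8 * X                            ∎
            where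
            open ≤-Reasoning
            0≤4kM : 0ℚ ≤ ι 4 * ι k * M
            0≤4kM = *≥0 (*≥0 (ι≥0 4) (ι≥0 k)) 0≤M

          nH≤ : ι n * (ι 16 * ι k * H n) ≤ ι 192 * X
          nH≤ = begin
            ι n * (ι 16 * ι k * H n)                       ≤⟨ *-monoʳ (ι 16 * ι k * H n) (*≥0 (*≥0 (ι≥0 16) (ι≥0 k)) (H≥0 n)) n≤4kM ⟩
            ι 4 * ι k * M * (ι 16 * ι k * H n)             ≤⟨ *-monoˡ (ι 4 * ι k * M) (*≥0 (*≥0 (ι≥0 4) (ι≥0 k)) 0≤M) (*-monoˡ (ι 16 * ι k) (*≥0 (ι≥0 16) (ι≥0 k)) H≤3L) ⟩
            ι 4 * ι k * M * (ι 16 * ι k * (ι 3 * L))       ≡⟨ solve 3 (λ k m l → con (ι 4) :* k :* m :* (con (ι 16) :* k :* (con (ι 3) :* l)) := con (ι 192) :* (k :* k :* (m :* l))) refl (ι k) M L ⟩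
            ι 192 * X                                      ∎
            where open ≤-Reasoning

          -- Multiplication by n cancels the 1/n in γ and leaves three summands. The harmonic one
          -- gives 192 = 4 · 16 · 3, from n ≤ 4 k M and H n ≤ 3 L; the summands n and 4 k M give 8
          -- each, from 1 ≤ 2 L and 1 ≤ k.
          np≤ : ι n * p ≤ ι 208 * X
          np≤ = begin
            ι n * p
              ≡⟨ solve 5 (λ n k h m i → n :* (con (ι 8) :* k :* h :+ (con (ι 8) :* k :* h :+ (con 1ℚ :+ con (ι 4) :* k :* m :* i))) := n :* (con (ι 16) :* k :* h) :+ n :+ con (ι 4) :* k :* m :* (n :* i)) refl (ι n) (ι k) (H n) M (inv (ι n)) ⟩
            ι n * (ι 16 * ι k * H n) + ι n + ι 4 * ι k * M * (ι n * inv (ι n))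
              ≡⟨ cong (λ z → ι n * (ι 16 * ι k * H n) + ι n + ι 4 * ι k * M * z) (*-inv (ι>0 (ℕₚ.<⇒≤ 2≤n))) ⟩
            ι n * (ι 16 * ι k * H n) + ι n + ι 4 * ι k * M * 1ℚ
              ≤⟨ +-mono-≤ (+-mono-≤ nH≤ (≤-trans n≤4kM 4kM≤8X)) (≤-trans (≤-reflexive (*-identityʳ (ι 4 * ι k * M))) 4kM≤8X) ⟩
            ι 192 * X + ι 8 * X + ι 8 * X
              ≡⟨ solve 1 (λ x → con (ι 192) :* x :+ con (ι 8) :* x :+ con (ι 8) :* x := con (ι 208) :* x) refl X ⟩
            ι 208 * X ∎
            where open ≤-Reasoning

        -- At most 9 n / δ phases of expected length at most P, and 1872 = 9 · 208. The estimate
        -- holds at every index m, since each partial sum is below a truncated expectation.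
        RBA-bound : ∀ m → ι d * seq (𝔼[RBA] G) m ≤ ι 1872 * (ι k * ι k) * (M * L)
        RBA-bound m = begin
          ι d * seq (𝔼[RBA] G) m          ≤⟨ *-monoˡ (ι d) (ι≥0 d) (maxᵥ-≤ (broadcast-time G) m (allFin n) (*≥0 (ι≥0 (proj₁ phases)) 0≤p) each) ⟩
          ι d * (q * p)                   ≡⟨ solve 3 (λ d q p → d :* (q :* p) := q :* d :* p) refl (ι d) q p ⟩
          q * ι d * p                     ≤⟨ *-monoʳ p 0≤p (≤-trans (≤-reflexive (sym (ι-* (proj₁ phases) d))) (≤-trans (ι-mono (proj₂ (proj₂ phases))) (≤-reflexive (ι-* 9 n)))) ⟩
          ι 9 * ι n * p                   ≡⟨ *-assoc (ι 9) (ι n) p ⟩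
          ι 9 * (ι n * p)                 ≤⟨ *-monoˡ (ι 9) (ι≥0 9) np≤ ⟩
          ι 9 * (ι 208 * X)               ≡⟨ solve 2 (λ k y → con (ι 9) :* (con (ι 208) :* (k :* y)) := con (ι 1872) :* k :* y) refl (ι k * ι k) (M * L) ⟩
          ι 1872 * (ι k * ι k) * (M * L)  ∎
          where
          open ≤-Reasoning
          0≤p : 0ℚ ≤ p
          0≤p = 0≤P G 2≤n k Δ≤kδ 0≤M (cut-bound G 2≤n cover≤M)
          each : ∀ s → seq (broadcast-time G s) m ≤ q * p
          each s = ≤-trans (partial-push≤ m ⁅ s ⁆)
            (push-bound G 2≤n k Δ≤kδ 0≤M (cut-bound G 2≤n cover≤M) (proj₁ phases) ⁅ s ⁆ {s} (∈⇒member {I = ⁅ s ⁆} {s} (Subₚ.x∈⁅x⁆ s))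
              (ℕₚ.≤-trans (proj₁ (proj₂ phases)) (ℕₚ.m≤m+n (proj₁ phases ℕ.* d) (8 ℕ.* # (member ⁅ s ⁆)))) m)

    -- Provides a rational M for the cut bound that is valid for all truncations and starting
    -- vertices, yet close to any late entry of `COV`. Half of ε goes into replacing the truncated
    -- time by a late partial sum, half into moving from that index to m.
    cover≤COV+ : ∀ {ε} → 0ℚ < ε → ∃[ N₀ ] (∀ m → N₀ ℕ.≤ m → ∀ N v → 𝔼[cover∧ N ] (v , ⁅ v ⁆) ≤ seq (COV G) m + ε)
    cover≤COV+ {ε} 0<ε = N₀ , bound
      where
      open ≤-Reasoning
      0<½ε : 0ℚ < ½ * ε
      0<½ε = *>0 0<½ 0<ε
      N₀ : ℕ
      N₀ = proj₁ (cauchy (COV G) (½ * ε) 0<½ε)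
      bound : ∀ m → N₀ ℕ.≤ m → ∀ N v → 𝔼[cover∧ N ] (v , ⁅ v ⁆) ≤ seq (COV G) m + ε
      bound m N₀≤m N v = begin
        𝔼[cover∧ N ] (v , ⁅ v ⁆)          ≤⟨ proj₂ (proj₂ limit) ⟩
        seq (cover-time G v) m′ + ½ * ε   ≤⟨ +-monoˡ-≤ (½ * ε) (≤-maxᵥ (cover-time G) m′ (allFin n) (∈ₚ.∈-allFin v)) ⟩
        seq (COV G) m′ + ½ * ε            ≤⟨ +-monoˡ-≤ (½ * ε) (∣∣-elim (seq (COV G) m′) (seq (COV G) m)
                                               (proj₂ (cauchy (COV G) (½ * ε) 0<½ε) m′ m (ℕₚ.≤-trans N₀≤m (proj₁ (proj₂ limit))) N₀≤m)) ⟩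
        seq (COV G) m + ½ * ε + ½ * ε     ≡⟨ +-assoc (seq (COV G) m) (½ * ε) (½ * ε) ⟩
        seq (COV G) m + (½ * ε + ½ * ε)   ≡⟨ cong (seq (COV G) m +_) (½+½ ε) ⟩
        seq (COV G) m + ε                 ∎
        where
        limit = cover-limit (walk-absorbing G) {v , ⁅ v ⁆} (Subₚ.x∈⁅x⁆ v) N m 0<½ε
        m′ : ℕ
        m′ = proj₁ limit

  -- The hypotheses give M / Z ≥ d / (K L), and d ≤ n turns d into d² / n. W and Z stand for entries
  -- of `COV` and `𝔼[RBA]`; M exceeds W by ε e, which costs at most ε after division by Z ≥ e.
  quotient-bound : ∀ {K d n L M Z W e ε} → 0ℚ < K → 0ℚ ≤ d → d ≤ n → 0ℚ < n → 0ℚ < L → 0ℚ ≤ M → 0ℚ < e → e ≤ Z → 0ℚ ≤ ε →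
                   M ≡ W + ε * e → d * Z ≤ K * (M * L) → inv K * (d * d * inv n) * (1ℚ * inv L) ≤ W * inv Z + ε
  quotient-bound {K} {d} {n} {L} {M} {Z} {W} {e} {ε} 0<K 0≤d d≤n 0<n 0<L 0≤M 0<e e≤Z 0≤ε M≡ dZ≤ = begin
      inv K * (d * d * inv n) * (1ℚ * inv L)
        ≡⟨ solve 4 (λ k d n l → k :* (d :* d :* n) :* (con 1ℚ :* l) := d :* d :* con 1ℚ :* (k :* n :* l)) refl (inv K) d (inv n) (inv L) ⟩
      d * d * 1ℚ * c
        ≡⟨ cong (λ z → d * d * z * c) (*-inv 0<Z) ⟨
      d * d * (Z * inv Z) * c
        ≡⟨ solve 4 (λ d z i c → d :* d :* (z :* i) :* c := d :* (d :* z) :* (i :* c)) refl d Z (inv Z) c ⟩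
      d * (d * Z) * (inv Z * c)
        ≤⟨ *-monoʳ (inv Z * c) 0≤i (≤-trans (*-monoˡ d 0≤d dZ≤) (*-monoʳ (K * (M * L)) (*≥0 (<⇒≤ 0<K) (*≥0 0≤M (<⇒≤ 0<L))) d≤n)) ⟩
      n * (K * (M * L)) * (inv Z * c)
        ≡⟨ solve 8 (λ n k m l z n′ k′ l′ → n :* (k :* (m :* l)) :* (z :* (k′ :* n′ :* l′)) := m :* z :* (k :* k′) :* (n :* n′) :* (l :* l′)) refl n K M L (inv Z) (inv n) (inv K) (inv L) ⟩
      M * inv Z * (K * inv K) * (n * inv n) * (L * inv L)
        ≡⟨ cong₂ (λ a b → M * inv Z * a * b * (L * inv L)) (*-inv 0<K) (*-inv 0<n) ⟩
      M * inv Z * 1ℚ * 1ℚ * (L * inv L)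
        ≡⟨ cong₂ (λ a b → a * inv Z * 1ℚ * 1ℚ * b) M≡ (*-inv 0<L) ⟩
      (W + ε * e) * inv Z * 1ℚ * 1ℚ * 1ℚ
        ≡⟨ solve 4 (λ w ε e z → (w :+ ε :* e) :* z :* con 1ℚ :* con 1ℚ :* con 1ℚ := w :* z :+ ε :* (e :* z)) refl W ε e (inv Z) ⟩
      W * inv Z + ε * (e * inv Z)
        ≤⟨ +-monoʳ-≤ (W * inv Z) (*-monoˡ ε 0≤ε (≤-trans (*-monoʳ (inv Z) (<⇒≤ (inv>0 0<Z)) e≤Z) (≤-reflexive (*-inv 0<Z)))) ⟩
      W * inv Z + ε * 1ℚ
        ≡⟨ cong (W * inv Z +_) (*-identityʳ ε) ⟩
      W * inv Z + ε ∎
    where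
    open ≤-Reasoning
    c : ℚ
    c = inv K * inv n * inv L
    0<Z : 0ℚ < Z
    0<Z = <-≤-trans 0<e e≤Z
    0≤i : 0ℚ ≤ inv Z * c
    0≤i = *≥0 (<⇒≤ (inv>0 0<Z)) (*≥0 (*≥0 (<⇒≤ (inv>0 0<K)) (<⇒≤ (inv>0 0<n))) (<⇒≤ (inv>0 0<L)))

  -- k is an integer above the late entries of c. The real inequality only yields a ≤ k b + ε; for ε
  -- = ½ integrality removes the error.
  ratio-bound : ∀ (c : ℝ) → ∃[ k ] (0 ℕ.< k × (∀ a b → fromℕ a ≤ℝ c *ℝ fromℕ b → a ℕ.≤ k ℕ.* b))
  ratio-bound c = k , 0<k , λ a b h → ℕₚ.≮⇒≥ (λ kb<a → <-irrefl refl (<-≤-trans 0<½ (½≤0 a b kb<a (a≤ a b h))))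
    where
    open ≤-Reasoning
    bounded = eventually-bounded c
    B : ℚ
    B = proj₁ bounded
    N k : ℕ
    N = proj₁ (proj₂ bounded)
    k = proj₁ (archimedean B 0<1)
    B≤ιk : B ≤ ι k
    B≤ιk = ≤-trans (proj₂ (archimedean B 0<1)) (≤-reflexive (*-identityʳ (ι k)))
    0<k : 0 ℕ.< k
    0<k = ℕₚ.n≢0⇒n>0 λ k≡0 → <-irrefl refl (<-≤-trans (proj₁ (proj₂ (proj₂ bounded))) (≤-trans B≤ιk (≤-reflexive (cong ι k≡0))))
    a≤ : ∀ a b → fromℕ a ≤ℝ c *ℝ fromℕ b → ι a ≤ ι k * ι b + ½
    a≤ a b h = begin
      ι a                    ≤⟨ proj₂ (h ½ 0<½) m (ℕₚ.m≤n+m (proj₁ (h ½ 0<½)) N) ⟩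
      seq c m * ι b + ½      ≤⟨ +-monoˡ-≤ ½ (*-monoʳ (ι b) (ι≥0 b) (≤-trans (≤∣∣ (seq c m)) (≤-trans (proj₂ (proj₂ (proj₂ bounded)) m (ℕₚ.m≤m+n N (proj₁ (h ½ 0<½)))) B≤ιk))) ⟩
      ι k * ι b + ½          ∎
      where
      m : ℕ
      m = N ℕ.+ proj₁ (h ½ 0<½)
    ½≤0 : ∀ a b → k ℕ.* b ℕ.< a → ι a ≤ ι k * ι b + ½ → ½ ≤ 0ℚ
    ½≤0 a b kb<a a≤ = ≤-by (ι k * ι b + ½ - (1ℚ + ι k * ι b)) (solve 1 (λ x → con 0ℚ := con ½ :+ (x :+ con ½ :- (con 1ℚ :+ x))) refl (ι k * ι b))
      (diff≥0 (≤-trans (≤-reflexive (trans (cong (1ℚ +_) (sym (ι-* k b))) (sym (ι-suc (k ℕ.* b))))) (≤-trans (ι-mono kb<a) a≤)))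

  module _ (c : ℝ) where

    k : ℕ
    k = proj₁ (ratio-bound c)

    0<k : 0 ℕ.< k
    0<k = proj₁ (proj₂ (ratio-bound c))

    K : ℚ
    K = ι 1872 * (ι k * ι k)

    0<K : 0ℚ < K
    0<K = *>0 (0<ι-suc 1871) (*>0 (ι>0 0<k) (ι>0 0<k))

    module _ {n : ℕ} (2≤n : 2 ℕ.≤ n) (G : Graph n) (Δ≤cδ : fromℕ (Δ G) ≤ℝ c *ℝ fromℕ (δ G)) where

      lower-bound : fromℚ (inv K) *ℝ (fromℕ (δ G ℕ.^ 2) ÷ fromℕ n [ fromℕ>0 (ℕₚ.<⇒≤ 2≤n) ]) *ℝ (1ℝ ÷ log n [ log>0 2≤n ]) ≤ℝ ℛ G 2≤n
      -- Beyond N₁ the entries of `𝔼[RBA]` are at least e; beyond N₂ those of `COV` plus ε e bound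
      -- all truncated cover times; beyond n the partial sums of `log n` are at least H n - 1.
      lower-bound ε 0<ε = N₁ ℕ.+ (N₂ ℕ.+ n) , λ m N≤m → bound m
          (ℕₚ.≤-trans (ℕₚ.m≤m+n N₁ (N₂ ℕ.+ n)) N≤m)
          (ℕₚ.≤-trans (ℕₚ.≤-trans (ℕₚ.m≤m+n N₂ n) (ℕₚ.m≤n+m (N₂ ℕ.+ n) N₁)) N≤m)
          (ℕₚ.≤-trans (ℕₚ.≤-trans (ℕₚ.m≤n+m n N₂) (ℕₚ.m≤n+m (N₂ ℕ.+ n) N₁)) N≤m)
        where
        e : ℚ
        e = proj₁ (𝔼[RBA]>0 G 2≤n)
        0<e : 0ℚ < e
        0<e = proj₁ (proj₂ (𝔼[RBA]>0 G 2≤n))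
        cover≤ = cover≤COV+ G 2≤n (*>0 0<ε 0<e)
        N₁ N₂ : ℕ
        N₁ = proj₁ (proj₂ (proj₂ (𝔼[RBA]>0 G 2≤n)))
        N₂ = proj₁ cover≤
        1≤n : 1 ℕ.≤ n
        1≤n = ℕₚ.<⇒≤ 2≤n
        Δ≤kδ : Δ G ℕ.≤ k ℕ.* δ G
        Δ≤kδ = proj₂ (proj₂ (ratio-bound c)) (Δ G) (δ G) Δ≤cδ
        bound : ∀ m → N₁ ℕ.≤ m → N₂ ℕ.≤ m → n ℕ.≤ m →
                inv K * (ι (δ G ℕ.^ 2) * inv (ι n)) * (1ℚ * inv (seq (log n) m)) ≤ seq (COV G) m * inv (seq (𝔼[RBA] G) m) + ε
        bound m N₁≤m N₂≤m n≤m = subst (λ z → inv K * (z * inv (ι n)) * (1ℚ * inv (seq (log n) m)) ≤ seq (COV G) m * inv (seq (𝔼[RBA] G) m) + ε)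
            (sym (trans (ι-* (δ G) (δ G ℕ.* 1)) (cong (λ z → ι (δ G) * ι z) (ℕₚ.*-identityʳ (δ G)))))
            (quotient-bound {K} {ι (δ G)} {ι n} {seq (log n) m} {seq (COV G) m + ε * e} {seq (𝔼[RBA] G) m} {seq (COV G) m} {e} {ε}
              0<K (ι≥0 (δ G)) (ι-mono (δ≤n G 2≤n)) (ι>0 1≤n) (<-≤-trans 0<½ ½≤L)
              (0≤M G 2≤n 0<k Δ≤kδ (proj₂ cover≤ m N₂≤m)) 0<e
              (≤-trans (≤-reflexive (sym (+-identityˡ e))) (proj₂ (proj₂ (proj₂ (𝔼[RBA]>0 G 2≤n))) m N₁≤m)) (<⇒≤ 0<ε) refl
              (RBA-bound G 2≤n 0<k Δ≤kδ (proj₂ cover≤ m N₂≤m) (H≤log+1 1≤n n≤m) ½≤L m))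
          where
          ½≤L : ½ ≤ seq (log n) m
          ½≤L = ½≤log 2≤n (ℕₚ.≤-trans 1≤n n≤m)

open import Data.Nat.Base using (ℕ; _≤_; _^_)
open import Data.Nat.Properties using (<⇒≤)
open import Data.Product.Base using (Σ; _×_; _,_)
import Data.Rational.Properties as ℚₚ

corollary4p10 : (c : ℝ) → 1ℝ ≤ℝ c →
    Σ ℝ λ C → 0ℝ <ℝ C ×
    ((n : ℕ) (2≤n : 2 ≤ n) (G : Graph n) →
    fromℕ (Δ G) ≤ℝ c *ℝ fromℕ (δ G) →
    C *ℝ (fromℕ (δ G ^ 2) ÷ fromℕ n [ fromℕ>0 (<⇒≤ 2≤n) ]) *ℝ (1ℝ ÷ log n [ log>0 2≤n ])
    ≤ℝ ℛ G 2≤n)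
corollary4p10 c _ =
    fromℚ (inv (K c))
  , (inv (K c) , inv>0 (0<K c) , 0 , λ _ _ → ℚₚ.≤-reflexive (ℚₚ.+-identityˡ (inv (K c))))
  , λ n 2≤n G → lower-bound c 2≤n G
  where open Proof using (K; 0<K; lower-bound)
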